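{- Let $q$ be a prime power, $n\ge 1$, let $G=\operatorname{GU}(n,q)$ be the unitary group of a nondegenerate Hermitian form on $V=\mathbb{F}_{q^2}^n$, and let $C$ be a conjugacy class of $G$ with representative $g$. Let $o(C)$ be the number of orbits of the centralizer $C_G(g)$ on the quotient $V/[g,V]$, where $[g,V]=(I-g)V$. Let $\lambda=\lambda_{z-1}(C)$ be the partition whose parts are the sizes of the Jordan blocks of $g$ for the eigenvalue $1$ (the empty partition if $1$ is not an eigenvalue). Then \[ o(C)=1+q\,d(\lambda)-b(\lambda), \] where $d(\lambda)$ is the number of distinct part sizes of $\lambda$ and $b(\lambda)$ is the number of part sizes of $\lambda$ that occur with multiplicity exactly $1$.
   Context: $o(C)$ depends only on the conjugacy class $C$, not on the choice of $g\in C$. For the empty partition, $d=b=0$. -}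

module Defs where

open import Level using (Level; _⊔_) renaming (suc to lsuc)
open import Data.Nat as ℕ using (ℕ; zero; suc; _≤ᵇ_)
open import Data.Nat.Primality using (Prime)
open import Data.Bool using (Bool; true; false; if_then_else_; _∧_; _∨_; not)
open import Data.List using (List; []; _∷_; length; concatMap; map; filter; upTo; allFin; foldr)
import Data.List.Base as L
open import Data.List.Relation.Unary.Any using (Any)
open import Data.List.Relation.Unary.AllPairs using (AllPairs)
open import Data.Fin using (Fin; zero; suc)
open import Data.Product using (Σ; _×_; _,_; ∃)
open import Relation.Nullary using (¬_; does)
open import Relation.Binary.PropositionalEquality using (_≡_)
open import Relation.Binary using (Decidable)
open import Algebra.Bundles using (CommutativeRing)

IsPrimePower : ℕ → Set
IsPrimePower q = Σ ℕ λ p → Σ ℕ λ k → Prime p × (q ≡ p ℕ.^ suc k)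

record FiniteField (c ℓ : Level) : Set (lsuc (c ⊔ ℓ)) where
  field
    commRing : CommutativeRing c ℓ
  open CommutativeRing commRing public
  field
    0≉1      : ¬ (0# ≈ 1#)
    inverse  : ∀ x → ¬ (x ≈ 0#) → ∃ λ y → x * y ≈ 1#
    _≟_      : Decidable _≈_
    elems    : List Carrier
    complete : ∀ x → Any (x ≈_) elems
    distinct : AllPairs (λ a b → ¬ (a ≈ b)) elems

  order : ℕ
  order = length elems

anyB : ∀ {a} {A : Set a} → (A → Bool) → List A → Bool
anyB p = foldr (λ x r → p x ∨ r) false

allB : ∀ {a} {A : Set a} → (A → Bool) → List A → Bool
allB p = foldr (λ x r → p x ∧ r) true

countB : ∀ {a} {A : Set a} → (A → Bool) → List A → ℕ
countB p xs = length (L.filterᵇ p xs)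

allFuns : ∀ {a} {A : Set a} → List A → (n : ℕ) → List (Fin n → A)
allFuns xs zero    = (λ ()) ∷ []
allFuns xs (suc n) =
  concatMap (λ x → map (λ f → λ { zero → x ; (suc i) → f i }) (allFuns xs n)) xs

numClasses : ∀ {a} {A : Set a} → (A → A → Bool) → List A → ℕ
numClasses {A = A} R = go []
  where
  go : List A → List A → ℕ
  go prev []       = 0
  go prev (x ∷ xs) =
    (if anyB (λ w → R w x) prev then 0 else 1) ℕ.+ go (x ∷ prev) xs

module _ {c ℓ} (𝔽 : FiniteField c ℓ) where
  open FiniteField 𝔽 using (Carrier; _≈_; _+_; _*_; _-_; 0#; 1#; _≟_; elems; order)

  Vec : ℕ → Set c
  Vec n = Fin n → Carrier

  Mat : ℕ → Set c
  Mat n = Fin n → Fin n → Carrier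

  _==_ : Carrier → Carrier → Bool
  x == y = does (x ≟ y)

  sumF : ∀ {n} → (Fin n → Carrier) → Carrier
  sumF {zero}  f = 0#
  sumF {suc n} f = f zero + sumF (λ i → f (suc i))

  pow : Carrier → ℕ → Carrier
  pow x zero    = 1#
  pow x (suc k) = x * pow x k

  allVecs : (n : ℕ) → List (Vec n)
  allVecs n = allFuns elems n

  allMats : (n : ℕ) → List (Mat n)
  allMats n = allFuns (allVecs n) n

  vecEq : ∀ {n} → Vec n → Vec n → Bool
  vecEq {n} v w = allB (λ i → v i == w i) (allFin n)

  matEq : ∀ {n} → Mat n → Mat n → Bool
  matEq {n} A B = allB (λ i → vecEq (A i) (B i)) (allFin n)

  app : ∀ {n} → Mat n → Vec n → Vec n
  app A v i = sumF (λ j → A i j * v j)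

  mmul : ∀ {n} → Mat n → Mat n → Mat n
  mmul A B i k = sumF (λ j → A i j * B j k)

  vsub : ∀ {n} → Vec n → Vec n → Vec n
  vsub v w i = v i - w i

  isZero : ∀ {n} → Vec n → Bool
  isZero v = vecEq v (λ _ → 0#)

  IminusG : ∀ {n} → Mat n → Vec n → Vec n
  IminusG g v = vsub v (app g v)

  iter : ∀ {n} → ℕ → (Vec n → Vec n) → Vec n → Vec n
  iter zero    f v = v
  iter (suc k) f v = f (iter k f v)

  -- Hermitian forms over 𝔽 = 𝔽_{q²}; conjugation is x ↦ x^q

  module Herm (q : ℕ) (n : ℕ) (H : Mat n) where

    conj : Carrier → Carrier
    conj x = pow x q

    form : Vec n → Vec n → Carrier
    form v w = sumF (λ i → sumF (λ j → conj (v i) * H i j * w j))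

    IsHermitian : Set ℓ
    IsHermitian = ∀ i j → H j i ≈ conj (H i j)

    IsNondegenerate : Set (c ⊔ ℓ)
    IsNondegenerate = ∀ v → (∀ w → form v w ≈ 0#) → ∀ i → v i ≈ 0#

    -- g ∈ GU(V, B): g preserves the form (such g is automatically invertible)
    inGU : Mat n → Bool
    inGU g = allB (λ v → allB (λ w → form (app g v) (app g w) == form v w)
                                (allVecs n)) (allVecs n)

    InGU : Mat n → Set
    InGU g = inGU g ≡ true

    inCent : Mat n → Mat n → Bool
    inCent g h = inGU h ∧ matEq (mmul h g) (mmul g h)

    -- v ~ w iff some h ∈ C_G(g) maps the coset v + [g,V] to w + [g,V]
    orbitRel : Mat n → Vec n → Vec n → Bool
    orbitRel g v w =
      anyB (λ h → inCent g h ∧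
                  anyB (λ u → vecEq (vsub (app h v) w) (IminusG g u)) (allVecs n))
           (allMats n)

    o : Mat n → ℕ
    o g = numClasses (orbitRel g) (allVecs n)

    -- dimension of a subspace from its cardinality Q^dim (Q = |𝔽|):
    -- the number of e ∈ {1..n} with Q^e ≤ |W|
    dimFromCard : ℕ → ℕ
    dimFromCard N = countB (λ e → order ℕ.^ suc e ≤ᵇ N) (upTo n)

    N : Mat n → ℕ → ℕ
    N g k = dimFromCard (countB (λ v → isZero (iter k (IminusG g) v)) (allVecs n))

    -- number of Jordan blocks of size exactly k (k ≥ 1) for eigenvalue 1:
    -- (N_k - N_{k-1}) - (N_{k+1} - N_k)
    mult : Mat n → ℕ → ℕ
    mult g zero    = 0
    mult g (suc k) = (N g (suc k) ℕ.∸ N g k) ℕ.∸ (N g (suc (suc k)) ℕ.∸ N g (suc k))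

    d : Mat n → ℕ
    d g = countB (λ k → not (mult g (suc k) ℕ.≡ᵇ 0)) (upTo n)

    b : Mat n → ℕ
    b g = countB (λ k → mult g (suc k) ℕ.≡ᵇ 1) (upTo n)

{-# OPTIONS --safe #-}
-- Put N = 1 - g and K j = ker N^j, and call two vectors equivalent when an element of the
-- centralizer of g carries one coset of N V to the other.  Every coset outside N V meets K (suc j)
-- outside K j + N V for exactly one j.  There x ↦ B(x , N^j x) is, up to a scalar σ j, the value of
-- a hermitian form with radical K j + N V, and this value is constant on equivalence classes.
-- Conversely two such vectors v, w with the same value are equivalent: with u = v - w one builds
-- a self-adjoint operator Θ commuting with g and with Θ x ≡ ⟨u , x⟩ u modulo N V, and for a suitable
-- scalar a the Cayley transform (1 + a Θ)⁻¹ (1 + ā Θ) maps v to w modulo N V.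
-- The hermitian space K (suc j) / (K j + N V) has as dimension the multiplicity m of suc j in λ, so it
-- contributes no class if m = 0, the q - 1 nonzero values if m = 1, and all q values if m ≥ 2,
-- since then it contains nonzero isotropic vectors.
module Submission where

open import Defs
open import Level using (Level; _⊔_) renaming (suc to lsuc)
open import Data.Nat.Base as ℕ using (ℕ; zero; suc; z≤n; s≤s)
import Data.Nat.Properties as ℕₚ
import Data.Nat.Solver
open import Data.Bool.Base as Bool using (Bool; true; false; if_then_else_; _∧_; not)
open import Data.List.Base as List using (List; []; _∷_; length; map; filter; _++_; allFin; replicate; upTo; _∷ʳ_)
open import Data.List.Relation.Unary.Any as Any using (Any; here; there; any?)
import Data.List.Relation.Unary.Any.Properties as Anyₚ
open import Data.List.Relation.Unary.All as All using (All; []; _∷_)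
import Data.List.Relation.Unary.All.Properties as Allₚ
open import Data.List.Relation.Unary.AllPairs as AllPairs using (AllPairs; []; _∷_)
import Data.List.Relation.Unary.AllPairs.Properties as AllPairsₚ
open import Data.List.Membership.Propositional using (_∈_; find)
open import Data.List.Membership.Propositional.Properties using (∈-allFin; ∈-filter⁻)
import Data.List.Properties as Listₚ
open import Data.Fin.Base as Fin using (Fin; zero; suc)
open import Data.Product.Base using (∃; _×_; _,_; proj₁; proj₂)
open import Data.Sum.Base using (_⊎_; inj₁; inj₂; [_,_]′)
open import Data.Empty using (⊥)
open import Relation.Nullary using (¬_; Dec; yes; no; does; contradiction; ¬?)
open import Relation.Nullary.Decidable using (dec-true; dec-false; decidable-stable; _×-dec_)
import Relation.Unary as U
open import Relation.Binary.PropositionalEquality as ≡ using (_≡_)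
open import Function.Base using (_∘_; id; flip)
open import Relation.Binary.Bundles using (Setoid)
open import Relation.Binary.Structures using (IsEquivalence)
open import Relation.Binary.Definitions using (Decidable; tri<; tri≈; tri>; Tri)
open import Algebra.Bundles using (CommutativeRing; RawRing; CommutativeMonoid)
open import Data.Nat.Primality using (Prime; euclidsLemma; prime⇒nonTrivial)
open import Data.Nat.Divisibility as ∣ using (_∣_; divides)
open import Data.Nat.Combinatorics using (_C_; nCn≡1)
import Data.Fin.Properties as Finₚ
import Relation.Binary.Reasoning.Setoid as SetoidReasoning

-- The centralizer of a general `g` has no handy description, so transitivity is shown by exhibiting
-- single elements of it. For g = 1 a quasi-reflection or transvection along u would do; in general
-- such a map does not commute with `g`. Θ therefore replaces x ↦ B(u , x) u by a sum over powers of
-- `N` whose commutator with `N` telescopes away. The Cayley transform treats all characteristics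
-- alike, 2 included. Its scalar a is found only if v - w pairs nontrivially with v; when that
-- pairing vanishes, w is reached through an intermediate vector of the same value. `N` is nilpotent
-- only on the spaces K j, yet V is never split by eigenvalues: the duality (ker N^j)^⊥ = im N^j, a
-- consequence of -G⁻¹N being the adjoint of `N`, is what ties cosets of N V to the K j. The scalar
-- σ j absorbs the sign (-1)^j that N^j acquires when it moves across B. Dimensions are read off
-- from cardinalities throughout, which matches the way block multiplicities are defined.

private
  module NS = Data.Nat.Solver.+-*-Solver

-- Counting in lists, and the number of classes of a Boolean relation

module _ where
  private variable
    a b r e p : Level
    A : Set a
    B : Set b

  remove-at : {P : B → Set p} (ys : List B) (i : Any P ys) →
    length ys ≡ suc (length (ys Any.─ i))
  remove-at (y ∷ ys) (here _)  = ≡.refl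
  remove-at (y ∷ ys) (there i) = ≡.cong suc (remove-at ys i)

  keep-or-hit : {P : B → Set p} {Q : B → Set r} (ys : List B) (i : Any P ys) → Any Q ys →
    Q (Any.lookup i) ⊎ Any Q (ys Any.─ i)
  keep-or-hit (y ∷ ys) (here _)  (here q)  = inj₁ q
  keep-or-hit (y ∷ ys) (here _)  (there j) = inj₂ j
  keep-or-hit (y ∷ ys) (there i) (here q)  = inj₂ (here q)
  keep-or-hit (y ∷ ys) (there i) (there j) with keep-or-hit ys i j
  ... | inj₁ q  = inj₁ q
  ... | inj₂ j′ = inj₂ (there j′)

  -- Each step deletes the partner of the head from `ys`. A relation in place of a function, and an
  -- arbitrary `E` in place of equality, make this applicable to lists over a setoid.
  pigeonhole : (R : A → B → Set r) (E : A → A → Set e) →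
    (∀ {x x′ y} → R x y → R x′ y → E x x′) →
    ∀ {xs ys} → AllPairs (λ x x′ → ¬ E x x′) xs → All (λ x → Any (R x) ys) xs →
    length xs ℕ.≤ length ys
  pigeonhole R E inj {[]} {ys} _ _ = z≤n
  pigeonhole {B = B} R E inj {x ∷ xs} {ys} (x∉ ∷ xs!) (i ∷ is) =
    ≡.subst (suc (length xs) ℕ.≤_) (≡.sym (remove-at ys i))
      (s≤s (pigeonhole R E inj xs! (All.zipWith move (x∉ , is))))
    where
    move : ∀ {x′} → (¬ E x x′) × Any (R x′) ys → Any (R x′) (ys Any.─ i)
    move (¬xx′ , j) with keep-or-hit ys i j
    ... | inj₁ q  = contradiction (inj (Anyₚ.lookup-result i) q) ¬xx′
    ... | inj₂ j′ = j′

  length-filter-split : {P : A → Set p} (P? : U.Decidable P) (xs : List A) →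
    length xs ≡ length (filter P? xs) ℕ.+ length (filter (¬? ∘ P?) xs)
  length-filter-split P? []       = ≡.refl
  length-filter-split P? (x ∷ xs) with does (P? x)
  ... | true  = ≡.cong suc (length-filter-split P? xs)
  ... | false = ≡.trans (≡.cong suc (length-filter-split P? xs)) (≡.sym (ℕₚ.+-suc _ _))

  module _ {P : A → Set p} (P? : U.Decidable P) where

    any-filter : {Q : A → Set r} {xs : List A} → Any Q xs → (∀ {x} → Q x → P x) →
      Any Q (filter P? xs)
    any-filter {xs = x ∷ xs} (here q) f with P? x
    ... | yes _ = here q
    ... | no ¬p = contradiction (f q) ¬p
    any-filter {xs = x ∷ xs} (there i) f with P? x
    ... | yes _ = there (any-filter i f)
    ... | no ¬p = any-filter i f

    all-filter : (xs : List A) → All P (filter P? xs)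
    all-filter = Allₚ.all-filter P?

  module _ {A : Set a} {B : Set b} (E : A → A → Set e) (R : A → B → Set r) (R? : ∀ x y → Dec (R x y)) where

    -- The fibre over the head of `ys` is split off and the remainder handled recursively. The bound
    -- speaks of all duplicate-free lists drawn from a fibre, not of one filtered list, so that it
    -- passes to `rest` unchanged.
    fibres-≤ : ∀ m (xs : List A) (ys : List B) → AllPairs (λ x x′ → ¬ E x x′) xs →
      All (λ x → Any (R x) ys) xs →
      (∀ y zs → AllPairs (λ x x′ → ¬ E x x′) zs → All (_∈ xs) zs → All (λ x → R x y) zs → length zs ℕ.≤ m) →
      length xs ℕ.≤ length ys ℕ.* m
    fibres-≤ m [] ys _ _ _ = z≤n
    fibres-≤ m (x ∷ xs) [] _ (() ∷ _) _
    fibres-≤ m xs@(_ ∷ _) (y ∷ ys) xs! hit bound = begin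
      length xs  ≡⟨ length-filter-split (flip R? y) xs ⟩
      length over ℕ.+ length rest  ≤⟨ ℕₚ.+-mono-≤
          (bound y over (AllPairsₚ.filter⁺ (flip R? y) xs!) (All.tabulate (proj₁ ∘ Memₚ-filter)) (Allₚ.all-filter (flip R? y) xs))
          (fibres-≤ m rest ys (AllPairsₚ.filter⁺ (¬? ∘ flip R? y) xs!) (All.tabulate hit′)
            (λ y′ zs zs! zs∈ → bound y′ zs zs! (All.map (proj₁ ∘ Memₚ-filter′) zs∈))) ⟩
      m ℕ.+ length ys ℕ.* m  ∎
      where
      open ℕₚ.≤-Reasoning
      open import Data.List.Membership.Propositional.Properties using (∈-filter⁻)
      over = filter (flip R? y) xs
      rest = filter (¬? ∘ flip R? y) xs
      Memₚ-filter : ∀ {x} → x ∈ over → x ∈ xs × R x y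
      Memₚ-filter = ∈-filter⁻ (flip R? y)
      Memₚ-filter′ : ∀ {x} → x ∈ rest → x ∈ xs × ¬ R x y
      Memₚ-filter′ = ∈-filter⁻ (¬? ∘ flip R? y)
      hit′ : ∀ {x} → x ∈ rest → Any (R x) ys
      hit′ x∈ with Memₚ-filter′ x∈
      ... | x∈xs , ¬Rxy with All.lookup hit x∈xs
      ...   | here Rxy = contradiction Rxy ¬Rxy
      ...   | there i  = i

    -- Disjointness keeps the later fibres intact when the first one is filtered out; this is the
    -- content of `same`.
    fibres-≥ : ∀ m (xs : List A) (ys : List B) →
      AllPairs (λ y y′ → ∀ x → R x y → ¬ R x y′) ys →
      (∀ y → y ∈ ys → m ℕ.≤ length (filter (λ x → R? x y) xs)) →
      length ys ℕ.* m ℕ.≤ length xs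
    fibres-≥ m xs [] _ _ = z≤n
    fibres-≥ m xs (y ∷ ys) (y∉ ∷ ys!) bound = begin
      m ℕ.+ length ys ℕ.* m  ≤⟨ ℕₚ.+-mono-≤ (bound y (here ≡.refl)) (fibres-≥ m rest ys ys! bound′) ⟩
      length (filter (flip R? y) xs) ℕ.+ length rest ≡⟨ length-filter-split (flip R? y) xs ⟨
      length xs  ∎
      where
      open ℕₚ.≤-Reasoning
      rest = filter (¬? ∘ flip R? y) xs
      same : ∀ y′ → (∀ x → R x y → ¬ R x y′) → ∀ xs →
        filter (flip R? y′) (filter (¬? ∘ flip R? y) xs) ≡ filter (flip R? y′) xs
      same y′ dis []       = ≡.refl
      same y′ dis (x ∷ xs) with R? x y
      ... | yes Rxy rewrite dec-false (R? x y′) (dis x Rxy) = same y′ dis xs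
      ... | no _ with does (R? x y′)
      ...   | true  = ≡.cong (x ∷_) (same y′ dis xs)
      ...   | false = same y′ dis xs
      bound′ : ∀ y′ → y′ ∈ ys → m ℕ.≤ length (filter (λ x → R? x y′) rest)
      bound′ y′ y′∈ = ≡.subst (λ l → m ℕ.≤ length l) (≡.sym (same y′ (All.lookup y∉ y′∈) xs))
        (bound y′ (there y′∈))

  anyB⁻ : (f : A → Bool) (xs : List A) → anyB f xs ≡ true → ∃ λ x → x ∈ xs × f x ≡ true
  anyB⁻ f (x ∷ xs) eq with f x in fx
  ... | true  = x , here ≡.refl , fx
  ... | false = let y , y∈ , fy = anyB⁻ f xs eq in y , there y∈ , fy

  anyB⁺ : (f : A → Bool) {x : A} {xs : List A} → x ∈ xs → f x ≡ true → anyB f xs ≡ true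
  anyB⁺ f (here ≡.refl) fx rewrite fx = ≡.refl
  anyB⁺ f {xs = y ∷ _} (there i) fx with f y
  ... | true  = ≡.refl
  ... | false = anyB⁺ f i fx

  allB⁻ : (f : A → Bool) {x : A} {xs : List A} → allB f xs ≡ true → x ∈ xs → f x ≡ true
  allB⁻ f {xs = y ∷ _} eq i with f y in fy
  allB⁻ f {xs = y ∷ _} eq (here ≡.refl) | true = fy
  allB⁻ f {xs = y ∷ _} eq (there i)   | true = allB⁻ f eq i

  allB⁺ : (f : A → Bool) (xs : List A) → (∀ {x} → x ∈ xs → f x ≡ true) → allB f xs ≡ true
  allB⁺ f []       h = ≡.refl
  allB⁺ f (x ∷ xs) h rewrite h (here ≡.refl) = allB⁺ f xs (h ∘ there)

  ∧⁻ : ∀ {x y} → x ∧ y ≡ true → x ≡ true × y ≡ true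
  ∧⁻ {true} eq = ≡.refl , eq

  ∧⁺ : ∀ {x y} → x ≡ true → y ≡ true → x ∧ y ≡ true
  ∧⁺ ≡.refl eq = eq

  does⁻ : {P : Set p} (P? : Dec P) → does P? ≡ true → P
  does⁻ (yes p) _ = p

  ≡-does : {P : Set p} {x : Bool} (P? : Dec P) → (x ≡ true → P) → (P → x ≡ true) → x ≡ does P?
  ≡-does (yes p) _ x⇐ = x⇐ p
  ≡-does {x = false} (no ¬p) _ _ = ≡.refl
  ≡-does {x = true}  (no ¬p) x⇒ _ = contradiction (x⇒ ≡.refl) ¬p

  module _ (R : A → A → Bool) where

    -- Follows the counter of `numClasses` but keeps the elements it counts. As there, `prev` holds
    -- every earlier element and not only the representatives.
    newReps : List A → List A → List A
    newReps prev []       = []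
    newReps prev (x ∷ xs) =
      if anyB (λ w → R w x) prev then newReps (x ∷ prev) xs else x ∷ newReps (x ∷ prev) xs

    -- The counter local to numClasses cannot be named; it is the solution of the
    -- metavariable here, found by abstracting over [] in numClasses-newReps.
    count-newReps : ∀ prev xs → _ ≡ length (newReps prev xs)
    numClasses-newReps : ∀ xs → numClasses R xs ≡ length (newReps [] xs)
    numClasses-newReps xs with (List A Function.Base.∋ [])
    ... | prev = count-newReps prev xs
    count-newReps prev [] = ≡.refl
    count-newReps prev (x ∷ xs) with anyB (λ w → R w x) prev
    ... | true  = count-newReps (x ∷ prev) xs
    ... | false = ≡.cong suc (count-newReps (x ∷ prev) xs)

  module _ {A : Set a} (R : A → A → Bool) (S : A → A → Set r)
    (R⇒S : ∀ {x y} → R x y ≡ true → S x y) (S⇒R : ∀ {x y} → S x y → R x y ≡ true)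
    (S-refl : ∀ {x} → S x x) (S-sym : ∀ {x y} → S x y → S y x)
    (S-trans : ∀ {x y z} → S x y → S y z → S x z) where

    private
      new-unrelated : ∀ prev xs → All (λ y → All (λ w → ¬ S w y) prev) (newReps R prev xs)
      new-unrelated prev [] = []
      new-unrelated prev (x ∷ xs) with anyB (λ w → R w x) prev in eq
      ... | true  = All.map (λ { (_ ∷ ws) → ws }) (new-unrelated (x ∷ prev) xs)
      ... | false = All.tabulate (λ w∈ s → case-⊥ (≡.trans (≡.sym eq) (anyB⁺ (λ w → R w x) w∈ (S⇒R s))))
                  ∷ All.map (λ { (_ ∷ ws) → ws }) (new-unrelated (x ∷ prev) xs)
        where
        case-⊥ : false ≡ true → ⊥
        case-⊥ ()

      newReps-unrelated : ∀ prev xs → AllPairs (λ x y → ¬ S x y) (newReps R prev xs)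
      newReps-unrelated prev [] = []
      newReps-unrelated prev (x ∷ xs) with anyB (λ w → R w x) prev
      ... | true  = newReps-unrelated (x ∷ prev) xs
      ... | false = All.map (λ { (¬s ∷ _) → ¬s }) (new-unrelated (x ∷ prev) xs)
                  ∷ newReps-unrelated (x ∷ prev) xs

      -- `ps` stands for the representatives found so far. Since `prev` also holds elements that
      -- were skipped, the invariant relating each of them to some member of `ps` is carried along;
      -- a skipped `x` is then covered by transitivity.
      newReps-cover : ∀ prev xs (ps : List A) → (∀ {w} → w ∈ prev → Any (λ r → S r w) ps) →
        ∀ {x} → x ∈ xs → Any (λ r → S r x) ps ⊎ Any (λ r → S r x) (newReps R prev xs)
      newReps-cover prev (x ∷ xs) ps inv i with anyB (λ w → R w x) prev in eq
      newReps-cover prev (x ∷ xs) ps inv i | true with anyB⁻ (λ w → R w x) prev eq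
      ... | w , w∈ , Rwx = go i
        where
        old : Any (λ r → S r x) ps
        old = Any.map (λ s → S-trans s (R⇒S Rwx)) (inv w∈)
        inv′ : ∀ {w} → w ∈ x ∷ prev → Any (λ r → S r w) ps
        inv′ (here ≡.refl) = old
        inv′ (there j)   = inv j
        go : ∀ {y} → y ∈ x ∷ xs → Any (λ r → S r y) ps ⊎ Any (λ r → S r y) (newReps R (x ∷ prev) xs)
        go (here ≡.refl) = inj₁ old
        go (there j)   = newReps-cover (x ∷ prev) xs ps inv′ j
      newReps-cover prev (x ∷ xs) ps inv (here ≡.refl) | false = inj₂ (here S-refl)
      newReps-cover prev (x ∷ xs) ps inv (there j)   | false
        with newReps-cover (x ∷ prev) xs (x ∷ ps)
               (λ { (here ≡.refl) → here S-refl ; (there k) → there (inv k) }) j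
      ... | inj₁ (here s)  = inj₂ (here s)
      ... | inj₁ (there k) = inj₁ k
      ... | inj₂ k         = inj₂ (there k)

    -- Two pigeonholes: the representatives embed into `as` because a shared invariant forces `S`,
    -- and `as` embeds into the representatives because `S` forces invariants to agree. With `G` a
    -- relation, an invariant can be certified by a witness instead of being computed.
    numClasses-invariants : {I : Set b} (G : A → I → Set p) (E : I → I → Set e) (xs : List A) (as : List I) →
      (∀ x → Any (G x) as) →
      (∀ {x y i} → G x i → G y i → S x y) →
      (∀ {x y i j} → S x y → G x i → G y j → E i j) →
      AllPairs (λ i j → ¬ E i j) as →
      All (λ i → ∃ λ x → x ∈ xs × G x i) as →
      numClasses R xs ≡ length as
    numClasses-invariants {I = I} G E xs as cover same inv as! real =
      ≡.trans (numClasses-newReps R xs) (ℕₚ.≤-antisym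
        (pigeonhole G S same (newReps-unrelated [] xs) (All.tabulate (λ {x} _ → cover x)))
        (pigeonhole (λ i x → ∃ λ y → G y i × S y x) E
          (λ { (_ , Gyi , Syx) (_ , Gzj , Szx) → inv (S-trans Syx (S-sym Szx)) Gyi Gzj }) as!
          (All.map represent real)))
      where
      represent : ∀ {i} → (∃ λ x → x ∈ xs × G x i) →
        Any (λ x → ∃ λ y → G y i × S y x) (newReps R [] xs)
      represent (x , x∈ , Gxi) with newReps-cover [] xs [] (λ ()) x∈
      ... | inj₂ k = Any.map (λ s → x , Gxi , S-sym s) k

-- Finite setoids and vectors over them

record IsFinite {c ℓ} (S : Setoid c ℓ) : Set (c ⊔ ℓ) where
  open Setoid S renaming (refl to ≈-refl; sym to ≈-sym; trans to ≈-trans)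
  field
    _≟_      : Decidable _≈_
    elems    : List Carrier
    complete : ∀ x → Any (x ≈_) elems
    distinct : AllPairs (λ x y → ¬ x ≈ y) elems

  any-elem : ∀ {p} {P : Carrier → Set p} → (∀ {x y} → x ≈ y → P x → P y) → ∃ P → Any P elems
  any-elem resp (x , px) = Any.map (λ x≈y → resp x≈y px) (complete x)

  ∃? : ∀ {p} {P : Carrier → Set p} → (∀ {x y} → x ≈ y → P x → P y) → U.Decidable P → Dec (∃ P)
  ∃? resp P? with any? P? elems
  ... | yes i = yes (Any.satisfied i)
  ... | no ¬i = no (¬i ∘ any-elem resp)

  -- A missed `y` would make `y ∷ map f elems` a list of pairwise distinct elements longer than
  -- `elems`.
  injective⇒surjective : (f : Carrier → Carrier) → (∀ {x y} → x ≈ y → f x ≈ f y) →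
    (∀ {x y} → f x ≈ f y → x ≈ y) → ∀ y → ∃ λ x → f x ≈ y
  injective⇒surjective f f-cong f-inj y
    with ∃? {P = λ x → f x ≈ y} (λ x≈x′ fx≈y → ≈-trans (f-cong (≈-sym x≈x′)) fx≈y) (λ x → f x ≟ y)
  ... | yes s = s
  ... | no ¬s = contradiction
    (pigeonhole _≈_ _≈_ (λ p q → ≈-trans p (≈-sym q)) y∷f! (All.tabulate (λ {x} _ → complete x)))
    (ℕₚ.<⇒≱ (ℕₚ.≤-reflexive (≡.cong suc (≡.sym (Listₚ.length-map f elems)))))
    where
    y∷f! : AllPairs (λ x y → ¬ x ≈ y) (y ∷ map f elems)
    y∷f! = Allₚ.map⁺ (All.tabulate (λ {x} _ y≈fx → ¬s (x , ≈-sym y≈fx)))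
         ∷ AllPairsₚ.map⁺ (AllPairs.map (λ x≉y fx≈fy → x≉y (f-inj fx≈fy)) distinct)

module _ {c ℓ} (S : Setoid c ℓ) where
  open Setoid S renaming (refl to ≈-refl; sym to ≈-sym; trans to ≈-trans)

  record Pointwise {n} (v w : Fin n → Carrier) : Set ℓ where
    constructor mk≋
    field at : ∀ i → v i ≈ w i
  open Pointwise public

  vecSetoid : ℕ → Setoid c ℓ
  vecSetoid n = record
    { Carrier = Fin n → Carrier ; _≈_ = Pointwise
    ; isEquivalence = record
      { refl = mk≋ λ _ → ≈-refl ; sym = λ p → mk≋ λ i → ≈-sym (at p i)
      ; trans = λ p q → mk≋ λ i → ≈-trans (at p i) (at q i) } }

module _ {c ℓ} {S : Setoid c ℓ} (fin : IsFinite S) where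
  open Setoid S renaming (refl to ≈-refl; sym to ≈-sym; trans to ≈-trans)
  open IsFinite fin

  -- The enumeration is `allFuns` itself, so `allVecs` is exhaustive and free of duplicates, and a
  -- second application says the same of `allMats`.
  vecFinite : ∀ n → IsFinite (vecSetoid S n)
  vecFinite n = record
    { _≟_ = dec ; elems = allFuns elems n ; complete = compl n ; distinct = dist n }
    where
    open import Data.Fin.Properties using (all?)
    dec : ∀ {n} → Decidable (Pointwise S {n})
    dec v w with all? (λ i → v i ≟ w i)
    ... | yes p = yes (mk≋ p)
    ... | no ¬p = no (¬p ∘ at)
    compl : ∀ n (v : Fin n → Carrier) → Any (Pointwise S v) (allFuns elems n)
    compl zero    v = here (mk≋ λ ())
    compl (suc n) v = Anyₚ.concatMap⁺ _ (Any.map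
      (λ v₀≈x → Anyₚ.map⁺ (Any.map (λ v′≋f → mk≋ λ { zero → v₀≈x ; (suc i) → at v′≋f i })
                            (compl n (v ∘ suc))))
      (complete (v zero)))
    dist : ∀ n → AllPairs (λ v w → ¬ Pointwise S v w) (allFuns elems n)
    dist zero    = [] ∷ []
    dist (suc n) = AllPairsₚ.concat⁺
      (Allₚ.map⁺ (All.tabulate λ _ →
        AllPairsₚ.map⁺ (AllPairs.map (λ f≠g eq → f≠g (mk≋ (at eq ∘ suc))) (dist n))))
      (AllPairsₚ.map⁺ (AllPairs.map
        (λ x≉y → Allₚ.map⁺ (All.tabulate λ _ → Allₚ.map⁺ (All.tabulate λ _ eq → x≉y (at eq zero))))
        distinct))

-- A ring solver with integer coefficients

module IntegerSolver {c ℓ} (R : CommutativeRing c ℓ) where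
  open CommutativeRing R hiding (zero)
  open import Algebra.Solver.Ring.AlmostCommutativeRing
  open import Algebra.Properties.Semiring.Mult.TCOptimised semiring renaming (_×_ to _·_)
  open import Algebra.Properties.Ring ring
  open import Data.Integer.Base as ℤ using (ℤ; +_; -[1+_]; _⊖_)
  import Data.Integer.Properties as ℤₚ
  open import Data.Maybe.Base using (Maybe; just; nothing)
  open import Relation.Binary.Reasoning.Setoid setoid

  private
    -- Integers as coefficients can be compared by computation, so identities with cancelling terms
    -- are solved over every commutative ring.
    ⟦_⟧ℤ : ℤ → Carrier
    ⟦ + n ⟧ℤ      = n · 1#
    ⟦ -[1+ n ] ⟧ℤ = - (suc n · 1#)

    cancel : ∀ a x y → (a + x) - (a + y) ≈ x - y
    cancel a x y = begin
      (a + x) - (a + y)  ≈⟨ +-cong (+-comm a x) (sym (-‿+-comm a y)) ⟩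
      (x + a) + (- a + - y)  ≈⟨ +-assoc x a _ ⟩
      x + (a + (- a + - y))  ≈⟨ +-congˡ (+-assoc a (- a) (- y)) ⟨
      x + ((a + - a) + - y)  ≈⟨ +-congˡ (+-congʳ (-‿inverseʳ a)) ⟩
      x + (0# + - y)  ≈⟨ +-congˡ (+-identityˡ _) ⟩
      x - y  ∎

    ⊖-homo : ∀ m n → ⟦ m ⊖ n ⟧ℤ ≈ m · 1# - n · 1#
    ⊖-homo m zero = begin
      m · 1#  ≈⟨ +-identityʳ _ ⟨
      m · 1# + 0#  ≈⟨ +-congˡ -0#≈0# ⟨
      m · 1# - 0#  ∎
    ⊖-homo zero (suc n) = sym (+-identityˡ _)
    ⊖-homo (suc m) (suc n) = begin
      ⟦ suc m ⊖ suc n ⟧ℤ  ≡⟨ ≡.cong ⟦_⟧ℤ (ℤₚ.[1+m]⊖[1+n]≡m⊖n m n) ⟩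
      ⟦ m ⊖ n ⟧ℤ  ≈⟨ ⊖-homo m n ⟩
      m · 1# - n · 1#  ≈⟨ cancel 1# _ _ ⟨
      (1# + m · 1#) - (1# + n · 1#) ≈⟨ +-cong (1+× m 1#) (-‿cong (1+× n 1#)) ⟨
      suc m · 1# - suc n · 1#  ∎

    +-homo : ∀ i j → ⟦ i ℤ.+ j ⟧ℤ ≈ ⟦ i ⟧ℤ + ⟦ j ⟧ℤ
    +-homo (+ m) (+ n) = ×-homo-+ 1# m n
    +-homo (+ m) -[1+ n ] = ⊖-homo m (suc n)
    +-homo -[1+ m ] (+ n) = trans (⊖-homo n (suc m)) (+-comm _ _)
    +-homo -[1+ m ] -[1+ n ] = begin
      - (suc (suc (m ℕ.+ n)) · 1#)  ≡⟨ ≡.cong (λ k → - (suc k · 1#)) (≡.sym (ℕₚ.+-suc m n)) ⟩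
      - ((suc m ℕ.+ suc n) · 1#)  ≈⟨ -‿cong (×-homo-+ 1# (suc m) (suc n)) ⟩
      - (suc m · 1# + suc n · 1#)  ≈⟨ -‿+-comm _ _ ⟨
      - (suc m · 1#) + - (suc n · 1#)  ∎

    -‿homo : ∀ i → ⟦ ℤ.- i ⟧ℤ ≈ - ⟦ i ⟧ℤ
    -‿homo (+ zero)   = sym -0#≈0#
    -‿homo (+ suc n)  = refl
    -‿homo -[1+ n ]   = sym (-‿involutive _)

    pos* : ∀ m j → ⟦ + m ℤ.* j ⟧ℤ ≈ m · 1# * ⟦ j ⟧ℤ
    pos* m (+ n) = begin
      ⟦ + m ℤ.* + n ⟧ℤ  ≡⟨ ≡.cong ⟦_⟧ℤ (≡.sym (ℤₚ.pos-* m n)) ⟩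
      (m ℕ.* n) · 1#  ≈⟨ ×1-homo-* m n ⟩
      m · 1# * n · 1#  ∎
    pos* m -[1+ n ] = begin
      ⟦ + m ℤ.* -[1+ n ] ⟧ℤ  ≡⟨ ≡.cong ⟦_⟧ℤ (≡.sym (ℤₚ.neg-distribʳ-* (+ m) (+ suc n))) ⟩
      ⟦ ℤ.- (+ m ℤ.* + suc n) ⟧ℤ  ≈⟨ -‿homo (+ m ℤ.* + suc n) ⟩
      - ⟦ + m ℤ.* + suc n ⟧ℤ  ≈⟨ -‿cong (pos* m (+ suc n)) ⟩
      - (m · 1# * suc n · 1#)  ≈⟨ -‿distribʳ-* _ _ ⟩
      m · 1# * - (suc n · 1#)  ∎

    *-homo : ∀ i j → ⟦ i ℤ.* j ⟧ℤ ≈ ⟦ i ⟧ℤ * ⟦ j ⟧ℤ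
    *-homo (+ m) j = pos* m j
    *-homo -[1+ m ] j = begin
      ⟦ -[1+ m ] ℤ.* j ⟧ℤ  ≡⟨ ≡.cong ⟦_⟧ℤ (≡.sym (ℤₚ.neg-distribˡ-* (+ suc m) j)) ⟩
      ⟦ ℤ.- (+ suc m ℤ.* j) ⟧ℤ  ≈⟨ -‿homo (+ suc m ℤ.* j) ⟩
      - ⟦ + suc m ℤ.* j ⟧ℤ  ≈⟨ -‿cong (pos* (suc m) j) ⟩
      - (suc m · 1# * ⟦ j ⟧ℤ)  ≈⟨ -‿distribˡ-* _ _ ⟩
      - (suc m · 1#) * ⟦ j ⟧ℤ  ∎

    ℤ-rawRing : RawRing _ _
    ℤ-rawRing = record
      { Carrier = ℤ ; _≈_ = ≡._≡_ ; _+_ = ℤ._+_ ; _*_ = ℤ._*_ ; -_ = ℤ.-_ ; 0# = + 0 ; 1# = + 1 }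

    homomorphism : ℤ-rawRing -Raw-AlmostCommutative⟶ fromCommutativeRing R
    homomorphism = record
      { ⟦_⟧ = ⟦_⟧ℤ ; +-homo = +-homo ; *-homo = *-homo ; -‿homo = -‿homo
      ; 0-homo = refl ; 1-homo = refl }

    coeff≟ : ∀ i j → Maybe (⟦ i ⟧ℤ ≈ ⟦ j ⟧ℤ)
    coeff≟ i j with i ℤₚ.≟ j
    ... | yes ≡.refl = just refl
    ... | no  _      = nothing

  open import Algebra.Solver.Ring ℤ-rawRing (fromCommutativeRing R) homomorphism coeff≟ public
    using (solve; _:=_; _:+_; _:*_; _:-_; :-_; con; Polynomial)

  :0 :1 : ∀ {n} → Polynomial n
  :0 = con (+ 0)
  :1 = con (+ 1)

-- Reindexing of products over lists

module _ {c ℓ} (M : CommutativeMonoid c ℓ) where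
  open CommutativeMonoid M
  open import Relation.Binary.Reasoning.Setoid setoid

  fold : List Carrier → Carrier
  fold = List.foldr _∙_ ε

  private
    fold-remove : ∀ {x ys} (i : Any (x ≈_) ys) → fold ys ≈ x ∙ fold (ys Any.─ i)
    fold-remove (here x≈y) = ∙-congʳ (sym x≈y)
    fold-remove {x} {y ∷ ys} (there i) = begin
      y ∙ fold ys  ≈⟨ ∙-congˡ (fold-remove i) ⟩
      y ∙ (x ∙ fold (ys Any.─ i))  ≈⟨ assoc y x _ ⟨
      (y ∙ x) ∙ fold (ys Any.─ i)  ≈⟨ ∙-congʳ (comm y x) ⟩
      (x ∙ y) ∙ fold (ys Any.─ i)  ≈⟨ assoc x y _ ⟩
      x ∙ (y ∙ fold (ys Any.─ i))  ∎

  -- `xs` is then a rearrangement of `ys`. Applied to the field under translation by 1 and to its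
  -- units under multiplication, this yields the characteristic and Fermat's identity.
  fold-⊆ : ∀ {xs ys} → AllPairs (λ x y → ¬ x ≈ y) xs → All (λ x → Any (x ≈_) ys) xs →
    length xs ≡ length ys → fold xs ≈ fold ys
  fold-⊆ {[]} {[]} _ _ _ = refl
  fold-⊆ {x ∷ xs} {ys} (x∉ ∷ xs!) (i ∷ is) eq = begin
    x ∙ fold xs  ≈⟨ ∙-congˡ (fold-⊆ xs! (All.zipWith move (x∉ , is))
                                  (ℕₚ.suc-injective (≡.trans eq (remove-at ys i)))) ⟩
    x ∙ fold (ys Any.─ i)  ≈⟨ fold-remove i ⟨
    fold ys  ∎
    where
    move : ∀ {x′} → (¬ x ≈ x′) × Any (x′ ≈_) ys → Any (x′ ≈_) (ys Any.─ i)
    move (x≉x′ , j) with keep-or-hit ys i j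
    ... | inj₁ q  = contradiction (trans (Anyₚ.lookup-result i) (sym q)) x≉x′
    ... | inj₂ j′ = j′

-- Binomial coefficients modulo a prime and the Frobenius map

module _ {p} (pr : Prime p) where
  open import Data.Nat.Combinatorics
  open import Data.Nat.Base using (_!; _<_; _≤_; _∸_)

  prime∤! : ∀ k → k < p → ¬ p ∣ k !
  prime∤! zero    k<p p∣ = ℕₚ.<⇒≱ (ℕ.nonTrivial⇒n>1 p {{prime⇒nonTrivial pr}}) (∣.∣⇒≤ p∣)
  prime∤! (suc k) k<p p∣ with euclidsLemma (suc k) (k !) pr p∣
  ... | inj₁ p∣k = ℕₚ.<⇒≱ k<p (∣.∣⇒≤ p∣k)
  ... | inj₂ p∣! = prime∤! k (ℕₚ.<-trans (ℕₚ.n<1+n k) k<p) p∣!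

  -- `p` divides p! = (p C k) k! (p - k)! but neither of the two factorials.
  prime∣C : ∀ k → 0 < k → k < p → p ∣ p C k
  prime∣C k 0<k k<p with euclidsLemma (p C k) (k ! ℕ.* (p ∸ k) !) pr p∣prod
    where
    open import Data.Nat.DivMod using (m/n*n≡m)
    instance _ = k ℕₚ.!* (p ∸ k) !≢0
    k≤p = ℕₚ.<⇒≤ k<p
    prod : (p C k) ℕ.* (k ! ℕ.* (p ∸ k) !) ≡ p !
    prod = ≡.trans (≡.cong (ℕ._* (k ! ℕ.* (p ∸ k) !)) (nCk≡n!/k![n-k]! k≤p)) (m/n*n≡m (k![n∸k]!∣n! k≤p))
    p∣p! : ∀ n → 1 < n → n ∣ n !
    p∣p! (suc n) _ = ∣.m∣m*n (n !)
    p∣prod : p ∣ (p C k) ℕ.* (k ! ℕ.* (p ∸ k) !)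
    p∣prod = ≡.subst (p ∣_) (≡.sym prod) (p∣p! p (ℕ.nonTrivial⇒n>1 p {{prime⇒nonTrivial pr}}))
  ... | inj₁ d = d
  ... | inj₂ d with euclidsLemma (k !) ((p ∸ k) !) pr d
  ...   | inj₁ e = contradiction e (prime∤! k k<p)
  ...   | inj₂ e = contradiction e (prime∤! (p ∸ k) (ℕₚ.∸-monoʳ-< 0<k (ℕₚ.<⇒≤ k<p)))

module _ {c ℓ} (R : CommutativeRing c ℓ) where
  open CommutativeRing R hiding (zero)
  open import Algebra.Properties.Semiring.Mult semiring
    using (×1-homo-*; ×-assoc-*) renaming (_×_ to _·_)
  open import Algebra.Properties.Monoid.Mult +-monoid using (×-congʳ; ×-homo-1)
  open import Algebra.Properties.Semiring.Exp semiring
  open import Algebra.Properties.CommutativeSemiring.Exp commutativeSemiring using (^-distrib-*)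
  open import Algebra.Properties.CommutativeSemiring.Binomial commutativeSemiring
  open import Algebra.Properties.Semiring.Sum semiring
  open import Relation.Binary.Reasoning.Setoid setoid

  char-divides : ∀ {p} → p · 1# ≈ 0# → ∀ {m} x → p ∣ m → m · x ≈ 0#
  char-divides {p} p·1 x (divides k ≡.refl) = begin
    (k ℕ.* p) · x  ≈⟨ ×-congʳ (k ℕ.* p) (*-identityˡ x) ⟨
    (k ℕ.* p) · (1# * x)  ≈⟨ ×-assoc-* (k ℕ.* p) 1# x ⟨
    ((k ℕ.* p) · 1#) * x  ≈⟨ *-congʳ (×1-homo-* k p) ⟩
    ((k · 1#) * (p · 1#)) * x  ≈⟨ *-congʳ (*-congˡ p·1) ⟩
    ((k · 1#) * 0#) * x  ≈⟨ *-congʳ (zeroʳ _) ⟩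
    0# * x  ≈⟨ zeroˡ x ⟩
    0#  ∎

  frobenius-+ : ∀ {p} → Prime p → p · 1# ≈ 0# → ∀ x y → (x + y) ^ p ≈ x ^ p + y ^ p
  frobenius-+ {zero} pr with () ← ℕ.nonTrivial⇒n>1 0 {{prime⇒nonTrivial pr}}
  frobenius-+ {suc p-1} pr p·1 x y = begin
    (x + y) ^ p  ≈⟨ theorem p x y ⟩
    sum (binomialTerm x y p)  ≈⟨ +-congˡ (sum-init-last t) ⟩
    binomialTerm x y p zero + (sum (λ i → t (Fin.inject₁ i)) + t (Fin.fromℕ p-1))
      ≈⟨ +-cong first (+-cong middle last) ⟩
    y ^ p + (0# + x ^ p)  ≈⟨ +-congˡ (+-identityˡ _) ⟩
    y ^ p + x ^ p  ≈⟨ +-comm _ _ ⟩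
    x ^ p + y ^ p  ∎
    where
    p = suc p-1
    t : Fin p → Carrier
    t i = binomialTerm x y p (suc i)
    first : binomialTerm x y p zero ≈ y ^ p
    first = trans (×-homo-1 _) (*-identityˡ _)
    last : t (Fin.fromℕ p-1) ≈ x ^ p
    last = begin
      t (Fin.fromℕ p-1)
        ≡⟨ ≡.cong (λ k → (p C suc k) · (x ^ suc k * y ^ (p-1 ℕ.∸ k))) (Finₚ.toℕ-fromℕ p-1) ⟩
      (p C p) · (x ^ p * y ^ (p-1 ℕ.∸ p-1))  ≡⟨ ≡.cong₂ (λ a b → a · (x ^ p * y ^ b)) (nCn≡1 p) (ℕₚ.n∸n≡0 p-1) ⟩
      1 · (x ^ p * 1#)  ≈⟨ ×-homo-1 _ ⟩
      x ^ p * 1#  ≈⟨ *-identityʳ _ ⟩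
      x ^ p  ∎
    zero-term : ∀ i → t (Fin.inject₁ i) ≈ 0#
    zero-term i = char-divides p·1 _ (prime∣C pr _ (s≤s z≤n)
      (s≤s (≡.subst (ℕ._< p-1) (≡.sym (Finₚ.toℕ-inject₁ i)) (Finₚ.toℕ<n i))))
    middle : sum (λ i → t (Fin.inject₁ i)) ≈ 0#
    middle = trans (sum-cong-≋ {p-1} {t ∘ Fin.inject₁} {λ _ → 0#} zero-term) (sum-replicate-zero p-1)

  frobenius^-+ : ∀ {p} → Prime p → p · 1# ≈ 0# → ∀ k x y →
    (x + y) ^ (p ℕ.^ k) ≈ x ^ (p ℕ.^ k) + y ^ (p ℕ.^ k)
  frobenius^-+ {p} pr p·1 zero x y =
    trans (*-identityʳ _) (sym (+-cong (*-identityʳ _) (*-identityʳ _)))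
  frobenius^-+ {p} pr p·1 (suc k) x y = begin
    (x + y) ^ (p ℕ.* p ℕ.^ k)  ≈⟨ ^-assocʳ (x + y) p _ ⟨
    ((x + y) ^ p) ^ (p ℕ.^ k)  ≈⟨ ^-congˡ (p ℕ.^ k) (frobenius-+ pr p·1 x y) ⟩
    (x ^ p + y ^ p) ^ (p ℕ.^ k)  ≈⟨ frobenius^-+ pr p·1 k _ _ ⟩
    (x ^ p) ^ (p ℕ.^ k) + (y ^ p) ^ (p ℕ.^ k)  ≈⟨ +-cong (^-assocʳ x p _) (^-assocʳ y p _) ⟩
    x ^ (p ℕ.* p ℕ.^ k) + y ^ (p ℕ.* p ℕ.^ k)  ∎

-- Boolean counts and prime powers

countB-∷ʳ : ∀ {a} {A : Set a} (p : A → Bool) xs x →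
  countB p (xs ∷ʳ x) ≡ countB p xs ℕ.+ (if p x then 1 else 0)
countB-∷ʳ p [] x with p x
... | true  = ≡.refl
... | false = ≡.refl
countB-∷ʳ p (y ∷ xs) x with p y
... | true  = ≡.cong suc (countB-∷ʳ p xs x)
... | false = countB-∷ʳ p xs x

countB-upTo : ∀ p k → countB p (upTo (suc k)) ≡ countB p (upTo k) ℕ.+ (if p k then 1 else 0)
countB-upTo p k = ≡.trans (≡.cong (countB p) (≡.sym (Listₚ.upTo-∷ʳ k))) (countB-∷ʳ p (upTo k) k)

countB-cong : ∀ {a} {A : Set a} {p r : A → Bool} → (∀ x → p x ≡ r x) → ∀ xs → countB p xs ≡ countB r xs
countB-cong eq [] = ≡.refl
countB-cong {p = p} {r} eq (x ∷ xs) with p x | r x | eq x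
... | true  | .true  | ≡.refl = ≡.cong suc (countB-cong eq xs)
... | false | .false | ≡.refl = countB-cong eq xs

countB-filter : ∀ {a r} {A : Set a} {P : A → Set r} (P? : U.Decidable P) {p : A → Bool} →
  (∀ x → p x ≡ does (P? x)) → ∀ xs → countB p xs ≡ length (filter P? xs)
countB-filter P? eq [] = ≡.refl
countB-filter P? {p} eq (x ∷ xs) with p x | does (P? x) | eq x
... | true  | .true  | ≡.refl = ≡.cong suc (countB-filter P? eq xs)
... | false | .false | ≡.refl = countB-filter P? eq xs

-- Evaluates `dimFromCard` at the cardinality of a subspace. The test at e succeeds exactly for e <
-- d, so the count over `upTo n` is the minimum of d and n, and `d ≤ n` makes the cut-off harmless.
countB-powers : ∀ Q → 1 ℕ.< Q → ∀ {d n} → d ℕ.≤ n →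
  countB (λ e → Q ℕ.^ suc e ℕ.≤ᵇ Q ℕ.^ d) (upTo n) ≡ d
countB-powers Q 1<Q {d} {n} d≤n = ≡.trans (go n) (ℕₚ.m≤n⇒m⊓n≡m d≤n)
  where
  powers-reflect : ∀ e → Q ℕ.^ suc e ℕ.≤ Q ℕ.^ d → e ℕ.< d
  powers-reflect e le = ℕₚ.≰⇒> λ d≤e →
    ℕₚ.<⇒≱ (ℕₚ.^-monoʳ-< Q 1<Q {d} {suc e} (s≤s d≤e)) le
  powers-preserve : ∀ e → e ℕ.< d → Q ℕ.^ suc e ℕ.≤ Q ℕ.^ d
  powers-preserve e = ℕₚ.^-monoʳ-≤ Q {{ℕ.>-nonZero (ℕₚ.<-trans (s≤s z≤n) 1<Q)}} {suc e} {d}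
  test : ∀ e → (Q ℕ.^ suc e ℕ.≤ᵇ Q ℕ.^ d) ≡ (e ℕ.<ᵇ d)
  test e = ≡-does (e ℕₚ.<? d)
    (λ eq → powers-reflect e (ℕₚ.≤ᵇ⇒≤ (Q ℕ.^ suc e) (Q ℕ.^ d) (≡.subst Bool.T (≡.sym eq) _)))
    (λ e<d → dec-true (Q ℕ.^ suc e ℕₚ.≤? Q ℕ.^ d) (powers-preserve e e<d))
  step : ∀ d n → d ℕ.⊓ n ℕ.+ (if n ℕ.<ᵇ d then 1 else 0) ≡ d ℕ.⊓ suc n
  step zero    n       = ≡.refl
  step (suc d) zero    = ≡.cong suc (≡.sym (ℕₚ.⊓-zeroʳ d))
  step (suc d) (suc n) = ≡.cong suc (step d n)
  go : ∀ n → countB (λ e → Q ℕ.^ suc e ℕ.≤ᵇ Q ℕ.^ d) (upTo n) ≡ d ℕ.⊓ n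
  go zero    = ≡.sym (ℕₚ.⊓-zeroʳ d)
  go (suc n) = ≡.trans (countB-upTo (λ e → Q ℕ.^ suc e ℕ.≤ᵇ Q ℕ.^ d) n) (≡.trans (≡.cong₂ ℕ._+_ (go n) (≡.cong (if_then 1 else 0) (test n))) (step d n))

primePower-≥2 : ∀ {q} → IsPrimePower q → ∃ λ q′ → q ≡ suc (suc q′)
primePower-≥2 {q} (p , k , pr , ≡.refl) = split q (ℕₚ.≤-trans (ℕ.nonTrivial⇒n>1 p {{prime⇒nonTrivial pr}})
  (ℕₚ.m≤m*n p (p ℕ.^ k) {{ℕₚ.m^n≢0 p k {{ℕ.nonTrivial⇒nonZero p {{prime⇒nonTrivial pr}}}}}}))
  where
  split : ∀ m → 2 ℕ.≤ m → ∃ λ m′ → m ≡ suc (suc m′)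
  split (suc (suc m)) _ = m , ≡.refl
  split (suc zero) (s≤s ())

-- Finite fields: roots of polynomials, characteristic, Fermat's identity

module _ {c ℓ} (𝔽 : FiniteField c ℓ) where
  open FiniteField 𝔽 hiding (zero)
  open IntegerSolver commRing
  open import Algebra.Properties.Semiring.Exp semiring using (_^_; ^-congˡ; ^-assocʳ)
  open import Algebra.Properties.CommutativeSemiring.Exp commutativeSemiring using (^-distrib-*)
  private
    module ≈-Reasoning = SetoidReasoning setoid

  module _ where
    open ≈-Reasoning
    open import Algebra.Properties.Semiring.Mult semiring using (×1-homo-*) renaming (_×_ to _·_)
    open import Algebra.Properties.Group +-group using (∙-cancelʳ; ∙-cancelˡ)

    Carrier-finite : IsFinite setoid
    Carrier-finite = record { _≟_ = _≟_ ; elems = elems ; complete = complete ; distinct = distinct }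

    infix 4 _≉0
    _≉0 : Carrier → Set _
    x ≉0 = ¬ x ≈ 0#

    1≉0 : 1# ≉0
    1≉0 = 0≉1 ∘ sym

    ≉0-resp : ∀ {x y} → x ≈ y → x ≉0 → y ≉0
    ≉0-resp x≈y x≉0 y≈0 = x≉0 (trans x≈y y≈0)

    zero-product : ∀ {x y} → x * y ≈ 0# → x ≉0 → y ≈ 0#
    zero-product {x} {y} xy≈0 x≉0 = let z , xz≈1 = inverse x x≉0 in begin
      y  ≈⟨ *-identityˡ y ⟨
      1# * y  ≈⟨ *-congʳ xz≈1 ⟨
      x * z * y  ≈⟨ solve 3 (λ x y z → x :* z :* y := z :* (x :* y)) refl x y z ⟩
      z * (x * y)  ≈⟨ *-congˡ xy≈0 ⟩
      z * 0#  ≈⟨ zeroʳ z ⟩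
      0#  ∎

    *-≉0 : ∀ {x y} → x ≉0 → y ≉0 → x * y ≉0
    *-≉0 x≉0 y≉0 xy≈0 = y≉0 (zero-product xy≈0 x≉0)

    x-y≈0⇒x≈y : ∀ {x y} → x - y ≈ 0# → x ≈ y
    x-y≈0⇒x≈y {x} {y} eq = begin
      x  ≈⟨ solve 2 (λ x y → x := (x :- y) :+ y) refl x y ⟩
      x - y + y  ≈⟨ +-congʳ eq ⟩
      0# + y  ≈⟨ +-identityˡ y ⟩
      y  ∎

    x≈y⇒x-y≈0 : ∀ {x y} → x ≈ y → x - y ≈ 0#
    x≈y⇒x-y≈0 {x} {y} eq = trans (+-congʳ eq) (-‿inverseʳ y)

    *-cancelˡ-≉0 : ∀ {x y z} → x ≉0 → x * y ≈ x * z → y ≈ z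
    *-cancelˡ-≉0 {x} {y} {z} x≉0 eq = x-y≈0⇒x≈y (zero-product (begin
      x * (y - z)  ≈⟨ solve 3 (λ x y z → x :* (y :- z) := x :* y :- x :* z) refl x y z ⟩
      x * y - x * z  ≈⟨ x≈y⇒x-y≈0 eq ⟩
      0#  ∎) x≉0)

    -‿≉0 : ∀ {x} → x ≉0 → - x ≉0
    -‿≉0 {x} x≉0 eq = x≉0 (begin
      x  ≈⟨ solve 1 (λ x → x := :- (:- x)) refl x ⟩
      - (- x)  ≈⟨ -‿cong eq ⟩
      - 0#  ≈⟨ solve 0 (:- :0 := :0) refl ⟩
      0#  ∎)

    -- The coefficients c₀ , … , cₘ₋₁ of the monic polynomial c₀ + … + cₘ₋₁ Xᵐ⁻¹ + Xᵐ.
    evalMonic : List Carrier → Carrier → Carrier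
    evalMonic []       x = 1#
    evalMonic (a ∷ as) x = a + x * evalMonic as x

    private
      -- Synthetic division by X - `r`: the coefficients of the quotient are the intermediate Horner
      -- values at `r`.
      quotient : List Carrier → Carrier → List Carrier
      quotient []           r = []
      quotient (_ ∷ [])     r = []
      quotient (_ ∷ b ∷ bs) r = evalMonic (b ∷ bs) r ∷ quotient (b ∷ bs) r

      length-quotient : ∀ a as r → length (quotient (a ∷ as) r) ≡ length as
      length-quotient a []       r = ≡.refl
      length-quotient a (b ∷ bs) r = ≡.cong suc (length-quotient b bs r)

      factor : ∀ a as x r →
        evalMonic (a ∷ as) x - evalMonic (a ∷ as) r ≈ (x - r) * evalMonic (quotient (a ∷ as) r) x
      factor a [] x r =
        solve 3 (λ a x r → (a :+ x :* :1) :- (a :+ r :* :1) := (x :- r) :* :1) refl a x r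
      factor a (b ∷ bs) x r = let e = evalMonic (b ∷ bs) ; q = evalMonic (quotient (b ∷ bs) r) x in begin
        (a + x * e x) - (a + r * e r)
          ≈⟨ solve 5 (λ a x r ex er → (a :+ x :* ex) :- (a :+ r :* er) := x :* (ex :- er) :+ (x :- r) :* er)
               refl a x r (e x) (e r) ⟩
        x * (e x - e r) + (x - r) * e r  ≈⟨ +-congʳ (*-congˡ (factor b bs x r)) ⟩
        x * ((x - r) * q) + (x - r) * e r
          ≈⟨ solve 4 (λ x r q er → x :* ((x :- r) :* q) :+ (x :- r) :* er := (x :- r) :* (er :+ x :* q))
               refl x r q (e r) ⟩
        (x - r) * (e r + x * q)  ∎

    roots-≤ : ∀ as {xs} → AllPairs (λ x y → ¬ x ≈ y) xs → All (λ x → evalMonic as x ≈ 0#) xs →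
      length xs ℕ.≤ length as
    roots-≤ as {[]} _ _ = z≤n
    roots-≤ [] {_ ∷ _} _ (1≈0 ∷ _) = contradiction 1≈0 1≉0
    roots-≤ (a ∷ as) {r ∷ xs} (r∉ ∷ xs!) (fr ∷ fs) =
      s≤s (≡.subst (length xs ℕ.≤_) (length-quotient a as r)
        (roots-≤ (quotient (a ∷ as) r) xs! (All.zipWith root (r∉ , fs))))
      where
      root : ∀ {x} → (¬ r ≈ x) × evalMonic (a ∷ as) x ≈ 0# → evalMonic (quotient (a ∷ as) r) x ≈ 0#
      root {x} (r≉x , fx) = zero-product
        (trans (sym (factor a as x r)) (x≈y⇒x-y≈0 (trans fx (sym fr))))
        (λ x-r≈0 → r≉x (sym (x-y≈0⇒x≈y x-r≈0)))

    private
      Σ-fold = fold +-commutativeMonoid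
      Π-fold = fold *-commutativeMonoid

      Σ-shift : ∀ xs → Σ-fold (map (_+ 1#) xs) ≈ Σ-fold xs + length xs · 1#
      Σ-shift []       = sym (+-identityʳ 0#)
      Σ-shift (x ∷ xs) = trans (+-congˡ (Σ-shift xs))
        (solve 4 (λ x s n o → (x :+ o) :+ (s :+ n) := (x :+ s) :+ (o :+ n)) refl x _ _ 1#)

      Π-scale : ∀ a xs → Π-fold (map (a *_) xs) ≈ a ^ length xs * Π-fold xs
      Π-scale a []       = sym (*-identityʳ 1#)
      Π-scale a (x ∷ xs) = trans (*-congˡ (Π-scale a xs))
        (solve 4 (λ a x m s → (a :* x) :* (m :* s) := (a :* m) :* (x :* s)) refl a x _ _)

      Π-≉0 : ∀ {xs} → All _≉0 xs → Π-fold xs ≉0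
      Π-≉0 []       = 1≉0
      Π-≉0 (p ∷ ps) = *-≉0 p (Π-≉0 ps)

    -- Translation by 1 permutes the field, so it leaves the sum of all elements unchanged while
    -- adding `order · 1#` to it.
    order·1≈0 : order · 1# ≈ 0#
    order·1≈0 = ∙-cancelˡ (Σ-fold elems) _ _ (begin
      Σ-fold elems + order · 1#  ≈⟨ Σ-shift elems ⟨
      Σ-fold (map (_+ 1#) elems)  ≈⟨ fold-⊆ +-commutativeMonoid
          (AllPairsₚ.map⁺ (AllPairs.map (λ x≉y eq → x≉y (∙-cancelʳ 1# _ _ eq)) distinct))
          (All.tabulate (λ {x} _ → complete x)) (Listₚ.length-map (_+ 1#) elems) ⟩
      Σ-fold elems  ≈⟨ +-identityʳ _ ⟨
      Σ-fold elems + 0#  ∎)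

    units : List Carrier
    units = filter (λ x → ¬? (x ≟ 0#)) elems

    units-≉0 : All _≉0 units
    units-≉0 = all-filter (λ x → ¬? (x ≟ 0#)) elems

    units-distinct : AllPairs (λ x y → ¬ x ≈ y) units
    units-distinct = AllPairsₚ.filter⁺ (λ x → ¬? (x ≟ 0#)) distinct

    units-complete : ∀ {x} → x ≉0 → Any (x ≈_) units
    units-complete {x} x≉0 = any-filter (λ x → ¬? (x ≟ 0#)) (complete x) (λ x≈y → ≉0-resp x≈y x≉0)

    length-units : suc (length units) ≡ order
    length-units = ℕₚ.≤-antisym
      (pigeonhole _≈_ _≈_ (λ p q → trans p (sym q))
        (All.map (λ x≉0 0≈x → x≉0 (sym 0≈x)) units-≉0 ∷ units-distinct)
        (All.tabulate (λ {x} _ → complete x)))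
      (pigeonhole _≈_ _≈_ (λ p q → trans p (sym q)) {ys = 0# ∷ units} distinct
        (All.tabulate (λ {x} _ → 0-or-unit x)))
      where
      0-or-unit : ∀ x → Any (x ≈_) (0# ∷ units)
      0-or-unit x with x ≟ 0#
      ... | yes x≈0 = here x≈0
      ... | no x≉0  = there (units-complete x≉0)

    -- Multiplication by a unit x permutes the units, so their product P satisfies x^(order - 1) P =
    -- P, and P can be cancelled.
    fermat : ∀ x → x ^ order ≈ x
    fermat x with x ≟ 0#
    ... | yes x≈0 = begin
      x ^ order  ≡⟨ ≡.cong (x ^_) (≡.sym length-units) ⟩
      x * x ^ length units  ≈⟨ *-congʳ x≈0 ⟩
      0# * x ^ length units  ≈⟨ zeroˡ _ ⟩
      0#  ≈⟨ x≈0 ⟨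
      x  ∎
    ... | no x≉0 = begin
      x ^ order  ≡⟨ ≡.cong (x ^_) (≡.sym length-units) ⟩
      x * x ^ length units  ≈⟨ *-congˡ unit-power ⟩
      x * 1#  ≈⟨ *-identityʳ x ⟩
      x  ∎
      where
      unit-power : x ^ length units ≈ 1#
      unit-power = *-cancelˡ-≉0 (Π-≉0 units-≉0) (begin
        Π-fold units * x ^ length units  ≈⟨ *-comm _ _ ⟩
        x ^ length units * Π-fold units  ≈⟨ Π-scale x units ⟨
        Π-fold (map (x *_) units)  ≈⟨ fold-⊆ *-commutativeMonoid
            (AllPairsₚ.map⁺ (AllPairs.map (λ y≉z eq → y≉z (*-cancelˡ-≉0 x≉0 eq)) units-distinct))
            (Allₚ.map⁺ (All.map (λ y≉0 → units-complete (*-≉0 x≉0 y≉0)) units-≉0))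
            (Listₚ.length-map (x *_) units) ⟩
        Π-fold units  ≈⟨ *-identityʳ _ ⟨
        Π-fold units * 1#  ∎)

    power-≈0 : ∀ k {x} → x ^ k ≈ 0# → x ≈ 0#
    power-≈0 zero 1≈0 = contradiction 1≈0 1≉0
    power-≈0 (suc k) {x} eq with x ≟ 0#
    ... | yes x≈0 = x≈0
    ... | no  x≉0 = power-≈0 k (zero-product eq x≉0)

    -- The k-th power of `p · 1#` is `order · 1#`, which vanishes, and a field has no nilpotents.
    characteristic : ∀ {p k} → order ≡ p ℕ.^ k → p · 1# ≈ 0#
    characteristic {p} {k} eq = power-≈0 k (trans (sym (·-^ k)) (≡.subst (λ m → m · 1# ≈ 0#) eq order·1≈0))
      where
      ·-^ : ∀ k → (p ℕ.^ k) · 1# ≈ (p · 1#) ^ k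
      ·-^ zero    = +-identityʳ 1#
      ·-^ (suc k) = trans (×1-homo-* p (p ℕ.^ k)) (*-congˡ (·-^ k))

  -- Vectors, linear maps and their matrices

  V : ℕ → Set c
  V = Vec 𝔽

  infix 4 _≋_
  _≋_ : ∀ {n} → V n → V n → Set ℓ
  _≋_ = Pointwise setoid

  module _ {n : ℕ} where
    open Setoid (vecSetoid setoid n) public using ()
      renaming (refl to ≋-refl; sym to ≋-sym; trans to ≋-trans)
    open IsFinite (vecFinite Carrier-finite n) public using ()
      renaming (_≟_ to _≋?_; complete to V-complete; distinct to V-distinct;
                ∃? to V-∃?; injective⇒surjective to V-injective⇒surjective)

  infixl 6 _⊕_ _⊖_
  infixr 7 _⊙_
  _⊕_ _⊖_ : ∀ {n} → V n → V n → V n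
  (v ⊕ w) i = v i + w i
  (v ⊖ w) i = v i - w i
  _⊙_ : ∀ {n} → Carrier → V n → V n
  (a ⊙ v) i = a * v i
  𝟎 : ∀ {n} → V n
  𝟎 i = 0#

  module _ {n : ℕ} where
    ⊕-cong : {v v′ w w′ : V n} → v ≋ v′ → w ≋ w′ → v ⊕ w ≋ v′ ⊕ w′
    ⊕-cong p q = mk≋ λ i → +-cong (at p i) (at q i)
    ⊖-cong : {v v′ w w′ : V n} → v ≋ v′ → w ≋ w′ → v ⊖ w ≋ v′ ⊖ w′
    ⊖-cong p q = mk≋ λ i → +-cong (at p i) (-‿cong (at q i))
    ⊙-cong : {a b : Carrier} {v w : V n} → a ≈ b → v ≋ w → a ⊙ v ≋ b ⊙ w
    ⊙-cong p q = mk≋ λ i → *-cong p (at q i)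
    ⊖≋𝟎⇒≋ : {v w : V n} → v ⊖ w ≋ 𝟎 → v ≋ w
    ⊖≋𝟎⇒≋ p = mk≋ λ i → x-y≈0⇒x≈y (at p i)
    ≋⇒⊖≋𝟎 : {v w : V n} → v ≋ w → v ⊖ w ≋ 𝟎
    ≋⇒⊖≋𝟎 p = mk≋ λ i → x≈y⇒x-y≈0 (at p i)

  record Linear {n} (f : V n → V n) : Set (c ⊔ ℓ) where
    field
      cong  : ∀ {v w} → v ≋ w → f v ≋ f w
      add   : ∀ v w → f (v ⊕ w) ≋ f v ⊕ f w
      scale : ∀ a v → f (a ⊙ v) ≋ a ⊙ f v

    zero-map : f 𝟎 ≋ 𝟎
    zero-map = ≋-trans (cong (mk≋ λ i → sym (zeroˡ 0#))) (≋-trans (scale 0# 𝟎) (mk≋ λ i → zeroˡ _))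

    sub : ∀ v w → f (v ⊖ w) ≋ f v ⊖ f w
    sub v w = ≋-trans (cong (mk≋ λ i → solve 2 (λ x y → x :- y := x :+ (:- :1) :* y) refl (v i) (w i)))
      (≋-trans (add v (- 1# ⊙ w)) (mk≋ λ i → trans (+-congˡ (at (scale (- 1#) w) i))
        (solve 2 (λ x y → x :+ (:- :1) :* y := x :- y) refl (f v i) (f w i))))

    injective : (∀ v → f v ≋ 𝟎 → v ≋ 𝟎) → ∀ {v w} → f v ≋ f w → v ≋ w
    injective ker eq = ⊖≋𝟎⇒≋ (ker _ (≋-trans (sub _ _) (≋⇒⊖≋𝟎 eq)))

  record Functional {n} (φ : V n → Carrier) : Set (c ⊔ ℓ) where
    field
      cong  : ∀ {v w} → v ≋ w → φ v ≈ φ w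
      add   : ∀ v w → φ (v ⊕ w) ≈ φ v + φ w
      scale : ∀ a v → φ (a ⊙ v) ≈ a * φ v

  module _ {n : ℕ} where
    id-linear : Linear {n} id
    id-linear = record { cong = id ; add = λ _ _ → ≋-refl ; scale = λ _ _ → ≋-refl }

    module _ {f g : V n → V n} (lf : Linear f) (lg : Linear g) where
      private
        module F = Linear lf
        module G = Linear lg

      ∘-linear : Linear (f ∘ g)
      ∘-linear = record
        { cong = F.cong ∘ G.cong
        ; add = λ v w → ≋-trans (F.cong (G.add v w)) (F.add _ _)
        ; scale = λ a v → ≋-trans (F.cong (G.scale a v)) (F.scale _ _) }

      ⊕-linear : Linear (λ x → f x ⊕ g x)
      ⊕-linear = record
        { cong = λ p → ⊕-cong (F.cong p) (G.cong p)
        ; add = λ v w → ≋-trans (⊕-cong (F.add v w) (G.add v w))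
            (mk≋ λ i → solve 4 (λ a b c d → (a :+ b) :+ (c :+ d) := (a :+ c) :+ (b :+ d)) refl (f v i) (f w i) (g v i) (g w i))
        ; scale = λ a v → ≋-trans (⊕-cong (F.scale a v) (G.scale a v)) (mk≋ λ i → sym (distribˡ a _ _)) }

      ⊖-linear : Linear (λ x → f x ⊖ g x)
      ⊖-linear = record
        { cong = λ p → ⊖-cong (F.cong p) (G.cong p)
        ; add = λ v w → ≋-trans (⊖-cong (F.add v w) (G.add v w))
            (mk≋ λ i → solve 4 (λ a b c d → (a :+ b) :- (c :+ d) := (a :- c) :+ (b :- d)) refl (f v i) (f w i) (g v i) (g w i))
        ; scale = λ a v → ≋-trans (⊖-cong (F.scale a v) (G.scale a v))
            (mk≋ λ i → solve 3 (λ a b c → a :* b :- a :* c := a :* (b :- c)) refl a (f v i) (g v i)) }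

    ⊙-linear : ∀ a {f : V n → V n} → Linear f → Linear (λ x → a ⊙ f x)
    ⊙-linear a {f} lf = record
      { cong = λ p → ⊙-cong refl (F.cong p)
      ; add = λ v w → mk≋ λ i → trans (*-congˡ (at (F.add v w) i)) (distribˡ a _ _)
      ; scale = λ b v → mk≋ λ i → trans (*-congˡ (at (F.scale b v) i))
          (solve 3 (λ a b x → a :* (b :* x) := b :* (a :* x)) refl a b (f v i)) }
      where module F = Linear lf

    functional-linear : {φ : V n → Carrier} → Functional φ → ∀ u → Linear (λ x → φ x ⊙ u)
    functional-linear lφ u = record
      { cong = λ p → ⊙-cong (F.cong p) ≋-refl
      ; add = λ v w → mk≋ λ i → trans (*-congʳ (F.add v w)) (distribʳ _ _ _)
      ; scale = λ a v → mk≋ λ i → trans (*-congʳ (F.scale a v)) (*-assoc a _ _) }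
      where module F = Functional lφ

    functional-∘ : {φ : V n → Carrier} {f : V n → V n} → Functional φ → Linear f → Functional (φ ∘ f)
    functional-∘ lφ lf = record
      { cong = F.cong ∘ L.cong
      ; add = λ v w → trans (F.cong (L.add v w)) (F.add _ _)
      ; scale = λ a v → trans (F.cong (L.scale a v)) (F.scale _ _) }
      where
      module F = Functional lφ
      module L = Linear lf

    iter-linear : ∀ k {f : V n → V n} → Linear f → Linear (iter 𝔽 k f)
    iter-linear zero    lf = id-linear
    iter-linear (suc k) lf = ∘-linear lf (iter-linear k lf)

  module _ {n : ℕ} where
    record LinearInverse (f : V n → V n) : Set (c ⊔ ℓ) where
      field
        f⁻¹      : V n → V n
        linear   : Linear f⁻¹
        inverseʳ : ∀ v → f (f⁻¹ v) ≋ v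
        inverseˡ : ∀ v → f⁻¹ (f v) ≋ v

    private
      build-inverse : {f : V n → V n} → Linear f → (∀ v → f v ≋ 𝟎 → v ≋ 𝟎) → LinearInverse f
      build-inverse {f} lf ker = record
        { f⁻¹ = f⁻¹ ; inverseʳ = inverseʳ
        ; inverseˡ = λ v → inj (inverseʳ (f v))
        ; linear = record
          { cong = λ p → inj (≋-trans (inverseʳ _) (≋-trans p (≋-sym (inverseʳ _))))
          ; add = λ v w → inj (≋-trans (inverseʳ _)
              (≋-sym (≋-trans (F.add _ _) (⊕-cong (inverseʳ v) (inverseʳ w)))))
          ; scale = λ a v → inj (≋-trans (inverseʳ _)
              (≋-sym (≋-trans (F.scale _ _) (⊙-cong refl (inverseʳ v))))) } }
        where
        module F = Linear lf
        inj = F.injective ker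
        surj = V-injective⇒surjective f F.cong inj
        f⁻¹ = λ v → proj₁ (surj v)
        inverseʳ = λ v → proj₂ (surj v)

    abstract
      -- Injectivity suffices because the space is finite. The inverse is found by exhaustive
      -- search, which `abstract` keeps from unfolding.
      linear-inverse : {f : V n → V n} → Linear f → (∀ v → f v ≋ 𝟎 → v ≋ 𝟎) → LinearInverse f
      linear-inverse = build-inverse

  sumF-cong : ∀ n {f g : V n} → (∀ i → f i ≈ g i) → sumF 𝔽 f ≈ sumF 𝔽 g
  sumF-cong zero  eq = refl
  sumF-cong (suc n) eq = +-cong (eq zero) (sumF-cong n (eq ∘ suc))

  sumF-+ : ∀ n (f g : V n) → sumF 𝔽 (λ i → f i + g i) ≈ sumF 𝔽 f + sumF 𝔽 g
  sumF-+ zero f g = sym (+-identityˡ 0#)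
  sumF-+ (suc n) f g = trans (+-congˡ (sumF-+ n (f ∘ suc) (g ∘ suc)))
    (solve 4 (λ a b c d → (a :+ b) :+ (c :+ d) := (a :+ c) :+ (b :+ d)) refl _ _ _ _)

  sumF-*ˡ : ∀ n a (f : V n) → sumF 𝔽 (λ i → a * f i) ≈ a * sumF 𝔽 f
  sumF-*ˡ zero a f = sym (zeroʳ a)
  sumF-*ˡ (suc n) a f = trans (+-congˡ (sumF-*ˡ n a (f ∘ suc))) (sym (distribˡ a _ _))

  sumF-0 : ∀ n → sumF 𝔽 {n} (λ _ → 0#) ≈ 0#
  sumF-0 zero    = refl
  sumF-0 (suc n) = trans (+-identityˡ _) (sumF-0 n)

  sumF-swap : ∀ m n (f : Fin m → Fin n → Carrier) →
    sumF 𝔽 (λ i → sumF 𝔽 (λ j → f i j)) ≈ sumF 𝔽 (λ j → sumF 𝔽 (λ i → f i j))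
  sumF-swap zero    n f = sym (sumF-0 n)
  sumF-swap (suc m) n f = trans (+-congˡ (sumF-swap m n (f ∘ suc))) (sym (sumF-+ n (f zero) _))

  infixr 5 _◁_
  _◁_ : ∀ {n} → Carrier → V n → V (suc n)
  (a ◁ v) zero    = a
  (a ◁ v) (suc i) = v i

  ◁-cong : ∀ {n} {a b : Carrier} {v w : V n} → a ≈ b → v ≋ w → a ◁ v ≋ b ◁ w
  ◁-cong p q = mk≋ λ { zero → p ; (suc i) → at q i }

  basis : ∀ {n} → Fin n → V n
  basis zero    = 1# ◁ 𝟎
  basis (suc i) = 0# ◁ basis i

  functional-expand : ∀ {n} {φ : V n → Carrier} → Functional φ → ∀ v →
    φ v ≈ sumF 𝔽 (λ j → φ (basis j) * v j)
  functional-expand {zero} {φ} lφ v = trans (F.cong (mk≋ λ ())) (trans (F.scale 0# 𝟎) (zeroˡ _))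
    where module F = Functional lφ
  functional-expand {suc n} {φ} lφ v = begin
    φ v  ≈⟨ F.cong (mk≋ split) ⟩
    φ (v zero ⊙ (1# ◁ 𝟎) ⊕ (0# ◁ v ∘ suc))  ≈⟨ F.add _ _ ⟩
    φ (v zero ⊙ (1# ◁ 𝟎)) + φ (0# ◁ v ∘ suc)  ≈⟨ +-cong (trans (F.scale _ _) (*-comm _ _)) (functional-expand lφ′ (v ∘ suc)) ⟩
    φ (1# ◁ 𝟎) * v zero + sumF 𝔽 (λ j → φ (0# ◁ basis j) * v (suc j)) ∎
    where
    open ≈-Reasoning
    module F = Functional lφ
    split : ∀ i → v i ≈ (v zero ⊙ (1# ◁ 𝟎) ⊕ (0# ◁ v ∘ suc)) i
    split zero    = solve 1 (λ x → x := x :* :1 :+ :0) refl (v zero)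
    split (suc i) = solve 2 (λ x y → x := y :* :0 :+ x) refl (v (suc i)) (v zero)
    lφ′ : Functional (λ w → φ (0# ◁ w))
    lφ′ = record
      { cong = λ p → F.cong (◁-cong refl p)
      ; add = λ v w → trans (F.cong (mk≋ λ { zero → sym (+-identityˡ 0#) ; (suc i) → refl })) (F.add _ _)
      ; scale = λ a v → trans (F.cong (mk≋ λ { zero → sym (zeroʳ a) ; (suc i) → refl })) (F.scale _ _) }

  dot : ∀ {n} → V n → V n → Carrier
  dot f x = sumF 𝔽 (λ j → f j * x j)

  dot-functional : ∀ {n} (f : V n) → Functional (dot f)
  dot-functional {n} f = record
    { cong = λ p → sumF-cong n (λ j → *-congˡ (at p j))
    ; add = λ v w → trans (sumF-cong n (λ j → distribˡ (f j) _ _)) (sumF-+ n _ _)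
    ; scale = λ a v → trans (sumF-cong n (λ j → solve 3 (λ a x y → x :* (a :* y) := a :* (x :* y)) refl a (f j) (v j))) (sumF-*ˡ n a _) }

  app-linear : ∀ {n} (A : Mat 𝔽 n) → Linear (app 𝔽 A)
  app-linear A = record
    { cong = λ p → mk≋ λ i → Functional.cong (dot-functional (A i)) p
    ; add = λ v w → mk≋ λ i → Functional.add (dot-functional (A i)) v w
    ; scale = λ a v → mk≋ λ i → Functional.scale (dot-functional (A i)) a v }

  matrix : ∀ {n} → (V n → V n) → Mat 𝔽 n
  matrix f i j = f (basis j) i

  app-matrix : ∀ {n} {f : V n → V n} → Linear f → ∀ v → app 𝔽 (matrix f) v ≋ f v
  app-matrix lf v = mk≋ λ i → sym (functional-expand (record
    { cong = λ p → at (F.cong p) i ; add = λ v w → at (F.add v w) i ; scale = λ a v → at (F.scale a v) i }) v)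
    where module F = Linear lf

  app-mmul : ∀ {n} (A B : Mat 𝔽 n) v → app 𝔽 (mmul 𝔽 A B) v ≋ app 𝔽 A (app 𝔽 B v)
  app-mmul {n} A B v = mk≋ λ i → begin
    sumF 𝔽 (λ k → sumF 𝔽 (λ j → A i j * B j k) * v k)
      ≈⟨ sumF-cong n (λ k → trans (*-comm _ _) (sym (sumF-*ˡ n (v k) _))) ⟩
    sumF 𝔽 (λ k → sumF 𝔽 (λ j → v k * (A i j * B j k)))  ≈⟨ sumF-swap n n _ ⟩
    sumF 𝔽 (λ j → sumF 𝔽 (λ k → v k * (A i j * B j k)))
      ≈⟨ sumF-cong n (λ j → trans (sumF-cong n (λ k →
           solve 3 (λ a b x → x :* (a :* b) := a :* (b :* x)) refl (A i j) (B j k) (v k))) (sumF-*ˡ n (A i j) _)) ⟩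
    sumF 𝔽 (λ j → A i j * sumF 𝔽 (λ k → B j k * v k))  ∎
    where open ≈-Reasoning

  app-basis : ∀ {n} (A : Mat 𝔽 n) j i → app 𝔽 A (basis j) i ≈ A i j
  app-basis A j i = go (A i) j
    where
    open ≈-Reasoning
    go : ∀ {n} (f : V n) j → dot f (basis j) ≈ f j
    go {suc n} f zero = begin
      f zero * 1# + sumF 𝔽 (λ j → f (suc j) * 0#)  ≈⟨ +-cong (*-identityʳ _) (sumF-cong n (λ j → zeroʳ _)) ⟩
      f zero + sumF 𝔽 {n} (λ _ → 0#)  ≈⟨ +-congˡ (sumF-0 n) ⟩
      f zero + 0#  ≈⟨ +-identityʳ _ ⟩
      f zero  ∎
    go f (suc j) = trans (+-cong (zeroʳ _) (go (f ∘ suc) j)) (+-identityˡ _)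

  -- Subspaces, their cardinalities and separating functionals

  record Subspace (n : ℕ) (p : Level) : Set (c ⊔ ℓ ⊔ lsuc p) where
    infix 4 _∋_
    field
      _∋_   : V n → Set p
      ∋?    : U.Decidable _∋_
      resp  : ∀ {v w} → v ≋ w → _∋_ v → _∋_ w
      zero∈ : _∋_ 𝟎
      add   : ∀ {v w} → _∋_ v → _∋_ w → _∋_ (v ⊕ w)
      scale : ∀ a {v} → _∋_ v → _∋_ (a ⊙ v)

    sub : ∀ {v w} → _∋_ v → _∋_ w → _∋_ (v ⊖ w)
    sub {v} {w} v∈ w∈ = resp (mk≋ λ i → solve 2 (λ x y → x :+ (:- :1) :* y := x :- y) refl (v i) (w i))
      (add v∈ (scale (- 1#) w∈))

    members : List (V n)
    members = filter ∋? (allVecs 𝔽 n)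

    card : ℕ
    card = length members

    members∋ : ∀ {v} → v ∈ members → _∋_ v
    members∋ v∈ = proj₂ (∈-filter⁻ ∋? {xs = allVecs 𝔽 n} v∈)

    members-all : All _∋_ members
    members-all = All.tabulate members∋

    members-complete : ∀ {v} → _∋_ v → Any (v ≋_) members
    members-complete v∈ = any-filter ∋? (V-complete _) (λ eq → resp eq v∈)

    members-distinct : AllPairs (λ v w → ¬ v ≋ w) members
    members-distinct = AllPairsₚ.filter⁺ ∋? V-distinct

  module _ where
    open Subspace

    private variable
      n : ℕ
      p r : Level

    card-≤ : (W : Subspace n p) (W′ : Subspace n r) →
      (∀ {v} → W ∋ v → W′ ∋ v) → card W ℕ.≤ card W′
    card-≤ W W′ sub = pigeonhole _≋_ _≋_ (λ p q → ≋-trans p (≋-sym q)) (members-distinct W)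
      (All.map (λ v∈ → members-complete W′ (sub v∈)) (members-all W))

    card-≡ : (W : Subspace n p) (W′ : Subspace n r) →
      (∀ {v} → W ∋ v → W′ ∋ v) → (∀ {v} → W′ ∋ v → W ∋ v) → card W ≡ card W′
    card-≡ W W′ f g = ℕₚ.≤-antisym (card-≤ W W′ f) (card-≤ W′ W g)

    card-< : (W : Subspace n p) (W′ : Subspace n r) →
      (∀ {v} → W ∋ v → W′ ∋ v) → ∀ {z} → W′ ∋ z → ¬ W ∋ z → card W ℕ.< card W′
    card-< W W′ sub {z} z∈ z∉ = pigeonhole _≋_ _≋_ (λ p q → ≋-trans p (≋-sym q))
      {z ∷ members W}
      (All.map (λ v∈ z≋v → z∉ (resp W (≋-sym z≋v) v∈)) (members-all W) ∷ members-distinct W)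
      (members-complete W′ z∈ ∷ All.map (λ v∈ → members-complete W′ (sub v∈)) (members-all W))

    module _ {n : ℕ} {p r b e : Level} {B : Set b} {_∼_ : B → B → Set e} (∼-equivalence : IsEquivalence _∼_)
      (_∼?_ : Decidable _∼_) (W : Subspace n p) (Z : Subspace n r) (f : V n → B)
      (f-cong : ∀ {v w} → v ≋ w → f v ∼ f w)
      (kernel⊆ : ∀ {v} → Z ∋ v → W ∋ v)
      (same⇒ : ∀ {v w} → W ∋ v → W ∋ w → f v ∼ f w → Z ∋ v ⊖ w)
      (same⇐ : ∀ {v w} → W ∋ v → W ∋ w → Z ∋ v ⊖ w → f v ∼ f w)
      where
      private
        module T = IsEquivalence ∼-equivalence

      -- The counting form of the isomorphism theorem: `f` is constant on `W` exactly along cosets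
      -- of `Z`, and `ys` lists its values. Subtracting a fixed member embeds a fibre into `Z`, and
      -- adding one embeds `Z` into the fibre.
      card-fibres : (ys : List B) → AllPairs (λ y y′ → ¬ y ∼ y′) ys →
        (∀ {v} → W ∋ v → Any (f v ∼_) ys) → (∀ {y} → y ∈ ys → ∃ λ v → W ∋ v × f v ∼ y) →
        card W ≡ length ys ℕ.* card Z
      card-fibres ys ys! hit real = ℕₚ.≤-antisym upper lower
        where
        upper : card W ℕ.≤ length ys ℕ.* card Z
        upper = fibres-≤ _≋_ (λ v y → f v ∼ y) (λ v y → f v ∼? y) (card Z) (members W) ys
          (members-distinct W) (All.map hit (members-all W)) bound
          where
          bound : ∀ y zs → AllPairs (λ v w → ¬ v ≋ w) zs → All (_∈ members W) zs →
            All (λ v → f v ∼ y) zs → length zs ℕ.≤ card Z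
          bound y [] _ _ _ = z≤n
          bound y zs@(z ∷ _) zs! zs∈@(z∈ ∷ _) fzs@(fz ∷ _) =
            pigeonhole (λ v w → v ⊖ z ≋ w) _≋_ (λ {v} {v′} p q → mk≋ λ i →
                trans (solve 2 (λ x z → x := (x :- z) :+ z) refl (v i) (z i))
                  (trans (+-congʳ (trans (at p i) (sym (at q i))))
                    (solve 2 (λ x z → (x :- z) :+ z := x) refl (v′ i) (z i))))
              zs! (All.zipWith (λ (v∈ , fv) → members-complete Z
                (same⇒ (members∋ W v∈) (members∋ W z∈) (T.trans fv (T.sym fz)))) (zs∈ , fzs))
        lower : length ys ℕ.* card Z ℕ.≤ card W
        lower = fibres-≥ _≋_ (λ v y → f v ∼ y) (λ v y → f v ∼? y) (card Z) (members W) ys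
          (AllPairs.map (λ y≁y′ v fv fv′ → y≁y′ (T.trans (T.sym fv) fv′)) ys!) bound
          where
          bound : ∀ y → y ∈ ys → card Z ℕ.≤ length (filter (λ v → f v ∼? y) (members W))
          bound y y∈ with z , z∈ , fz ← real y∈ =
            pigeonhole (λ v w → v ⊕ z ≋ w) _≋_ (λ {v} {v′} p q → mk≋ λ i →
                trans (solve 2 (λ x z → x := (x :+ z) :- z) refl (v i) (z i))
                  (trans (+-congʳ (trans (at p i) (sym (at q i))))
                    (solve 2 (λ x z → (x :+ z) :- z := x) refl (v′ i) (z i))))
              (members-distinct Z)
              (All.map (λ {v} v∈ → any-filter (λ v → f v ∼? y)
                (members-complete W (add W (kernel⊆ v∈) z∈))
                (λ eq → T.trans (f-cong (≋-sym eq)) (T.trans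
                  (same⇐ (add W (kernel⊆ v∈) z∈) z∈
                    (resp Z (mk≋ λ i → solve 2 (λ x z → x := (x :+ z) :- z) refl (v i) (z i)) v∈)) fz)))
                (members-all Z))

    _∩ker_ : (W : Subspace n p) {φ : V n → Carrier} → Functional φ → Subspace n _
    _∩ker_ W {φ} lφ = record
      { _∋_ = λ v → W ∋ v × φ v ≈ 0#
      ; ∋? = λ v → ∋? W v ×-dec φ v ≟ 0#
      ; resp = λ eq (v∈ , φv) → resp W eq v∈ , trans (F.cong (≋-sym eq)) φv
      ; zero∈ = zero∈ W , trans (F.cong (mk≋ λ i → sym (zeroˡ 0#))) (trans (F.scale 0# 𝟎) (zeroˡ _))
      ; add = λ (v∈ , φv) (w∈ , φw) → add W v∈ w∈ , trans (F.add _ _) (trans (+-cong φv φw) (+-identityˡ 0#))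
      ; scale = λ a (v∈ , φv) → scale W a v∈ , trans (F.scale a _) (trans (*-congˡ φv) (zeroʳ a)) }
      where module F = Functional lφ

    functional-sub : {φ : V n → Carrier} → Functional φ → ∀ v w → φ (v ⊖ w) ≈ φ v - φ w
    functional-sub {φ = φ} lφ v w = begin
      φ (v ⊖ w)  ≈⟨ F.cong (mk≋ λ i → solve 2 (λ x y → x :- y := x :+ (:- :1) :* y) refl (v i) (w i)) ⟩
      φ (v ⊕ - 1# ⊙ w)  ≈⟨ F.add _ _ ⟩
      φ v + φ (- 1# ⊙ w)  ≈⟨ +-congˡ (F.scale _ _) ⟩
      φ v + - 1# * φ w  ≈⟨ solve 2 (λ x y → x :+ (:- :1) :* y := x :- y) refl _ _ ⟩
      φ v - φ w  ∎
      where
      module F = Functional lφ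
      open ≈-Reasoning

    -- The multiples of `z` alone already give the functional every value of the field, so there are
    -- `order` fibres.
    card-∩ker : (W : Subspace n p) {φ : V n → Carrier} (lφ : Functional φ) →
      ∀ {z} → W ∋ z → φ z ≉0 → card W ≡ order ℕ.* card (W ∩ker lφ)
    card-∩ker W {φ} lφ {z} z∈ φz≉0 = card-fibres isEquivalence _≟_ W (W ∩ker lφ) φ F.cong proj₁
      (λ v∈ w∈ eq → sub W v∈ w∈ , trans (functional-sub lφ _ _) (x≈y⇒x-y≈0 eq))
      (λ _ _ (_ , eq) → x-y≈0⇒x≈y (trans (sym (functional-sub lφ _ _)) eq))
      elems distinct (λ _ → complete _)
      (λ {y} _ → let u , φzu≈1 = inverse (φ z) φz≉0 in (y * u) ⊙ z , scale W _ z∈ ,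
        trans (F.scale _ z) (trans (solve 3 (λ y u x → y :* u :* x := y :* (x :* u)) refl y u (φ z))
          (trans (*-congˡ φzu≈1) (*-identityʳ y))))
      where module F = Functional lφ

    private
      head-functional : Functional {suc n} (λ v → v zero)
      head-functional = record { cong = λ p → at p zero ; add = λ _ _ → refl ; scale = λ _ _ → refl }

    hyperplane : Subspace (suc n) p → Subspace n p
    hyperplane W = record
      { _∋_ = λ w → W ∋ (0# ◁ w)
      ; ∋? = λ w → ∋? W (0# ◁ w)
      ; resp = λ eq → resp W (◁-cong refl eq)
      ; zero∈ = resp W (mk≋ λ { zero → refl ; (suc i) → refl }) (zero∈ W)
      ; add = λ v∈ w∈ → resp W (mk≋ λ { zero → +-identityˡ 0# ; (suc i) → refl }) (add W v∈ w∈)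
      ; scale = λ a v∈ → resp W (mk≋ λ { zero → zeroʳ a ; (suc i) → refl }) (scale W a v∈) }

    private
      ◁-tail : ∀ (v : V (suc n)) {a} → v zero ≈ a → v ≋ a ◁ (v ∘ suc)
      ◁-tail v eq = mk≋ λ { zero → eq ; (suc i) → refl }

      pivot? : (W : Subspace (suc n) p) → Dec (∃ λ v → W ∋ v × v zero ≉0)
      pivot? W = V-∃? (λ eq (v∈ , v₀≉0) → resp W eq v∈ , ≉0-resp (at eq zero) v₀≉0)
        (λ v → ∋? W v ×-dec ¬? (v zero ≟ 0#))

      no-pivot : (W : Subspace (suc n) p) → ¬ (∃ λ v → W ∋ v × v zero ≉0) → ∀ {v} → W ∋ v → v zero ≈ 0#
      no-pivot W ¬s v∈ = decidable-stable (_ ≟ 0#) (λ v₀≉0 → ¬s (_ , v∈ , v₀≉0))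

      card-hyperplane : (W : Subspace (suc n) p) → (∀ {v} → W ∋ v → v zero ≈ 0#) → card W ≡ card (hyperplane W)
      card-hyperplane W flat = ℕₚ.≤-antisym
        (pigeonhole (λ v w → v ≋ 0# ◁ w) _≋_ (λ p q → ≋-trans p (≋-sym q)) (members-distinct W)
          (All.map (λ {v} v∈ → Any.map (λ eq → ≋-trans (◁-tail v (flat v∈)) (◁-cong refl eq))
            (members-complete (hyperplane W) (resp W (◁-tail v (flat v∈)) v∈))) (members-all W)))
        (pigeonhole (λ w v → 0# ◁ w ≋ v) _≋_ (λ p q → mk≋ λ i → at (≋-trans p (≋-sym q)) (suc i))
          (members-distinct (hyperplane W))
          (All.map (members-complete W) (members-all (hyperplane W))))

    -- Induction on the coordinates: a vector with nonzero first coordinate contributes a factor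
    -- `order`, and the remaining hyperplane loses that coordinate. The exponent is the dimension,
    -- obtained without bases.
    card-power : ∀ n (W : Subspace n p) → ∃ λ e → e ℕ.≤ n × card W ≡ order ℕ.^ e
    card-power zero W = 0 , z≤n , ℕₚ.≤-antisym
      (pigeonhole _≋_ _≋_ (λ p q → ≋-trans p (≋-sym q)) {ys = 𝟎 ∷ []} (members-distinct W)
        (All.tabulate (λ _ → here (mk≋ λ ()))))
      (pigeonhole _≋_ _≋_ (λ p q → ≋-trans p (≋-sym q)) {𝟎 ∷ []} ([] ∷ [])
        (members-complete W (zero∈ W) ∷ []))
    card-power (suc n) W with pivot? W
    ... | no ¬s = let e , e≤n , eq = card-power n (hyperplane W) in
      e , ℕₚ.m≤n⇒m≤1+n e≤n , ≡.trans (card-hyperplane W (no-pivot W ¬s)) eq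
    ... | yes (z , z∈ , z₀≉0) =
      let Z = W ∩ker head-functional
          e , e≤n , eq = card-power n (hyperplane Z) in
      suc e , s≤s e≤n , ≡.trans (card-∩ker W head-functional z∈ z₀≉0)
        (≡.cong (order ℕ.*_) (≡.trans (card-hyperplane Z proj₂) eq))

    -- Elimination on the first coordinate. With a pivot w, subtracting multiples of w reduces
    -- everything to the hyperplane; without one, the first coordinate separates z unless it
    -- vanishes there too, and then the problem drops by one dimension.
    separate : ∀ n (W : Subspace n p) {z} → ¬ W ∋ z →
      ∃ λ f → (∀ {x} → W ∋ x → dot f x ≈ 0#) × dot f z ≉0
    separate zero W z∉ = contradiction (resp W (mk≋ λ ()) (zero∈ W)) z∉
    separate (suc n) W {z} z∉ with pivot? W
    ... | no ¬s with z zero ≟ 0#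
    ...   | yes z₀≈0 =
      let f , kill , f-z = separate n (hyperplane W) (λ z′∈ → z∉ (resp W (≋-sym (◁-tail z z₀≈0)) z′∈)) in
      0# ◁ f
      , (λ {x} x∈ → trans (drop f x)
          (kill (resp W (◁-tail x (no-pivot W ¬s x∈)) x∈)))
      , ≉0-resp (sym (drop f z)) f-z
      where
      drop : ∀ f (x : V (suc n)) → dot (0# ◁ f) x ≈ dot f (x ∘ suc)
      drop f x = trans (+-congʳ (zeroˡ _)) (+-identityˡ _)
    ...   | no z₀≉0 = 1# ◁ 𝟎 , (λ {x} x∈ → trans (first x) (no-pivot W ¬s x∈)) , ≉0-resp (sym (first z)) z₀≉0
      where
      first : ∀ (x : V (suc n)) → dot (1# ◁ 𝟎) x ≈ x zero
      first x = trans (+-cong (*-identityˡ _) (trans (sumF-cong n (λ j → zeroˡ _)) (sumF-0 n))) (+-identityʳ _)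
    separate (suc n) W {z} z∉ | yes (w , w∈ , w₀≉0) =
      f , (λ {x} x∈ → trans (dot-reduce x) (kill (reduce∈ x∈))) , ≉0-resp (sym (dot-reduce z)) f-z
      where
      open ≈-Reasoning
      u = proj₁ (inverse (w zero) w₀≉0)
      w₀u≈1 = proj₂ (inverse (w zero) w₀≉0)
      reduce : V (suc n) → V n
      reduce x i = x (suc i) - (x zero * u) * w (suc i)
      reduce-eq : ∀ x → x ⊖ (x zero * u) ⊙ w ≋ 0# ◁ reduce x
      reduce-eq x = mk≋ λ
        { zero → begin
            x zero - x zero * u * w zero  ≈⟨ solve 3 (λ x u w → x :- x :* u :* w := x :* (:1 :- w :* u)) refl (x zero) u (w zero) ⟩
            x zero * (1# - w zero * u)  ≈⟨ *-congˡ (x≈y⇒x-y≈0 (sym w₀u≈1)) ⟩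
            x zero * 0#  ≈⟨ zeroʳ _ ⟩
            0#  ∎
        ; (suc i) → refl }
      reduce∈ : ∀ {x} → W ∋ x → hyperplane W ∋ reduce x
      reduce∈ {x} x∈ = resp W (reduce-eq x) (sub W x∈ (scale W _ w∈))
      z′∉ : ¬ hyperplane W ∋ reduce z
      z′∉ z′∈ = z∉ (resp W (mk≋ λ i → solve 2 (λ a b → (a :- b) :+ b := a) refl (z i) (z zero * u * w i))
        (add W (resp W (≋-sym (reduce-eq z)) z′∈) (scale W (z zero * u) w∈)))
      rec = separate n (hyperplane W) z′∉
      f′ = proj₁ rec
      kill = proj₁ (proj₂ rec)
      f-z = proj₂ (proj₂ rec)
      -- The first coefficient is the one that makes `f` vanish on the pivot `w`.
      f : V (suc n)
      f = (- (dot f′ (w ∘ suc) * u)) ◁ f′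
      dot-reduce : ∀ x → dot f x ≈ dot f′ (reduce x)
      dot-reduce x = begin
        - (dot f′ (w ∘ suc) * u) * x zero + dot f′ (x ∘ suc)
          ≈⟨ solve 4 (λ d u x e → (:- (d :* u)) :* x :+ e := e :- x :* u :* d) refl _ u (x zero) _ ⟩
        dot f′ (x ∘ suc) - x zero * u * dot f′ (w ∘ suc)  ≈⟨ +-congˡ (-‿cong (F.scale _ _)) ⟨
        dot f′ (x ∘ suc) - dot f′ ((x zero * u) ⊙ (w ∘ suc)) ≈⟨ functional-sub (dot-functional f′) _ _ ⟨
        dot f′ (reduce x)  ∎
        where module F = Functional (dot-functional f′)

  open Subspace using (_∋_; card; members)

  -- Conjugation, trace and norm of the quadratic extension

  module _ (q : ℕ) (pp : IsPrimePower q) (order≡q² : order ≡ q ℕ.^ 2) where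

    module _ where
      open ≈-Reasoning

      conj : Carrier → Carrier
      conj x = pow 𝔽 x q

      private
        pow≡^ : ∀ x k → pow 𝔽 x k ≡ x ^ k
        pow≡^ x zero    = ≡.refl
        pow≡^ x (suc k) = ≡.cong (x *_) (pow≡^ x k)

        conj≈^ : ∀ x → conj x ≈ x ^ q
        conj≈^ x = reflexive (pow≡^ x q)

        order≡q*q : order ≡ q ℕ.* q
        order≡q*q = ≡.trans order≡q² (≡.cong (q ℕ.*_) (ℕₚ.*-identityʳ q))

      Fixed : Carrier → Set ℓ
      Fixed x = conj x ≈ x

      abstract
        conj-cong : ∀ {x y} → x ≈ y → conj x ≈ conj y
        conj-cong {x} {y} eq = trans (conj≈^ x) (trans (^-congˡ q eq) (sym (conj≈^ y)))

        conj-* : ∀ x y → conj (x * y) ≈ conj x * conj y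
        conj-* x y = trans (conj≈^ _) (trans (^-distrib-* x y q) (*-cong (sym (conj≈^ x)) (sym (conj≈^ y))))

        -- Both `q` and `order` are powers of the same prime, which is therefore the characteristic,
        -- so `conj` is an iterate of the Frobenius map.
        conj-+ : ∀ x y → conj (x + y) ≈ conj x + conj y
        conj-+ x y = trans (conj≈^ _) (trans (≡.subst (λ m → (x + y) ^ m ≈ x ^ m + y ^ m) (≡.sym q≡p^k)
            (frobenius^-+ commRing pr (characteristic {p} {k ℕ.* 2} order≡) k x y))
            (+-cong (sym (conj≈^ x)) (sym (conj≈^ y))))
          where
          p k : ℕ
          p = proj₁ pp
          k = suc (proj₁ (proj₂ pp))
          pr : Prime p
          pr = proj₁ (proj₂ (proj₂ pp))
          q≡p^k : q ≡ p ℕ.^ k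
          q≡p^k = proj₂ (proj₂ (proj₂ pp))
          order≡ : order ≡ p ℕ.^ (k ℕ.* 2)
          order≡ = ≡.trans order≡q² (≡.trans (≡.cong (ℕ._^ 2) q≡p^k) (ℕₚ.^-*-assoc p k 2))

        conj-involutive : ∀ x → conj (conj x) ≈ x
        conj-involutive x = begin
          conj (conj x)  ≈⟨ conj≈^ _ ⟩
          conj x ^ q  ≈⟨ ^-congˡ q (conj≈^ x) ⟩
          (x ^ q) ^ q  ≈⟨ ^-assocʳ x q q ⟩
          x ^ (q ℕ.* q)  ≡⟨ ≡.cong (x ^_) (≡.sym order≡q*q) ⟩
          x ^ order  ≈⟨ fermat x ⟩
          x  ∎

        conj-0 : conj 0# ≈ 0#
        conj-0 = begin
          conj 0#  ≈⟨ solve 1 (λ z → z := (z :+ z) :- z) refl (conj 0#) ⟩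
          (conj 0# + conj 0#) - conj 0# ≈⟨ +-congʳ (conj-+ 0# 0#) ⟨
          conj (0# + 0#) - conj 0#  ≈⟨ x≈y⇒x-y≈0 (conj-cong (+-identityˡ 0#)) ⟩
          0#  ∎

        conj-neg : ∀ x → conj (- x) ≈ - conj x
        conj-neg x = begin
          conj (- x)  ≈⟨ solve 2 (λ x y → y := (x :+ y) :- x) refl (conj x) _ ⟩
          (conj x + conj (- x)) - conj x  ≈⟨ +-congʳ (conj-+ x (- x)) ⟨
          conj (x - x) - conj x  ≈⟨ +-congʳ (trans (conj-cong (-‿inverseʳ x)) conj-0) ⟩
          0# - conj x  ≈⟨ +-identityˡ _ ⟩
          - conj x  ∎

        conj-≉0 : ∀ {x} → x ≉0 → conj x ≉0
        conj-≉0 {x} x≉0 eq = x≉0 (trans (sym (conj-involutive x)) (trans (conj-cong eq) conj-0))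

        conj-1 : conj 1# ≈ 1#
        conj-1 = *-cancelˡ-≉0 (conj-≉0 1≉0)
          (trans (sym (conj-* 1# 1#)) (trans (conj-cong (*-identityˡ 1#)) (sym (*-identityʳ _))))

        fixed-resp : ∀ {x y} → x ≈ y → Fixed x → Fixed y
        fixed-resp x≈y fx = trans (conj-cong (sym x≈y)) (trans fx x≈y)

        fixed-inverse : ∀ {x y} → Fixed x → x ≉0 → x * y ≈ 1# → Fixed y
        fixed-inverse {x} {y} fx x≉0 xy≈1 = *-cancelˡ-≉0 x≉0 (begin
          x * conj y  ≈⟨ *-congʳ fx ⟨
          conj x * conj y  ≈⟨ conj-* x y ⟨
          conj (x * y)  ≈⟨ conj-cong xy≈1 ⟩
          conj 1#  ≈⟨ conj-1 ⟩
          1#  ≈⟨ xy≈1 ⟨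
          x * y  ∎)

        fixed-* : ∀ {x y} → Fixed x → Fixed y → Fixed (x * y)
        fixed-* fx fy = trans (conj-* _ _) (*-cong fx fy)

        fixed-neg : ∀ {x} → Fixed x → Fixed (- x)
        fixed-neg fx = trans (conj-neg _) (-‿cong fx)

        fixed-0 : Fixed 0#
        fixed-0 = conj-0

        fixed-trace : ∀ x → Fixed (x + conj x)
        fixed-trace x = trans (conj-+ x (conj x)) (trans (+-congˡ (conj-involutive x)) (+-comm _ _))

        fixed-norm : ∀ x → Fixed (x * conj x)
        fixed-norm x = trans (conj-* x (conj x)) (trans (*-congˡ (conj-involutive x)) (*-comm _ _))

      private
        q′ = proj₁ (primePower-≥2 pp)

        q≡2+q′ : q ≡ suc (suc q′)
        q≡2+q′ = proj₂ (primePower-≥2 pp)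

        evalMonic-replicate : ∀ m x → evalMonic (replicate m 0#) x ≈ x ^ m
        evalMonic-replicate zero    x = refl
        evalMonic-replicate (suc m) x = trans (+-identityˡ _) (*-congˡ (evalMonic-replicate m x))

        -- a + b X + X^q
        trinomial : Carrier → Carrier → List Carrier
        trinomial a b = a ∷ b ∷ replicate q′ 0#

        length-trinomial : ∀ a b → length (trinomial a b) ≡ q
        length-trinomial a b =
          ≡.trans (≡.cong (2 ℕ.+_) (Listₚ.length-replicate q′)) (≡.sym q≡2+q′)

        eval-trinomial : ∀ a b x → evalMonic (trinomial a b) x ≈ a + b * x + conj x
        eval-trinomial a b x = begin
          a + x * (b + x * evalMonic (replicate q′ 0#) x)
            ≈⟨ +-congˡ (*-congˡ (+-congˡ (*-congˡ (evalMonic-replicate q′ x)))) ⟩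
          a + x * (b + x * x ^ q′)
            ≈⟨ solve 4 (λ a b x y → a :+ x :* (b :+ x :* y) := a :+ b :* x :+ x :* (x :* y)) refl a b x (x ^ q′) ⟩
          a + b * x + x ^ suc (suc q′)  ≡⟨ ≡.cong (λ m → a + b * x + x ^ m) (≡.sym q≡2+q′) ⟩
          a + b * x + x ^ q  ≈⟨ +-congˡ (conj≈^ x) ⟨
          a + b * x + conj x  ∎

        q<order : q ℕ.< order
        q<order = ≡.subst (q ℕ.<_) (≡.sym order≡q*q) (≡.subst (λ q → q ℕ.< q ℕ.* q) (≡.sym q≡2+q′)
          (ℕₚ.m<m*n (2 ℕ.+ q′) (2 ℕ.+ q′) (s≤s (s≤s z≤n))))

        non-root : ∀ as → length as ℕ.< order → ∃ λ x → evalMonic as x ≉0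
        non-root as lt with IsFinite.∃? Carrier-finite {P = λ x → evalMonic as x ≉0}
            (λ x≈y → ≉0-resp (eval-cong as x≈y)) (λ x → ¬? (evalMonic as x ≟ 0#))
          where
          eval-cong : ∀ as {x y} → x ≈ y → evalMonic as x ≈ evalMonic as y
          eval-cong []       eq = refl
          eval-cong (a ∷ as) eq = +-congˡ (*-cong eq (eval-cong as eq))
        ... | yes s = s
        ... | no ¬s = contradiction (roots-≤ as distinct
          (All.tabulate (λ {x} _ → decidable-stable (evalMonic as x ≟ 0#) (λ ¬r → ¬s (x , ¬r))))) (ℕₚ.<⇒≱ lt)

        -- The polynomial X^q + b X has degree q, less than the q² elements available. The value b =
        -- -1 supplies an element moved by conjugation, b = 1 an element of nonzero trace.
        trinomial-non-root : ∀ b → ∃ λ x → (b * x + conj x) ≉0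
        trinomial-non-root b =
          let x , nr = non-root (trinomial 0# b) (≡.subst (ℕ._< order) (≡.sym (length-trinomial 0# b)) q<order)
          in x , ≉0-resp (trans (eval-trinomial 0# b x) (+-congʳ (+-identityˡ _))) nr

      abstract
        non-fixed : ∃ λ x → ¬ Fixed x
        non-fixed = let x , nr = trinomial-non-root (- 1#) in x , λ fx → nr (begin
          - 1# * x + conj x  ≈⟨ +-congˡ fx ⟩
          - 1# * x + x  ≈⟨ solve 1 (λ x → (:- :1) :* x :+ x := :0) refl x ⟩
          0#  ∎)

      abstract
        -- The trace is linear over the fixed elements, so one nonzero value can be rescaled to any
        -- other.
        trace-surjective : ∀ {a} → Fixed a → ∃ λ t → t + conj t ≈ a
        trace-surjective {a} fa =
          let x , nr   = trinomial-non-root 1#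
              τ≉0      = ≉0-resp (+-congʳ (*-identityˡ x)) nr
              z , τz≈1 = inverse (x + conj x) τ≉0
              fz       = fixed-inverse (fixed-trace x) τ≉0 τz≈1
          in a * z * x , (begin
            a * z * x + conj (a * z * x)  ≈⟨ +-congˡ (trans (conj-* (a * z) x) (*-congʳ (fixed-* fa fz))) ⟩
            a * z * x + a * z * conj x
              ≈⟨ solve 4 (λ a z x y → a :* z :* x :+ a :* z :* y := a :* ((x :+ y) :* z)) refl a z x (conj x) ⟩
            a * ((x + conj x) * z)  ≈⟨ *-congˡ τz≈1 ⟩
            a * 1#  ≈⟨ *-identityʳ a ⟩
            a  ∎)

      fixed? : U.Decidable Fixed
      fixed? x = conj x ≟ x

      fixedElems : List Carrier
      fixedElems = filter fixed? elems

      fixedElems-fixed : All Fixed fixedElems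
      fixedElems-fixed = all-filter fixed? elems

      fixedElems-distinct : AllPairs (λ x y → ¬ x ≈ y) fixedElems
      fixedElems-distinct = AllPairsₚ.filter⁺ fixed? distinct

      fixedElems-complete : ∀ {x} → Fixed x → Any (x ≈_) fixedElems
      fixedElems-complete fx = any-filter fixed? (complete _) (λ x≈y → fixed-resp x≈y fx)

      fixedElems-≤ : ∀ {xs} → AllPairs (λ x y → ¬ x ≈ y) xs → All Fixed xs → length xs ℕ.≤ q
      fixedElems-≤ {xs} xs! fxs = ≡.subst (length xs ℕ.≤_) (length-trinomial 0# (- 1#))
        (roots-≤ (trinomial 0# (- 1#)) xs! (All.map (λ {x} fx → begin
          evalMonic (trinomial 0# (- 1#)) x  ≈⟨ eval-trinomial 0# (- 1#) x ⟩
          0# + - 1# * x + conj x  ≈⟨ +-congˡ fx ⟩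
          0# + - 1# * x + x  ≈⟨ solve 1 (λ x → :0 :+ (:- :1) :* x :+ x := :0) refl x ⟩
          0#  ∎) fxs))

      -- At most q because fixed elements are roots of X^q - X. At least q because the trace sends
      -- all q² elements to fixed ones, and a fibre consists of roots of X^q + X - y, hence has at
      -- most q members.
      length-fixedElems : length fixedElems ≡ q
      length-fixedElems = ℕₚ.≤-antisym (fixedElems-≤ fixedElems-distinct fixedElems-fixed)
        (ℕₚ.*-cancelʳ-≤ q (length fixedElems) q {{≡.subst ℕ.NonZero (≡.sym q≡2+q′) _}}
          (≡.subst (ℕ._≤ length fixedElems ℕ.* q) order≡q*q
            (fibres-≤ _≈_ (λ x y → x + conj x ≈ y) (λ x y → (x + conj x) ≟ y) q elems fixedElems distinct
              (All.tabulate (λ {x} _ → fixedElems-complete (fixed-trace x)))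
              (λ y zs zs! _ trs → ≡.subst (length zs ℕ.≤_) (length-trinomial (- y) 1#)
                (roots-≤ (trinomial (- y) 1#) zs! (All.map (λ {x} tr → begin
                  evalMonic (trinomial (- y) 1#) x  ≈⟨ eval-trinomial (- y) 1# x ⟩
                  - y + 1# * x + conj x  ≈⟨ solve 3 (λ x y z → (:- y) :+ :1 :* x :+ z := (x :+ z) :- y) refl x y (conj x) ⟩
                  (x + conj x) - y  ≈⟨ x≈y⇒x-y≈0 tr ⟩
                  0#  ∎) trs))))))

      fixedUnits : List Carrier
      fixedUnits = filter (λ x → ¬? (x ≟ 0#)) fixedElems

      fixedUnits-all : All (λ x → Fixed x × x ≉0) fixedUnits
      fixedUnits-all = All.zip (Allₚ.filter⁺ (λ x → ¬? (x ≟ 0#)) fixedElems-fixed , all-filter (λ x → ¬? (x ≟ 0#)) fixedElems)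

      fixedUnits-distinct : AllPairs (λ x y → ¬ x ≈ y) fixedUnits
      fixedUnits-distinct = AllPairsₚ.filter⁺ (λ x → ¬? (x ≟ 0#)) fixedElems-distinct

      fixedUnits-complete : ∀ {x} → Fixed x → x ≉0 → Any (x ≈_) fixedUnits
      fixedUnits-complete fx x≉0 = any-filter (λ x → ¬? (x ≟ 0#)) (fixedElems-complete fx) (λ x≈y → ≉0-resp x≈y x≉0)

      length-fixedUnits : suc (length fixedUnits) ≡ q
      length-fixedUnits = ℕₚ.≤-antisym
        (fixedElems-≤ (All.map (λ (_ , x≉0) 0≈x → x≉0 (sym 0≈x)) fixedUnits-all ∷ fixedUnits-distinct)
          (fixed-0 ∷ All.map proj₁ fixedUnits-all))
        (≡.subst (ℕ._≤ suc (length fixedUnits)) length-fixedElems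
          (pigeonhole _≈_ _≈_ (λ p r → trans p (sym r)) {ys = 0# ∷ fixedUnits} fixedElems-distinct
            (All.map 0-or-unit fixedElems-fixed)))
        where
        0-or-unit : ∀ {x} → Fixed x → Any (x ≈_) (0# ∷ fixedUnits)
        0-or-unit {x} fx with x ≟ 0#
        ... | yes x≈0 = here x≈0
        ... | no x≉0  = there (fixedUnits-complete fx x≉0)

      abstract
        -- If `a` were missed, the q² - 1 units would have norms among at most q - 2 values. Each
        -- value is taken at most q + 1 times, as a root of X^(q + 1) - y, and (q - 2)(q + 1) is too
        -- small.
        norm-surjective : ∀ {a} → Fixed a → a ≉0 → ∃ λ x → x * conj x ≈ a
        norm-surjective {a} fa a≉0 with norm-value? a
          where
          norm-value? : ∀ a → Dec (∃ λ x → x * conj x ≈ a)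
          norm-value? a = IsFinite.∃? Carrier-finite
            (λ x≈y eq → trans (*-cong (sym x≈y) (conj-cong (sym x≈y))) eq) (λ x → (x * conj x) ≟ a)
        ... | yes s = s
        ... | no ¬s = contradiction bound (ℕₚ.<⇒≱ too-many)
          where
          good? : U.Decidable (λ y → ¬ y ≈ 0# × ¬ y ≈ a)
          good? y = ¬? (y ≟ 0#) ×-dec ¬? (y ≟ a)
          values : List Carrier
          values = filter good? fixedElems
          length-values : length values ℕ.≤ q′
          length-values = ℕ.s≤s⁻¹ (ℕ.s≤s⁻¹ (≡.subst (suc (suc (length values)) ℕ.≤_) q≡2+q′
            (fixedElems-≤ {0# ∷ a ∷ values}
              (((λ 0≈a → a≉0 (sym 0≈a)) ∷ All.map (λ (y≉0 , _) 0≈y → y≉0 (sym 0≈y)) (all-filter good? fixedElems))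
               ∷ All.map (λ (_ , y≉a) a≈y → y≉a (sym a≈y)) (all-filter good? fixedElems)
               ∷ AllPairsₚ.filter⁺ good? fixedElems-distinct)
              (fixed-0 ∷ fa ∷ Allₚ.filter⁺ good? fixedElems-fixed))))
          bound : length units ℕ.≤ q′ ℕ.* suc q
          bound = ℕₚ.≤-trans
            (fibres-≤ _≈_ (λ x y → x * conj x ≈ y) (λ x y → (x * conj x) ≟ y) (suc q) units values units-distinct
              (All.map (λ {x} x≉0 → any-filter good? (fixedElems-complete (fixed-norm x))
                (λ n≈y → (λ y≈0 → *-≉0 x≉0 (conj-≉0 x≉0) (trans n≈y y≈0)) , (λ y≈a → ¬s (x , trans n≈y y≈a)))) units-≉0)
              (λ y zs zs! _ norms → ≡.subst (length zs ℕ.≤_) (≡.cong suc (Listₚ.length-replicate q))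
                (roots-≤ (- y ∷ replicate q 0#) zs! (All.map (λ {x} n → begin
                  - y + x * evalMonic (replicate q 0#) x  ≈⟨ +-congˡ (*-congˡ (trans (evalMonic-replicate q x) (sym (conj≈^ x)))) ⟩
                  - y + x * conj x  ≈⟨ +-comm _ _ ⟩
                  x * conj x - y  ≈⟨ x≈y⇒x-y≈0 n ⟩
                  0#  ∎) norms))))
            (ℕₚ.*-monoˡ-≤ (suc q) length-values)
          too-many : q′ ℕ.* suc q ℕ.< length units
          too-many = ℕ.s≤s⁻¹ (≡.subst (suc (suc (q′ ℕ.* suc q)) ℕ.≤_)
            (≡.trans (≡.sym order≡q*q) (≡.sym length-units))
            -- With q = 2 + q′ the left side is 2 + (q - 2)(q + 1) = q² - q, so the slack added on
            -- the next line is exactly q.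
            (≡.subst (λ q → 2 ℕ.+ q′ ℕ.* suc q ℕ.≤ q ℕ.* q) (≡.sym q≡2+q′)
              (ℕₚ.≤-trans (ℕₚ.m≤m+n _ (2 ℕ.+ q′)) (ℕₚ.≤-reflexive
                (NS.solve 1 (λ m → (NS.con 2 NS.:+ m NS.:* (NS.con 3 NS.:+ m)) NS.:+ (NS.con 2 NS.:+ m)
                  NS.:= (NS.con 2 NS.:+ m) NS.:* (NS.con 2 NS.:+ m)) ≡.refl q′)))))

      order>1 : 1 ℕ.< order
      order>1 = ℕₚ.≤-<-trans (≡.subst (1 ℕ.≤_) (≡.sym q≡2+q′) (s≤s z≤n)) q<order

      -- The difference of an element moved by conjugation and its conjugate is a nonzero skew
      -- element. In characteristic 2 such a κ is itself fixed, since κ and - κ coincide.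
      non-fixed-κ : ∃ λ κ → κ ≉0 × conj κ ≈ - κ
      non-fixed-κ with ι , nf ← non-fixed = ι - conj ι , (λ eq → nf (sym (x-y≈0⇒x≈y eq))) , (begin
        conj (ι - conj ι)  ≈⟨ conj-+ ι (- conj ι) ⟩
        conj ι + conj (- conj ι)  ≈⟨ +-congˡ (trans (conj-neg (conj ι)) (-‿cong (conj-involutive ι))) ⟩
        conj ι - ι  ≈⟨ solve 2 (λ x y → y :- x := :- (x :- y)) refl ι (conj ι) ⟩
        - (ι - conj ι)  ∎)

      -- The scalar of the Cayley transform

      private
        identity₁ : ∀ x y p r → x * p - y * r ≈ (r + x * (p + r)) - (1# + (x + y)) * r
        identity₁ = solve 4 (λ x y p r → x :* p :- y :* r := (r :+ x :* (p :+ r)) :- (:1 :+ (x :+ y)) :* r) refl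

        identity₂ : ∀ a p r → (r + a * r * (p + r)) - 0# * r ≈ (1# + a * (p + r)) * r
        identity₂ = solve 3 (λ a p r → (r :+ a :* r :* (p :+ r)) :- :0 :* r := (:1 :+ a :* (p :+ r)) :* r) refl

        identity₃ : ∀ t k s p r → (t + k) * p - (s - k) * r ≈ (t * p - s * r) + k * (p + r)
        identity₃ = solve 5 (λ t k s p r → (t :+ k) :* p :- (s :- k) :* r := (t :* p :- s :* r) :+ k :* (p :+ r)) refl

        identity₄ : ∀ t s p r → (t + s) * p ≈ (t * p - s * r) + s * (p + r)
        identity₄ = solve 4 (λ t s p r → (t :+ s) :* p := (t :* p :- s :* r) :+ s :* (p :+ r)) refl

        module _ {P w : Carrier} (P̄w≈1 : conj P * w ≈ 1#) (t : Carrier) (tr : t + conj t ≈ - 1#) where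
          a·P̄ : t * w * conj P ≈ t
          a·P̄ = begin
            t * w * conj P  ≈⟨ solve 3 (λ t w p → t :* w :* p := t :* (p :* w)) refl t w (conj P) ⟩
            t * (conj P * w)  ≈⟨ *-congˡ P̄w≈1 ⟩
            t * 1#  ≈⟨ *-identityʳ t ⟩
            t  ∎

          ā·P : conj (t * w) * P ≈ conj t
          ā·P = begin
            conj (t * w) * P  ≈⟨ *-congˡ (conj-involutive P) ⟨
            conj (t * w) * conj (conj P)  ≈⟨ conj-* (t * w) (conj P) ⟨
            conj (t * w * conj P)  ≈⟨ conj-cong a·P̄ ⟩
            conj t  ∎

          parameter-trace : 1# + conj (t * w) * P + t * w * conj P ≈ 0#
          parameter-trace = begin
            1# + conj (t * w) * P + t * w * conj P  ≈⟨ +-cong (+-congˡ ā·P) a·P̄ ⟩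
            1# + conj t + t  ≈⟨ +-assoc 1# (conj t) t ⟩
            1# + (conj t + t)  ≈⟨ +-congˡ (trans (+-comm (conj t) t) tr) ⟩
            1# - 1#  ≈⟨ -‿inverseʳ 1# ⟩
            0#  ∎

          parameter-unit : (t * P - conj t * conj P) ≉0 → (1# + t * w * (P + conj P)) ≉0
          parameter-unit ft eq = ft (begin
            t * P - conj t * conj P
              ≈⟨ identity₁ t (conj t) P (conj P) ⟩
            (conj P + t * (P + conj P)) - (1# + (t + conj t)) * conj P
              ≈⟨ +-cong (+-congˡ (*-congʳ (sym a·P̄))) (-‿cong (*-congʳ (trans (+-congˡ tr) (-‿inverseʳ 1#)))) ⟩
            (conj P + t * w * conj P * (P + conj P)) - 0# * conj P
              ≈⟨ identity₂ (t * w) P (conj P) ⟩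
            (1# + t * w * (P + conj P)) * conj P  ≈⟨ *-congʳ eq ⟩
            0# * conj P  ≈⟨ zeroˡ _ ⟩
            0#  ∎)

        shifted-trace : ∀ {t κ} → conj κ ≈ - κ → t + conj t ≈ - 1# → (t + κ) + conj (t + κ) ≈ - 1#
        shifted-trace {t} {κ} conj-κ tr = begin
          (t + κ) + conj (t + κ)  ≈⟨ +-congˡ (trans (conj-+ t κ) (+-congˡ conj-κ)) ⟩
          (t + κ) + (conj t - κ)  ≈⟨ solve 3 (λ t k s → (t :+ k) :+ (s :- k) := t :+ s) refl t κ (conj t) ⟩
          t + conj t  ≈⟨ tr ⟩
          - 1#  ∎

        trace-≉0 : ∀ {P t} → P ≉0 → t + conj t ≈ - 1# → t * P - conj t * conj P ≈ 0# → (P + conj P) ≉0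
        trace-≉0 {P} {t} P≉0 tr ft eq = -‿≉0 P≉0 (begin
          - P  ≈⟨ solve 1 (λ p → :- p := (:- :1) :* p) refl P ⟩
          - 1# * P  ≈⟨ *-congʳ tr ⟨
          (t + conj t) * P  ≈⟨ identity₄ t (conj t) P (conj P) ⟩
          (t * P - conj t * conj P) + conj t * (P + conj P)  ≈⟨ +-cong ft (*-congˡ eq) ⟩
          0# + conj t * 0#  ≈⟨ trans (+-identityˡ _) (zeroʳ _) ⟩
          0#  ∎)

        shifted-≉0 : ∀ {P t κ} → conj κ ≈ - κ → κ ≉0 → t * P - conj t * conj P ≈ 0# → (P + conj P) ≉0 →
          ((t + κ) * P - conj (t + κ) * conj P) ≉0
        shifted-≉0 {P} {t} {κ} conj-κ κ≉0 ft trP≉0 eq = *-≉0 κ≉0 trP≉0 (begin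
          κ * (P + conj P)  ≈⟨ trans (+-congʳ ft) (+-identityˡ _) ⟨
          (t * P - conj t * conj P) + κ * (P + conj P)  ≈⟨ identity₃ t κ (conj t) P (conj P) ⟨
          (t + κ) * P - (conj t - κ) * conj P
            ≈⟨ +-congˡ (-‿cong (*-congʳ (trans (conj-+ t κ) (+-congˡ conj-κ)))) ⟨
          (t + κ) * P - conj (t + κ) * conj P  ≈⟨ eq ⟩
          0#  ∎)

      -- Write a = t / conj P. The first condition becomes t + conj t = -1, and then (1 + a (P +
      -- conj P)) conj P = t P - conj t conj P. Should this vanish, replacing t by t + κ with κ skew
      -- keeps the trace and adds κ (P + conj P). That is nonzero: P + conj P = 0 would give t P -
      -- conj t conj P = (t + conj t) P = - P.
      cayley-parameter : ∀ {P} → P ≉0 → ∃ λ a → 1# + conj a * P + a * conj P ≈ 0# × (1# + a * (P + conj P)) ≉0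
      cayley-parameter {P} P≉0
        with t , tr ← trace-surjective (fixed-neg conj-1)
        with w , P̄w≈1 ← inverse (conj P) (conj-≉0 P≉0)
        with (t * P - conj t * conj P) ≟ 0#
      ... | no ft = t * w , parameter-trace P̄w≈1 t tr , parameter-unit P̄w≈1 t tr ft
      ... | yes ft with κ , κ≉0 , conj-κ ← non-fixed-κ = (t + κ) * w
        , parameter-trace P̄w≈1 (t + κ) (shifted-trace conj-κ tr)
        , parameter-unit P̄w≈1 (t + κ) (shifted-trace conj-κ tr) (shifted-≉0 conj-κ κ≉0 ft (trace-≉0 P≉0 tr ft))

    -- The hermitian form

    module _ (n : ℕ) (H : Mat 𝔽 n)
      (hermitian : Herm.IsHermitian 𝔽 q n H) (nondegenerate : Herm.IsNondegenerate 𝔽 q n H) where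
      private
        module ≋-Reasoning = SetoidReasoning (vecSetoid setoid n)

      module _ where
        open ≈-Reasoning

        B : V n → V n → Carrier
        B = Herm.form 𝔽 q n H

        abstract
          private
            conj-sumF : ∀ n (f : V n) → conj (sumF 𝔽 f) ≈ sumF 𝔽 (λ i → conj (f i))
            conj-sumF zero    f = conj-0
            conj-sumF (suc n) f = trans (conj-+ _ _) (+-congˡ (conj-sumF n (f ∘ suc)))

          B-functional : ∀ v → Functional (B v)
          B-functional v = record
            { cong = λ p → sumF-cong n (λ i → Functional.cong (row i) p)
            ; add = λ w w′ → trans (sumF-cong n (λ i → Functional.add (row i) w w′)) (sumF-+ n _ _)
            ; scale = λ a w → trans (sumF-cong n (λ i → Functional.scale (row i) a w)) (sumF-*ˡ n a _) }
            where
            row : ∀ i → Functional (dot (λ j → conj (v i) * H i j))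
            row i = dot-functional (λ j → conj (v i) * H i j)

          B-conj : ∀ v w → conj (B v w) ≈ B w v
          B-conj v w = begin
            conj (B v w)  ≈⟨ trans (conj-sumF n _) (sumF-cong n (λ i → conj-sumF n _)) ⟩
            sumF 𝔽 (λ i → sumF 𝔽 (λ j → conj (conj (v i) * H i j * w j)))  ≈⟨ sumF-swap n n _ ⟩
            sumF 𝔽 (λ j → sumF 𝔽 (λ i → conj (conj (v i) * H i j * w j)))
              ≈⟨ sumF-cong n (λ j → sumF-cong n (λ i → term i j)) ⟩
            B w v ∎
            where
            term : ∀ i j → conj (conj (v i) * H i j * w j) ≈ conj (w j) * H j i * v i
            term i j = begin
              conj (conj (v i) * H i j * w j)  ≈⟨ trans (conj-* _ _) (*-congʳ (conj-* _ _)) ⟩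
              conj (conj (v i)) * conj (H i j) * conj (w j)
                ≈⟨ *-congʳ (*-cong (conj-involutive _) (sym (hermitian i j))) ⟩
              v i * H j i * conj (w j)  ≈⟨ solve 3 (λ x h y → x :* h :* y := y :* h :* x) refl _ _ _ ⟩
              conj (w j) * H j i * v i  ∎

          B-cong : ∀ {v v′ w w′} → v ≋ v′ → w ≋ w′ → B v w ≈ B v′ w′
          B-cong {v} {v′} {w} {w′} p q = begin
            B v w  ≈⟨ Functional.cong (B-functional v) q ⟩
            B v w′  ≈⟨ B-conj w′ v ⟨
            conj (B w′ v)  ≈⟨ conj-cong (Functional.cong (B-functional w′) p) ⟩
            conj (B w′ v′)  ≈⟨ B-conj w′ v′ ⟩
            B v′ w′  ∎

          B-congˡ : ∀ {v w w′} → w ≋ w′ → B v w ≈ B v w′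
          B-congˡ q = B-cong ≋-refl q

          B-congʳ : ∀ {v v′ w} → v ≋ v′ → B v w ≈ B v′ w
          B-congʳ q = B-cong q ≋-refl

          B-addʳ : ∀ v w w′ → B v (w ⊕ w′) ≈ B v w + B v w′
          B-addʳ v = Functional.add (B-functional v)

          B-scaleʳ : ∀ a v w → B v (a ⊙ w) ≈ a * B v w
          B-scaleʳ a v = Functional.scale (B-functional v) a

          B-subʳ : ∀ v w w′ → B v (w ⊖ w′) ≈ B v w - B v w′
          B-subʳ v = functional-sub (B-functional v)

          B-addˡ : ∀ v v′ w → B (v ⊕ v′) w ≈ B v w + B v′ w
          B-addˡ v v′ w = begin
            B (v ⊕ v′) w  ≈⟨ B-conj w _ ⟨
            conj (B w (v ⊕ v′))  ≈⟨ trans (conj-cong (B-addʳ w v v′)) (conj-+ _ _) ⟩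
            conj (B w v) + conj (B w v′) ≈⟨ +-cong (B-conj w v) (B-conj w v′) ⟩
            B v w + B v′ w  ∎

          B-scaleˡ : ∀ a v w → B (a ⊙ v) w ≈ conj a * B v w
          B-scaleˡ a v w = begin
            B (a ⊙ v) w  ≈⟨ B-conj w _ ⟨
            conj (B w (a ⊙ v))  ≈⟨ trans (conj-cong (B-scaleʳ a w v)) (conj-* _ _) ⟩
            conj a * conj (B w v)  ≈⟨ *-congˡ (B-conj w v) ⟩
            conj a * B v w  ∎

          B-subˡ : ∀ v v′ w → B (v ⊖ v′) w ≈ B v w - B v′ w
          B-subˡ v v′ w = begin
            B (v ⊖ v′) w  ≈⟨ B-conj w _ ⟨
            conj (B w (v ⊖ v′))  ≈⟨ trans (conj-cong (B-subʳ w v v′)) (conj-+ _ _) ⟩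
            conj (B w v) + conj (- B w v′) ≈⟨ +-cong (B-conj w v) (trans (conj-neg _) (-‿cong (B-conj w v′))) ⟩
            B v w - B v′ w  ∎

          B-0ʳ : ∀ v → B v 𝟎 ≈ 0#
          B-0ʳ v = trans (B-congˡ (mk≋ λ i → sym (zeroˡ 0#))) (trans (B-scaleʳ 0# v 𝟎) (zeroˡ _))

          B-0ˡ : ∀ v → B 𝟎 v ≈ 0#
          B-0ˡ v = trans (sym (B-conj v 𝟎)) (trans (conj-cong (B-0ʳ v)) conj-0)

          nondegenerateˡ : ∀ {v} → (∀ w → B v w ≈ 0#) → v ≋ 𝟎
          nondegenerateˡ h = mk≋ (nondegenerate _ h)

          nondegenerateʳ : ∀ {v} → (∀ w → B w v ≈ 0#) → v ≋ 𝟎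
          nondegenerateʳ h = nondegenerateˡ (λ w → trans (sym (B-conj w _)) (trans (conj-cong (h w)) conj-0))

          B-extˡ : ∀ {v v′} → (∀ w → B v w ≈ B v′ w) → v ≋ v′
          B-extˡ h = ⊖≋𝟎⇒≋ (nondegenerateˡ (λ w → trans (B-subˡ _ _ w) (x≈y⇒x-y≈0 (h w))))

          -- Nondegeneracy makes y ↦ B(y , ·) injective, and finiteness makes it onto. Being
          -- conjugate-linear, `row` falls outside `linear-inverse`, so the counting argument is
          -- applied to it directly.
          riesz : ∀ (f : V n) → ∃ λ y → ∀ x → B y x ≈ dot f x
          riesz f =
            let y , eq = V-injective⇒surjective row row-cong row-injective f in
            y , λ x → trans (B-row y x) (sumF-cong n (λ j → *-congʳ (at eq j)))
            where
            row : V n → V n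
            row y j = sumF 𝔽 (λ i → conj (y i) * H i j)
            row-cong : ∀ {y y′} → y ≋ y′ → row y ≋ row y′
            row-cong eq = mk≋ λ j → sumF-cong n (λ i → *-congʳ (conj-cong (at eq i)))
            B-row : ∀ y x → B y x ≈ dot (row y) x
            B-row y x = trans (sumF-swap n n _) (sumF-cong n (λ j →
              trans (sumF-cong n (λ i → *-comm _ _)) (trans (sumF-*ˡ n (x j) _) (*-comm _ _))))
            row-injective : ∀ {y y′} → row y ≋ row y′ → y ≋ y′
            row-injective eq = B-extˡ (λ x → trans (B-row _ x)
              (trans (sumF-cong n (λ j → *-congʳ (at eq j))) (sym (B-row _ x))))

      -- The operator N = 1 - G, its adjoint and the kernels of its powers

      module Isometry (G : V n → V n) (G-linear : Linear G) (G-isometry : ∀ v w → B (G v) (G w) ≈ B v w) where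

        isometry-injective : {f : V n → V n} → Linear f → (∀ v w → B (f v) (f w) ≈ B v w) → ∀ v → f v ≋ 𝟎 → v ≋ 𝟎
        isometry-injective {f} lf iso v fv≋𝟎 = nondegenerateˡ (λ w →
          trans (sym (iso v w)) (trans (B-congʳ fv≋𝟎) (B-0ˡ _)))

        module G = Linear G-linear
        private
          G-inverse = linear-inverse G-linear (isometry-injective G-linear G-isometry)
        open LinearInverse G-inverse public using ()
          renaming (f⁻¹ to G⁻¹; linear to G⁻¹-linear; inverseˡ to G⁻¹G; inverseʳ to GG⁻¹)
        module G⁻¹ = Linear G⁻¹-linear

        Commute : (f g : V n → V n) → Set _
        Commute f g = ∀ x → f (g x) ≋ g (f x)

        -- The adjoint of an isometry `G` is `G⁻¹`, so `N*` is the adjoint of `N`.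
        N N* : V n → V n
        N  v = v ⊖ G v
        N* v = v ⊖ G⁻¹ v

        N-linear : Linear N
        N-linear = ⊖-linear id-linear G-linear
        N*-linear : Linear N*
        N*-linear = ⊖-linear id-linear G⁻¹-linear
        module N = Linear N-linear
        module N* = Linear N*-linear

        N^ N*^ : ℕ → V n → V n
        N^ k  = iter 𝔽 k N
        N*^ k = iter 𝔽 k N*
        module N^ k = Linear (iter-linear k N-linear)
        module N*^ k = Linear (iter-linear k N*-linear)

        iter-shift : ∀ k (f : V n → V n) x → iter 𝔽 k f (f x) ≡ f (iter 𝔽 k f x)
        iter-shift zero    f x = ≡.refl
        iter-shift (suc k) f x = ≡.cong f (iter-shift k f x)

        ≡⇒≋ : {v w : V n} → v ≡ w → v ≋ w
        ≡⇒≋ ≡.refl = ≋-refl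

        N^-shift : ∀ k x → N^ k (N x) ≋ N (N^ k x)
        N^-shift k x = ≡⇒≋ (iter-shift k N x)

        commute-N : ∀ {f} → Linear f → Commute f G → Commute f N
        commute-N lf fG x = ≋-trans (Linear.sub lf x (G x)) (⊖-cong ≋-refl (fG x))

        commute-iter : ∀ {f g : V n → V n} → Linear g → Commute f g → ∀ k → Commute f (iter 𝔽 k g)
        commute-iter lg fg zero    x = ≋-refl
        commute-iter lg fg (suc k) x = ≋-trans (fg _) (Linear.cong lg (commute-iter lg fg k x))

        commute-G : ∀ {f} → Linear f → Commute f N → Commute f G
        commute-G {f} lf fN x = begin
          f (G x)  ≈⟨ F.cong (mk≋ λ i → solve 2 (λ x y → y := x :- (x :- y)) refl (x i) (G x i)) ⟩
          f (x ⊖ N x)  ≈⟨ F.sub x (N x) ⟩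
          f x ⊖ f (N x)  ≈⟨ ⊖-cong ≋-refl (fN x) ⟩
          f x ⊖ N (f x)  ≈⟨ (mk≋ λ i → solve 2 (λ x y → x :- (x :- y) := y) refl (f x i) (G (f x) i)) ⟩
          G (f x)  ∎
          where
          open ≋-Reasoning
          module F = Linear lf

        commute-G⁻¹ : ∀ {f} → Linear f → Commute f G → Commute f G⁻¹
        commute-G⁻¹ {f} lf fG x = begin
          f (G⁻¹ x)  ≈⟨ G⁻¹G _ ⟨
          G⁻¹ (G (f (G⁻¹ x)))  ≈⟨ G⁻¹.cong (fG _) ⟨
          G⁻¹ (f (G (G⁻¹ x)))  ≈⟨ G⁻¹.cong (Linear.cong lf (GG⁻¹ x)) ⟩
          G⁻¹ (f x)  ∎
          where open ≋-Reasoning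

        G⁻¹-commutes-N : Commute G⁻¹ N
        G⁻¹-commutes-N = commute-N G⁻¹-linear (λ x → ≋-trans (G⁻¹G x) (≋-sym (GG⁻¹ x)))

        N*-commutes-N : Commute N* N
        N*-commutes-N = commute-N N*-linear (λ x → ≋-trans (⊖-cong ≋-refl (≋-trans (G⁻¹G x) (≋-sym (GG⁻¹ x))))
          (≋-sym (G.sub x (G⁻¹ x))))

        -- The source of every comparison of `N` with `N*`: as `G⁻¹` is invertible and commutes with
        -- `N`, their powers have the same kernels and images, and where G fixes N x the two differ
        -- only by a sign.
        N*≋-G⁻¹N : ∀ x → N* x ≋ - 1# ⊙ G⁻¹ (N x)
        N*≋-G⁻¹N x = begin
          x ⊖ G⁻¹ x  ≈⟨ mk≋ (λ i → solve 2 (λ x y → x :- y := (:- :1) :* (y :- x)) refl (x i) (G⁻¹ x i)) ⟩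
          - 1# ⊙ (G⁻¹ x ⊖ x)  ≈⟨ ⊙-cong refl (⊖-cong ≋-refl (≋-sym (G⁻¹G x))) ⟩
          - 1# ⊙ (G⁻¹ x ⊖ G⁻¹ (G x))  ≈⟨ ⊙-cong refl (G⁻¹.sub x (G x)) ⟨
          - 1# ⊙ G⁻¹ (N x)  ∎
          where open ≋-Reasoning

        N*∈imN : ∀ x → N* x ≋ N (- 1# ⊙ G⁻¹ x)
        N*∈imN x = ≋-trans (N*≋-G⁻¹N x) (≋-trans (⊙-cong refl (G⁻¹-commutes-N x)) (≋-sym (N.scale (- 1#) (G⁻¹ x))))

        G-adjoint : ∀ x y → B (G x) y ≈ B x (G⁻¹ y)
        G-adjoint x y = trans (B-congˡ (≋-sym (GG⁻¹ y))) (G-isometry x (G⁻¹ y))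

        N-adjoint : ∀ x y → B (N x) y ≈ B x (N* y)
        N-adjoint x y = begin
          B (x ⊖ G x) y  ≈⟨ B-subˡ x (G x) y ⟩
          B x y - B (G x) y  ≈⟨ +-congˡ (-‿cong (G-adjoint x y)) ⟩
          B x y - B x (G⁻¹ y) ≈⟨ B-subʳ x y (G⁻¹ y) ⟨
          B x (N* y)  ∎
          where open ≈-Reasoning

        flip-adjoint : ∀ {f f* : V n → V n} → (∀ x y → B (f x) y ≈ B x (f* y)) → ∀ x y → B (f* x) y ≈ B x (f y)
        flip-adjoint adj x y = trans (sym (B-conj y _)) (trans (conj-cong (sym (adj y x))) (B-conj _ x))

        N^-adjoint : ∀ k x y → B (N^ k x) y ≈ B x (N*^ k y)
        N^-adjoint zero    x y = refl
        N^-adjoint (suc k) x y = begin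
          B (N (N^ k x)) y  ≈⟨ N-adjoint _ y ⟩
          B (N^ k x) (N* y)  ≈⟨ N^-adjoint k x (N* y) ⟩
          B x (N*^ k (N* y))  ≈⟨ B-congˡ (≡⇒≋ (iter-shift k N* y)) ⟩
          B x (N* (N*^ k y))  ∎
          where open ≈-Reasoning

        N*^-adjoint : ∀ k x y → B (N*^ k x) y ≈ B x (N^ k y)
        N*^-adjoint k = flip-adjoint (N^-adjoint k)

        K : ℕ → V n → Set _
        K k x = N^ k x ≋ 𝟎

        K-commute : ∀ k {f x} → Linear f → Commute f N → K k x → K k (f x)
        K-commute k {f} {x} lf fN x∈ = ≋-trans (≋-sym (commute-iter N-linear fN k x))
          (≋-trans (Linear.cong lf x∈) (Linear.zero-map lf))

        K-suc : ∀ k {x} → K k x → K (suc k) x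
        K-suc k x∈ = ≋-trans (N.cong x∈) N.zero-map

        K-≤ : ∀ {j k x} → j ℕ.≤ k → K j x → K k x
        K-≤ j≤k x∈ = go (ℕₚ.≤⇒≤′ j≤k)
          where
          go : ∀ {k} → _ ℕ.≤′ k → K k _
          go ℕ.≤′-refl = x∈
          go (ℕ.≤′-step {k} p) = K-suc k (go p)

        K-N : ∀ k {x} → K (suc k) x → K k (N x)
        K-N k {x} x∈ = ≋-trans (N^-shift k x) x∈

        K-N* : ∀ k {x} → K (suc k) x → K k (N* x)
        K-N* k {x} x∈ = begin
          N^ k (N* x)  ≈⟨ N^.cong k (N*≋-G⁻¹N x) ⟩
          N^ k (- 1# ⊙ G⁻¹ (N x))  ≈⟨ N^.scale k _ _ ⟩
          - 1# ⊙ N^ k (G⁻¹ (N x))  ≈⟨ ⊙-cong refl (K-commute k G⁻¹-linear G⁻¹-commutes-N (K-N k x∈)) ⟩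
          - 1# ⊙ 𝟎  ≈⟨ mk≋ (λ i → zeroʳ _) ⟩
          𝟎  ∎
          where open ≋-Reasoning

        K⇒N*^ : ∀ k {x} → K k x → N*^ k x ≋ 𝟎
        K⇒N*^ zero    x∈ = x∈
        K⇒N*^ (suc k) {x} x∈ = ≋-trans (≋-sym (≡⇒≋ (iter-shift k N* x))) (K⇒N*^ k (K-N* k x∈))

        K-add : ∀ k {x y} → K k x → K k y → K k (x ⊕ y)
        K-add k x∈ y∈ = ≋-trans (N^.add k _ _) (≋-trans (⊕-cong x∈ y∈) (mk≋ λ i → +-identityˡ 0#))

        K-sub : ∀ k {x y} → K k x → K k y → K k (x ⊖ y)
        K-sub k x∈ y∈ = ≋-trans (N^.sub k _ _) (≋-trans (⊖-cong x∈ y∈) (mk≋ λ i → -‿inverseʳ 0#))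

        K-scale : ∀ k a {x} → K k x → K k (a ⊙ x)
        K-scale k a x∈ = ≋-trans (N^.scale k a _) (≋-trans (⊙-cong refl x∈) (mk≋ λ i → zeroʳ a))

        K-resp : ∀ k {x y} → x ≋ y → K k x → K k y
        K-resp k eq x∈ = ≋-trans (N^.cong k (≋-sym eq)) x∈

        -- One half of (ker N^k)^⊥ = im N^k: move N^k across `B` and use that `K k` is killed by
        -- `N*^ k` too.
        K⊥imN^ : ∀ k {x} y → K k x → B x (N^ k y) ≈ 0#
        K⊥imN^ k y x∈ = trans (sym (N*^-adjoint k _ y)) (trans (B-congʳ (K⇒N*^ k x∈)) (B-0ˡ y))

        kerN⇒N* : ∀ {x} → N x ≋ 𝟎 → N* x ≋ 𝟎
        kerN⇒N* Nx = K⇒N*^ 1 Nx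

        -- The sign (-1)^k, which measures how far the form B x (N^ k y) on K (suc k) is from being
        -- hermitian.
        ε : ℕ → Carrier
        ε zero    = 1#
        ε (suc k) = - ε k

        conj-ε : ∀ k → conj (ε k) ≈ ε k
        conj-ε zero    = conj-1
        conj-ε (suc k) = fixed-neg (conj-ε k)

        ε-square : ∀ k → ε k * ε k ≈ 1#
        ε-square zero    = *-identityˡ 1#
        ε-square (suc k) = trans (solve 1 (λ e → (:- e) :* (:- e) := e :* e) refl (ε k)) (ε-square k)

        ε-cases : ∀ k → ε k ≈ 1# ⊎ ε k ≈ - 1#
        ε-cases zero = inj₁ refl
        ε-cases (suc k) with ε-cases k
        ... | inj₁ eq = inj₂ (-‿cong eq)
        ... | inj₂ eq = inj₁ (trans (-‿cong eq) (solve 0 (:- (:- :1) := :1) refl))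

        -- N* = - G⁻¹ N, and G⁻¹ fixes the kernel of N.
        N*^≋εN^ : ∀ k {x} → K (suc k) x → N*^ k x ≋ ε k ⊙ N^ k x
        N*^≋εN^ zero {x} _ = mk≋ λ i → sym (*-identityˡ _)
        N*^≋εN^ (suc k) {x} x∈ = begin
          N* (N*^ k x)  ≈⟨ ≡⇒≋ (iter-shift k N* x) ⟨
          N*^ k (N* x)  ≈⟨ N*^≋εN^ k (K-N* (suc k) x∈) ⟩
          ε k ⊙ N^ k (N* x)  ≈⟨ ⊙-cong refl (commute-iter N-linear N*-commutes-N k x) ⟨
          ε k ⊙ N* y  ≈⟨ ⊙-cong refl N*y ⟩
          ε k ⊙ (- 1# ⊙ N y)  ≈⟨ mk≋ (λ i → solve 2 (λ e x → e :* ((:- :1) :* x) := (:- e) :* x) refl (ε k) (N y i)) ⟩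
          ε (suc k) ⊙ N^ (suc k) x  ∎
          where
          open ≋-Reasoning
          y = N^ k x
          N*y : N* y ≋ - 1# ⊙ N y
          N*y = begin
            N* y  ≈⟨ N*≋-G⁻¹N y ⟩
            - 1# ⊙ G⁻¹ (N y)  ≈⟨ ⊙-cong refl (≋-sym (⊖≋𝟎⇒≋ (kerN⇒N* {N y} x∈))) ⟩
            - 1# ⊙ N y  ∎

        -- The hermitian pairing on each K (suc j)

        private
          abstract
            -- Every scalar s + ε conj s has conjugate ε times itself, so only its being nonzero is
            -- at stake. For ε = 1 an element of trace 1 serves, for ε = -1 an element moved by
            -- conjugation. In characteristic 2 the two signs agree and either choice is sound.
            s-exists : ∀ j → ∃ λ s → (s + ε j * conj s) ≉0
            s-exists j with ε-cases j
            ... | inj₁ ε≈1 = let t , tr = trace-surjective conj-1 in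
              t , ≉0-resp (trans (sym tr) (+-congˡ (sym (trans (*-congʳ ε≈1) (*-identityˡ _))))) 1≉0
            ... | inj₂ ε≈-1 = let t , nf = non-fixed in
              t , λ eq → nf (sym (x-y≈0⇒x≈y (trans (+-congˡ (sym (trans (*-congʳ ε≈-1)
                (solve 1 (λ x → (:- :1) :* x := :- x) refl _)))) eq)))

        s σ : ℕ → Carrier
        s j = proj₁ (s-exists j)
        σ j = s j + ε j * conj (s j)

        σ≉0 : ∀ j → σ j ≉0
        σ≉0 j = proj₂ (s-exists j)

        conj-σ : ∀ j → conj (σ j) ≈ ε j * σ j
        conj-σ j = begin
          conj (s j + ε j * conj (s j))  ≈⟨ trans (conj-+ _ _) (+-congˡ (trans (conj-* _ _) (*-cong (conj-ε j) (conj-involutive _)))) ⟩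
          conj (s j) + ε j * s j  ≈⟨ +-congʳ (trans (*-congʳ (ε-square j)) (*-identityˡ _)) ⟨
          ε j * ε j * conj (s j) + ε j * s j  ≈⟨ solve 3 (λ e s t → e :* e :* t :+ e :* s := e :* (s :+ e :* t)) refl (ε j) (s j) (conj (s j)) ⟩
          ε j * σ j  ∎
          where open ≈-Reasoning

        -- σ j makes the ε j-hermitian form B x (Nʲ y) on K (suc j) hermitian.
        pairing : ℕ → V n → V n → Carrier
        pairing j x y = σ j * B x (N^ j y)

        pairing-functional : ∀ j x → Functional (pairing j x)
        pairing-functional j x = record
          { cong = λ p → *-congˡ (F.cong p)
          ; add = λ v w → trans (*-congˡ (F.add v w)) (distribˡ _ _ _)
          ; scale = λ a v → trans (*-congˡ (F.scale a v)) (solve 3 (λ s a x → s :* (a :* x) := a :* (s :* x)) refl _ a _) }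
          where module F = Functional (functional-∘ (B-functional x) (iter-linear j N-linear))

        module pairing j x = Functional (pairing-functional j x)

        pairing-congˡ : ∀ j {x x′ y} → x ≋ x′ → pairing j x y ≈ pairing j x′ y
        pairing-congˡ j p = *-congˡ (B-congʳ p)

        pairing-addˡ : ∀ j x x′ y → pairing j (x ⊕ x′) y ≈ pairing j x y + pairing j x′ y
        pairing-addˡ j x x′ y = trans (*-congˡ (B-addˡ x x′ _)) (distribˡ _ _ _)

        pairing-subˡ : ∀ j x x′ y → pairing j (x ⊖ x′) y ≈ pairing j x y - pairing j x′ y
        pairing-subˡ j x x′ y = trans (*-congˡ (B-subˡ x x′ _))
          (solve 3 (λ s a b → s :* (a :- b) := s :* a :- s :* b) refl _ _ _)

        pairing-scaleˡ : ∀ j a x y → pairing j (a ⊙ x) y ≈ conj a * pairing j x y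
        pairing-scaleˡ j a x y = trans (*-congˡ (B-scaleˡ a x _))
          (solve 3 (λ s a b → s :* (a :* b) := a :* (s :* b)) refl _ _ _)

        -- Conjugating σ j produces one sign ε j, and moving N^j across `B` produces another through
        -- `N*^≋εN^`; they cancel.
        pairing-conj : ∀ j {x y} → K (suc j) x → conj (pairing j x y) ≈ pairing j y x
        pairing-conj j {x} {y} x∈ = begin
          conj (σ j * B x (N^ j y))  ≈⟨ trans (conj-* _ _) (*-cong (conj-σ j) (B-conj _ _)) ⟩
          ε j * σ j * B (N^ j y) x  ≈⟨ *-congˡ (trans (N^-adjoint j y x) (B-congˡ (N*^≋εN^ j x∈))) ⟩
          ε j * σ j * B y (ε j ⊙ N^ j x)  ≈⟨ *-congˡ (B-scaleʳ _ y _) ⟩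
          ε j * σ j * (ε j * B y (N^ j x))
            ≈⟨ solve 3 (λ e s b → e :* s :* (e :* b) := e :* e :* (s :* b)) refl (ε j) (σ j) _ ⟩
          ε j * ε j * (σ j * B y (N^ j x)) ≈⟨ *-congʳ (ε-square j) ⟩
          1# * pairing j y x  ≈⟨ *-identityˡ _ ⟩
          pairing j y x  ∎
          where open ≈-Reasoning

        pairing-fixed : ∀ j {x} → K (suc j) x → Fixed (pairing j x x)
        pairing-fixed j x∈ = pairing-conj j x∈

        -- N V lies in the radical, so the pairing of elements of `K (suc j)` is insensitive to
        -- changes within a coset.
        pairing-kills-N : ∀ j {x} u → K (suc j) x → pairing j x (N u) ≈ 0#
        pairing-kills-N j {x} u x∈ = trans (*-congˡ (trans (B-congˡ (N^-shift j u)) (K⊥imN^ (suc j) u x∈))) (zeroʳ _)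

        pairing-N-kills : ∀ j {x} u → K (suc j) x → pairing j (N u) x ≈ 0#
        pairing-N-kills j {x} u x∈ = trans (sym (pairing-conj j x∈)) (trans (conj-cong (pairing-kills-N j u x∈)) conj-0)

        -- The centralizer and its orbits on cosets

        record Centralizes (h : V n → V n) : Set (c ⊔ ℓ) where
          field
            linear   : Linear h
            isometry : ∀ v w → B (h v) (h w) ≈ B v w
            commutes : Commute h G

          commutes-N : Commute h N
          commutes-N = commute-N linear commutes

          preserves-pairing : ∀ j v w → pairing j (h v) (h w) ≈ pairing j v w
          preserves-pairing j v w = *-congˡ (trans (B-congˡ (≋-sym (commute-iter N-linear commutes-N j w))) (isometry v _))

          preserves-K : ∀ k {v} → K k v → K k (h v)
          preserves-K k = K-commute k linear commutes-N

        infix 4 _~_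
        -- The mathematical content of `orbitRel`, with linear maps in place of matrices and
        -- existence in place of search.
        _~_ : V n → V n → Set (c ⊔ ℓ)
        v ~ w = ∃ λ h → Centralizes h × ∃ λ u → h v ⊖ w ≋ N u

        ~-mod-N : ∀ {v w} u → v ⊖ w ≋ N u → v ~ w
        ~-mod-N u eq = id , record { linear = id-linear ; isometry = λ _ _ → refl ; commutes = λ _ → ≋-refl } , u , eq

        ~-refl : ∀ {v} → v ~ v
        ~-refl = ~-mod-N 𝟎 (≋-trans (mk≋ λ i → -‿inverseʳ _) (≋-sym N.zero-map))

        ~-sym : ∀ {v w} → v ~ w → w ~ v
        ~-sym {v} {w} (h , ch , u , eq) = I.f⁻¹ , record
          { linear = I.linear
          ; isometry = λ x y → trans (sym (C.isometry _ _)) (B-cong (I.inverseʳ x) (I.inverseʳ y))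
          ; commutes = commutes⁻¹ }
          , - 1# ⊙ I.f⁻¹ u , (begin
            I.f⁻¹ w ⊖ v  ≈⟨ ⊖-cong ≋-refl (I.inverseˡ v) ⟨
            I.f⁻¹ w ⊖ I.f⁻¹ (h v)  ≈⟨ (mk≋ λ i → solve 2 (λ x y → x :- y := (:- :1) :* (y :- x)) refl (I.f⁻¹ w i) (I.f⁻¹ (h v) i)) ⟩
            - 1# ⊙ (I.f⁻¹ (h v) ⊖ I.f⁻¹ w)  ≈⟨ ⊙-cong refl (I⁻¹.sub (h v) w) ⟨
            - 1# ⊙ I.f⁻¹ (h v ⊖ w)  ≈⟨ ⊙-cong refl (≋-trans (I⁻¹.cong eq) (commute-N I.linear commutes⁻¹ u)) ⟩
            - 1# ⊙ N (I.f⁻¹ u)  ≈⟨ N.scale _ _ ⟨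
            N (- 1# ⊙ I.f⁻¹ u)  ∎)
          where
          open ≋-Reasoning
          module C = Centralizes ch
          module I = LinearInverse (linear-inverse C.linear (isometry-injective C.linear C.isometry))
          module I⁻¹ = Linear I.linear
          commutes⁻¹ : Commute I.f⁻¹ G
          commutes⁻¹ x = begin
            I.f⁻¹ (G x)  ≈⟨ I⁻¹.cong (G.cong (I.inverseʳ x)) ⟨
            I.f⁻¹ (G (h (I.f⁻¹ x)))  ≈⟨ I⁻¹.cong (C.commutes _) ⟨
            I.f⁻¹ (h (G (I.f⁻¹ x)))  ≈⟨ I.inverseˡ _ ⟩
            G (I.f⁻¹ x)  ∎

        ~-trans : ∀ {v w x} → v ~ w → w ~ x → v ~ x
        ~-trans {v} {w} {x} (h , ch , u , eq) (k , ck , t , eq′) = k ∘ h , record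
          { linear = ∘-linear D.linear C.linear
          ; isometry = λ a b → trans (D.isometry _ _) (C.isometry a b)
          ; commutes = λ a → ≋-trans (Linear.cong D.linear (C.commutes a)) (D.commutes _) }
          , k u ⊕ t , (begin
            k (h v) ⊖ x  ≈⟨ (mk≋ λ i → solve 3 (λ a b x → a :- x := (a :- b) :+ (b :- x)) refl (k (h v) i) (k w i) (x i)) ⟩
            (k (h v) ⊖ k w) ⊕ (k w ⊖ x)  ≈⟨ ⊕-cong (≋-sym (Linear.sub D.linear _ _)) eq′ ⟩
            k (h v ⊖ w) ⊕ N t  ≈⟨ ⊕-cong (≋-trans (Linear.cong D.linear eq) (D.commutes-N u)) ≋-refl ⟩
            N (k u) ⊕ N t  ≈⟨ N.add _ _ ⟨
            N (k u ⊕ t)  ∎)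
          where
          open ≋-Reasoning
          module C = Centralizes ch
          module D = Centralizes ck

        ~-norm-one : ∀ {a} → a * conj a ≈ 1# → ∀ v → v ~ a ⊙ v
        ~-norm-one {a} aā≈1 v = (a ⊙_) , record
          { linear = ⊙-linear a id-linear
          ; isometry = λ x y → trans (B-scaleˡ a x _) (trans (*-congˡ (B-scaleʳ a x y))
              (trans (solve 3 (λ a b x → b :* (a :* x) := a :* b :* x) refl a (conj a) _)
                (trans (*-congʳ aā≈1) (*-identityˡ _))))
          ; commutes = λ x → ≋-sym (G.scale a x) }
          , 𝟎 , ≋-trans (mk≋ λ i → -‿inverseʳ _) (≋-sym N.zero-map)

        -- The self-adjoint operator Θ and its Cayley transform

        module RankOne (j : ℕ) (u : V n) (u∈ : K (suc j) u) where

          -- Φ j x = Σᵢ B(u , N^(j - i) x) Nⁱ u commutes with N because N^(suc j) u = 0, and Ψ j is its adjoint.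
          Φ Ψ : ℕ → V n → V n
          Φ zero    x = B u x ⊙ u
          Φ (suc i) x = B u (N^ (suc i) x) ⊙ u ⊕ N (Φ i x)
          Ψ zero    y = B u y ⊙ u
          Ψ (suc i) y = B u y ⊙ N*^ (suc i) u ⊕ Ψ i (N* y)

          Φ-linear : ∀ i → Linear (Φ i)
          Φ-linear zero    = functional-linear (B-functional u) u
          Φ-linear (suc i) = ⊕-linear
            (functional-linear (functional-∘ (B-functional u) (iter-linear (suc i) N-linear)) u)
            (∘-linear N-linear (Φ-linear i))

          Ψ-linear : ∀ i → Linear (Ψ i)
          Ψ-linear zero    = functional-linear (B-functional u) u
          Ψ-linear (suc i) = ⊕-linear (functional-linear (B-functional u) (N*^ (suc i) u)) (∘-linear (Ψ-linear i) N*-linear)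

          Ψ-adjoint : ∀ i y x → B (Ψ i y) x ≈ B y (Φ i x)
          Ψ-adjoint zero y x = begin
            B (B u y ⊙ u) x  ≈⟨ B-scaleˡ _ u x ⟩
            conj (B u y) * B u x  ≈⟨ *-congʳ (B-conj u y) ⟩
            B y u * B u x  ≈⟨ *-comm _ _ ⟩
            B u x * B y u  ≈⟨ B-scaleʳ _ y u ⟨
            B y (B u x ⊙ u)  ∎
            where open ≈-Reasoning
          Ψ-adjoint (suc i) y x = begin
            B (B u y ⊙ N*^ (suc i) u ⊕ Ψ i (N* y)) x  ≈⟨ B-addˡ _ _ x ⟩
            B (B u y ⊙ N*^ (suc i) u) x + B (Ψ i (N* y)) x  ≈⟨ +-cong (B-scaleˡ _ _ x) (Ψ-adjoint i (N* y) x) ⟩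
            conj (B u y) * B (N*^ (suc i) u) x + B (N* y) (Φ i x)
              ≈⟨ +-cong (*-cong (B-conj u y) (N*^-adjoint (suc i) u x)) (flip-adjoint N-adjoint y (Φ i x)) ⟩
            B y u * B u (N^ (suc i) x) + B y (N (Φ i x))
              ≈⟨ +-congʳ (trans (*-comm _ _) (sym (B-scaleʳ _ y u))) ⟩
            B y (B u (N^ (suc i) x) ⊙ u) + B y (N (Φ i x))  ≈⟨ B-addʳ y _ _ ⟨
            B y (Φ (suc i) x)  ∎
            where open ≈-Reasoning

          -- In the commutator of `Φ i` with `N` all terms cancel except the two at the ends. For i
          -- = j both of these vanish as well: one contains N^(j + 1) u, the other pairs u with the
          -- image of N^(j + 1).
          Φ-shift : ∀ i x → B u (N^ (suc i) x) ⊙ u ⊕ N (Φ i x) ≋ Φ i (N x) ⊕ B u x ⊙ N^ (suc i) u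
          Φ-shift zero x = ⊕-cong ≋-refl (N.scale _ u)
          Φ-shift (suc i) x = begin
            B u (N^ (suc (suc i)) x) ⊙ u ⊕ N (Φ (suc i) x)
              ≈⟨ ⊕-cong (⊙-cong (B-congˡ (≋-sym (N^-shift (suc i) x))) ≋-refl) (N.cong (Φ-shift i x)) ⟩
            B u (N^ (suc i) (N x)) ⊙ u ⊕ N (Φ i (N x) ⊕ B u x ⊙ N^ (suc i) u)
              ≈⟨ ⊕-cong ≋-refl (≋-trans (N.add _ _) (⊕-cong ≋-refl (N.scale _ _))) ⟩
            B u (N^ (suc i) (N x)) ⊙ u ⊕ (N (Φ i (N x)) ⊕ B u x ⊙ N^ (suc (suc i)) u)
              ≈⟨ (mk≋ λ _ → sym (+-assoc _ _ _)) ⟩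
            Φ (suc i) (N x) ⊕ B u x ⊙ N^ (suc (suc i)) u ∎
            where open ≋-Reasoning

          Φ-commutes : Commute (Φ j) G
          Φ-commutes = commute-G (Φ-linear j) λ x → begin
            Φ j (N x)
              ≈⟨ (mk≋ λ i → sym (trans (+-congˡ (trans (*-congˡ (at u∈ i)) (zeroʳ _))) (+-identityʳ _))) ⟩
            Φ j (N x) ⊕ B u x ⊙ N^ (suc j) u  ≈⟨ Φ-shift j x ⟨
            B u (N^ (suc j) x) ⊙ u ⊕ N (Φ j x)
              ≈⟨ (mk≋ λ i → trans (+-congʳ (trans (*-congʳ (K⊥imN^ (suc j) x u∈)) (zeroˡ _))) (+-identityˡ _)) ⟩
            N (Φ j x)  ∎
            where open ≋-Reasoning

          -- `Φ j` commutes with `G⁻¹`, the adjoint of `G`; taking adjoints carries this over to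
          -- `Ψ j` and `G`.
          Ψ-commutes : Commute (Ψ j) G
          Ψ-commutes y = B-extˡ λ x → begin
            B (Ψ j (G y)) x  ≈⟨ Ψ-adjoint j (G y) x ⟩
            B (G y) (Φ j x)  ≈⟨ G-adjoint y _ ⟩
            B y (G⁻¹ (Φ j x))  ≈⟨ B-congˡ (commute-G⁻¹ (Φ-linear j) Φ-commutes x) ⟨
            B y (Φ j (G⁻¹ x))  ≈⟨ Ψ-adjoint j y (G⁻¹ x) ⟨
            B (Ψ j y) (G⁻¹ x)  ≈⟨ G-adjoint _ x ⟨
            B (G (Ψ j y)) x  ∎
            where open ≈-Reasoning

          Φ-mod-N : ∀ i x → ∃ λ z → Φ i x ≋ B u (N^ i x) ⊙ u ⊕ N z
          Φ-mod-N zero    x = 𝟎 , mk≋ λ i → sym (trans (+-congˡ (at N.zero-map i)) (+-identityʳ _))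
          Φ-mod-N (suc i) x = Φ i x , ≋-refl

          Ψ-mod-N : ∀ i y → ∃ λ z → Ψ i y ≋ B u (N*^ i y) ⊙ u ⊕ N z
          Ψ-mod-N zero    y = 𝟎 , mk≋ λ i → sym (trans (+-congˡ (at N.zero-map i)) (+-identityʳ _))
          -- The vector `t` is the preimage from `N*∈imN`, chosen so that N t = N*^(i + 1) u.
          Ψ-mod-N (suc i) y = let z , eq = Ψ-mod-N i (N* y) ; t = - 1# ⊙ G⁻¹ (N*^ i u) in
            B u y ⊙ t ⊕ z , (begin
            B u y ⊙ N* (N*^ i u) ⊕ Ψ i (N* y)
              ≈⟨ ⊕-cong (≋-trans (⊙-cong refl (N*∈imN _)) (≋-sym (N.scale _ t)))
                   (≋-trans eq (⊕-cong (⊙-cong (B-congˡ (≡⇒≋ (iter-shift i N* y))) ≋-refl) ≋-refl)) ⟩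
            N (B u y ⊙ t) ⊕ (B u (N*^ (suc i) y) ⊙ u ⊕ N z)
              ≈⟨ (mk≋ λ i → solve 3 (λ a b c → a :+ (b :+ c) := b :+ (a :+ c)) refl (N (B u y ⊙ t) i) _ (N z i)) ⟩
            B u (N*^ (suc i) y) ⊙ u ⊕ (N (B u y ⊙ t) ⊕ N z)  ≈⟨ ⊕-cong ≋-refl (N.add _ _) ⟨
            B u (N*^ (suc i) y) ⊙ u ⊕ N (B u y ⊙ t ⊕ z)  ∎)
            where open ≋-Reasoning

          -- This feeds `T-injective`: a vector killed by `T a` is a multiple of its image under
          -- `Θ`, so it lies in `K (suc j)`, where `N` is nilpotent.
          Φ-image : ∀ i x → K (suc j) (Φ i x)
          Φ-image zero    x = K-scale (suc j) _ u∈
          Φ-image (suc i) x = K-add (suc j) (K-scale (suc j) _ u∈) (K-commute (suc j) N-linear (λ _ → ≋-refl) (Φ-image i x))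

          Ψ-image : ∀ i x → K (suc j) (Ψ i x)
          Ψ-image zero    x = K-scale (suc j) _ u∈
          Ψ-image (suc i) x = K-add (suc j) (K-scale (suc j) _ (N*^-image (suc i))) (Ψ-image i (N* x))
            where
            N*^-image : ∀ i → K (suc j) (N*^ i u)
            N*^-image zero    = u∈
            N*^-image (suc i) = K-commute (suc j) N*-linear N*-commutes-N (N*^-image i)

          -- On ker N only the summand without a power of N inside `B` survives. Thus `Θ` restricts
          -- to a rank one map there, which makes the kernel of `T a` computable.
          Φ-kerN : ∀ i {y} → N y ≋ 𝟎 → Φ i y ≋ B u y ⊙ N^ i u
          Φ-kerN zero    _ = ≋-refl
          Φ-kerN (suc i) {y} Ny = begin
            B u (N^ (suc i) y) ⊙ u ⊕ N (Φ i y)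
              ≈⟨ ⊕-cong (⊙-cong (trans (B-congˡ (K-≤ {1} {suc i} (s≤s z≤n) Ny)) (B-0ʳ u)) ≋-refl)
                   (≋-trans (N.cong (Φ-kerN i Ny)) (N.scale _ _)) ⟩
            0# ⊙ u ⊕ B u y ⊙ N^ (suc i) u  ≈⟨ (mk≋ λ _ → trans (+-congʳ (zeroˡ _)) (+-identityˡ _)) ⟩
            B u y ⊙ N^ (suc i) u  ∎
            where open ≋-Reasoning

          Ψ-kerN : ∀ i {y} → N y ≋ 𝟎 → Ψ i y ≋ B u y ⊙ N*^ i u
          Ψ-kerN zero    _ = ≋-refl
          Ψ-kerN (suc i) {y} Ny = ≋-trans
            (⊕-cong ≋-refl (≋-trans (Linear.cong (Ψ-linear i) (kerN⇒N* {y} Ny)) (Linear.zero-map (Ψ-linear i))))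
            (mk≋ λ _ → +-identityʳ _)

          -- Conjugate coefficients on the adjoint pair `Φ j`, `Ψ j` make the sum self-adjoint.
          -- Modulo N V the two leading terms differ by the factor ε j and add up to s + ε conj s,
          -- which is why σ j has that form.
          Θ : V n → V n
          Θ x = s j ⊙ Φ j x ⊕ conj (s j) ⊙ Ψ j x

          Θ-linear : Linear Θ
          Θ-linear = ⊕-linear (⊙-linear _ (Φ-linear j)) (⊙-linear _ (Ψ-linear j))
          module Θ = Linear Θ-linear

          Θ-selfadjoint : ∀ x y → B (Θ x) y ≈ B x (Θ y)
          Θ-selfadjoint x y = begin
            B (Θ x) y
              ≈⟨ trans (B-addˡ _ _ y) (+-cong (B-scaleˡ _ _ y) (B-scaleˡ _ _ y)) ⟩
            conj (s j) * B (Φ j x) y + conj (conj (s j)) * B (Ψ j x) y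
              ≈⟨ +-cong (*-congˡ (flip-adjoint (Ψ-adjoint j) x y)) (*-cong (conj-involutive _) (Ψ-adjoint j x y)) ⟩
            conj (s j) * B x (Ψ j y) + s j * B x (Φ j y)  ≈⟨ +-comm _ _ ⟩
            s j * B x (Φ j y) + conj (s j) * B x (Ψ j y)
              ≈⟨ trans (B-addʳ x _ _) (+-cong (B-scaleʳ _ x _) (B-scaleʳ _ x _)) ⟨
            B x (Θ y)  ∎
            where open ≈-Reasoning

          Θ-commutes : Commute Θ G
          Θ-commutes x = ≋-trans (⊕-cong (⊙-cong refl (Φ-commutes x)) (⊙-cong refl (Ψ-commutes x)))
            (≋-sym (≋-trans (G.add _ _) (⊕-cong (G.scale _ _) (G.scale _ _))))

          Θ-image : ∀ x → K (suc j) (Θ x)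
          Θ-image x = K-add (suc j) (K-scale (suc j) _ (Φ-image j x)) (K-scale (suc j) _ (Ψ-image j x))

          Θ-mod-N : ∀ {x} → K (suc j) x → ∃ λ z → Θ x ≋ pairing j u x ⊙ u ⊕ N z
          Θ-mod-N {x} x∈ = let a , eqa = Φ-mod-N j x ; b , eqb = Ψ-mod-N j x in
            s j ⊙ a ⊕ conj (s j) ⊙ b , (begin
            s j ⊙ Φ j x ⊕ conj (s j) ⊙ Ψ j x
              ≈⟨ ⊕-cong (⊙-cong refl eqa) (⊙-cong refl (≋-trans eqb (⊕-cong (⊙-cong
                   (trans (B-congˡ (N*^≋εN^ j x∈)) (B-scaleʳ _ u _)) ≋-refl) ≋-refl))) ⟩
            s j ⊙ (B u (N^ j x) ⊙ u ⊕ N a) ⊕ conj (s j) ⊙ ((ε j * B u (N^ j x)) ⊙ u ⊕ N b)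
              ≈⟨ (mk≋ λ i → solve 7 (λ s t e b x y z →
                    s :* (b :* x :+ y) :+ t :* (e :* b :* x :+ z) := (s :+ e :* t) :* b :* x :+ (s :* y :+ t :* z))
                    refl (s j) (conj (s j)) (ε j) _ (u i) (N a i) (N b i)) ⟩
            pairing j u x ⊙ u ⊕ (s j ⊙ N a ⊕ conj (s j) ⊙ N b)
              ≈⟨ ⊕-cong ≋-refl (≋-trans (N.add _ _) (⊕-cong (N.scale _ _) (N.scale _ _))) ⟨
            pairing j u x ⊙ u ⊕ N (s j ⊙ a ⊕ conj (s j) ⊙ b) ∎)
            where open ≋-Reasoning

          Θ-kerN : ∀ {y} → N y ≋ 𝟎 → Θ y ≋ (σ j * B u y) ⊙ N^ j u
          Θ-kerN {y} Ny = begin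
            s j ⊙ Φ j y ⊕ conj (s j) ⊙ Ψ j y
              ≈⟨ ⊕-cong (⊙-cong refl (Φ-kerN j Ny)) (⊙-cong refl (≋-trans (Ψ-kerN j Ny) (⊙-cong refl (N*^≋εN^ j u∈)))) ⟩
            s j ⊙ B u y ⊙ N^ j u ⊕ conj (s j) ⊙ B u y ⊙ ε j ⊙ N^ j u
              ≈⟨ (mk≋ λ i → solve 5 (λ s t e b x → s :* (b :* x) :+ t :* (b :* (e :* x)) := (s :+ e :* t) :* b :* x)
                   refl (s j) (conj (s j)) (ε j) (B u y) (N^ j u i)) ⟩
            (σ j * B u y) ⊙ N^ j u ∎
            where open ≋-Reasoning

          -- The Cayley transform (1 + a Θ)⁻¹ (1 + ā Θ) of the self-adjoint Θ is an isometry.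
          T : Carrier → V n → V n
          T a x = x ⊕ a ⊙ Θ x

          T-linear : ∀ a → Linear (T a)
          T-linear a = ⊕-linear id-linear (⊙-linear a Θ-linear)

          T-adjoint : ∀ a x y → B (T a x) y ≈ B x (T (conj a) y)
          T-adjoint a x y = begin
            B (x ⊕ a ⊙ Θ x) y  ≈⟨ trans (B-addˡ _ _ y) (+-congˡ (B-scaleˡ a _ y)) ⟩
            B x y + conj a * B (Θ x) y  ≈⟨ +-congˡ (*-congˡ (Θ-selfadjoint x y)) ⟩
            B x y + conj a * B x (Θ y)  ≈⟨ trans (B-addʳ x _ _) (+-congˡ (B-scaleʳ _ x _)) ⟨
            B x (T (conj a) y)  ∎
            where open ≈-Reasoning

          T-comm : ∀ a b x → T a (T b x) ≋ T b (T a x)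
          T-comm a b x = begin
            T b x ⊕ a ⊙ Θ (T b x)  ≈⟨ expand a b ⟩
            x ⊕ b ⊙ Θ x ⊕ a ⊙ (Θ x ⊕ b ⊙ Θ (Θ x))
              ≈⟨ (mk≋ λ i → solve 5 (λ a b x y z → x :+ b :* y :+ a :* (y :+ b :* z) := x :+ a :* y :+ b :* (y :+ a :* z))
                   refl a b (x i) (Θ x i) (Θ (Θ x) i)) ⟩
            x ⊕ a ⊙ Θ x ⊕ b ⊙ (Θ x ⊕ a ⊙ Θ (Θ x))  ≈⟨ expand b a ⟨
            T a x ⊕ b ⊙ Θ (T a x)  ∎
            where
            open ≋-Reasoning
            expand : ∀ a b → T b x ⊕ a ⊙ Θ (T b x) ≋ x ⊕ b ⊙ Θ x ⊕ a ⊙ (Θ x ⊕ b ⊙ Θ (Θ x))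
            expand a b = ⊕-cong ≋-refl (⊙-cong refl (≋-trans (Θ.add _ _) (⊕-cong ≋-refl (Θ.scale _ _))))

          T-commutes : ∀ a → Commute (T a) G
          T-commutes a x = ≋-trans (⊕-cong ≋-refl (⊙-cong refl (Θ-commutes x)))
            (≋-sym (≋-trans (G.add _ _) (⊕-cong ≋-refl (G.scale _ _))))

          module _ (a : Carrier) (a-good : (1# + a * pairing j u u) ≉0) where

            private
              -- For y in ker N, `T a` adds the vector a σ B(u , y) N^j u, so a killed y is a
              -- multiple of N^j u. Applying B(u , ·) turns this into (1 + a ⟨u , u⟩) B(u , y) = 0,
              -- and the first factor is nonzero by `a-good`.
              T-kerN : ∀ {y} → N y ≋ 𝟎 → T a y ≋ 𝟎 → y ≋ 𝟎
              T-kerN {y} Ny Ty = ≋-trans y≋ (≋-trans (⊙-cong Buy≈0 ≋-refl) (mk≋ λ _ → zeroˡ _))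
                where
                y≋ : y ≋ (B u y) ⊙ ((- (a * σ j)) ⊙ N^ j u)
                y≋ = ≋-sym (begin
                  B u y ⊙ - (a * σ j) ⊙ N^ j u
                    ≈⟨ (mk≋ λ i → solve 4 (λ b a s x → b :* ((:- (a :* s)) :* x) := :0 :- a :* ((s :* b) :* x)) refl (B u y) a (σ j) (N^ j u i)) ⟩
                  𝟎 ⊖ a ⊙ (σ j * B u y) ⊙ N^ j u  ≈⟨ ⊖-cong (≋-sym Ty) (⊙-cong refl (≋-sym (Θ-kerN Ny))) ⟩
                  T a y ⊖ a ⊙ Θ y  ≈⟨ (mk≋ λ i → solve 2 (λ x y → (x :+ y) :- y := x) refl (y i) (a * Θ y i)) ⟩
                  y  ∎)
                  where open ≋-Reasoning
                Buy≈0 : B u y ≈ 0#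
                Buy≈0 = zero-product (begin
                  (1# + a * (σ j * B u (N^ j u))) * B u y
                    ≈⟨ solve 4 (λ a s b c → (:1 :+ a :* (s :* c)) :* b := b :- b :* ((:- (a :* s)) :* c)) refl a (σ j) (B u y) _ ⟩
                  B u y - B u y * (- (a * σ j) * B u (N^ j u))
                    ≈⟨ +-congˡ (-‿cong (*-congˡ (sym (B-scaleʳ _ u _)))) ⟩
                  B u y - B u y * B u (- (a * σ j) ⊙ N^ j u)
                    ≈⟨ x≈y⇒x-y≈0 (trans (B-congˡ y≋) (B-scaleʳ _ u _)) ⟩
                  0#  ∎) a-good
                  where open ≈-Reasoning

              -- N^k x lies in ker N and is killed by `T a` along with x, so it is zero and k drops
              -- by one.
              T-K : ∀ k {x} → K k x → T a x ≋ 𝟎 → x ≋ 𝟎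
              T-K zero    x∈ _ = x∈
              T-K (suc k) {x} x∈ Tx = T-K k (T-kerN x∈ (begin
                  T a (N^ k x)  ≈⟨ commute-iter N-linear (commute-N (T-linear a) (T-commutes a)) k x ⟩
                  N^ k (T a x)  ≈⟨ N^.cong k Tx ⟩
                  N^ k 𝟎  ≈⟨ N^.zero-map k ⟩
                  𝟎  ∎)) Tx
                where open ≋-Reasoning

            T-injective : ∀ x → T a x ≋ 𝟎 → x ≋ 𝟎
            T-injective x Tx = T-K (suc j) (K-resp (suc j) (≋-sym x≋) (K-scale (suc j) (- a) (Θ-image x))) Tx
              where
              x≋ : x ≋ - a ⊙ Θ x
              x≋ = ⊖≋𝟎⇒≋ (≋-trans (mk≋ λ i → solve 3 (λ x a y → x :- (:- a) :* y := x :+ a :* y) refl (x i) a (Θ x i)) Tx)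

            private
              module I = LinearInverse (linear-inverse (T-linear a) T-injective)
              T⁻¹ = I.f⁻¹
              module T⁻¹ = Linear I.linear

              T⁻¹-commutes : Commute T⁻¹ G
              T⁻¹-commutes x = begin
                T⁻¹ (G x)  ≈⟨ T⁻¹.cong (G.cong (I.inverseʳ x)) ⟨
                T⁻¹ (G (T a (T⁻¹ x)))  ≈⟨ T⁻¹.cong (T-commutes a _) ⟨
                T⁻¹ (T a (G (T⁻¹ x)))  ≈⟨ I.inverseˡ _ ⟩
                G (T⁻¹ x)  ∎
                where open ≋-Reasoning

            cayley : V n → V n
            cayley x = T⁻¹ (T (conj a) x)

            cayley-centralizes : Centralizes cayley
            cayley-centralizes = record
              { linear = ∘-linear I.linear (T-linear (conj a))
              ; isometry = iso
              ; commutes = λ x → ≋-trans (T⁻¹.cong (T-commutes (conj a) x)) (T⁻¹-commutes _) }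
              where
              -- Write y = T a z. Since `T a` and `T (conj a)` commute, cayley y = T (conj a) z, and
              -- moving this operator to the left argument cancels the inverse there.
              iso : ∀ x y → B (cayley x) (cayley y) ≈ B x y
              iso x y = begin
                B (cayley x) (cayley y)  ≈⟨ B-congˡ cayley-y ⟩
                B (cayley x) (T (conj a) z)  ≈⟨ T-adjoint a _ z ⟨
                B (T a (cayley x)) z  ≈⟨ B-congʳ (I.inverseʳ _) ⟩
                B (T (conj a) x) z  ≈⟨ T-adjoint (conj a) x z ⟩
                B x (T (conj (conj a)) z)  ≈⟨ B-congˡ (⊕-cong ≋-refl (⊙-cong (conj-involutive a) ≋-refl)) ⟩
                B x (T a z)  ≈⟨ B-congˡ (I.inverseʳ y) ⟩
                B x y  ∎
                where
                open ≈-Reasoning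
                z = T⁻¹ y
                cayley-y : cayley y ≋ T (conj a) z
                cayley-y = ≋-trans (T⁻¹.cong (≋-trans (Linear.cong (T-linear (conj a)) (≋-sym (I.inverseʳ y)))
                  (T-comm (conj a) a z))) (I.inverseˡ _)

            private
              split : ∀ b p u x → b * (p * u + x) ≈ b * p * u + b * x
              split = solve 4 (λ b p u x → b :* (p :* u :+ x) := b :* p :* u :+ b :* x) refl

              gather : ∀ v w p x r y u → v - w ≈ u →
                (v + (p * u + x)) - (w + (r * u + y)) ≈ (1# + p - r) * u + (x - y)
              gather v w p x r y u v-w≈u = trans
                (solve 6 (λ v w P x R y → (v :+ (P :+ x)) :- (w :+ (R :+ y)) := (v :- w) :+ (P :- R) :+ (x :- y)) refl v w (p * u) x (r * u) y)
                (+-congʳ (trans (+-congʳ v-w≈u) (solve 3 (λ p r u → u :+ (p :* u :- r :* u) := (:1 :+ p :- r) :* u) refl p r u)))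

              -- Modulo N V the difference is (1 + conj a p - a r) u, because v - w = u. Comparing
              -- `T (conj a) v` with `T a w` postpones the inverse of `T a` to `cayley-difference`,
              -- where it merely preserves N V.
              T-difference : ∀ {v w x y p r} → v ⊖ w ≋ u → Θ v ≋ p ⊙ u ⊕ N x → Θ w ≋ r ⊙ u ⊕ N y →
                1# + conj a * p - a * r ≈ 0# → T (conj a) v ⊖ T a w ≋ conj a ⊙ N x ⊖ a ⊙ N y
              T-difference {v} {w} {x} {y} {p} {r} u≋ eqx eqy coeff = mk≋ λ i → begin
                (v i + conj a * Θ v i) - (w i + a * Θ w i)
                  ≈⟨ +-cong (+-congˡ (trans (*-congˡ (at eqx i)) (split (conj a) p (u i) (N x i))))
                       (-‿cong (+-congˡ (trans (*-congˡ (at eqy i)) (split a r (u i) (N y i))))) ⟩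
                (v i + (conj a * p * u i + conj a * N x i)) - (w i + (a * r * u i + a * N y i))
                  ≈⟨ gather (v i) (w i) (conj a * p) (conj a * N x i) (a * r) (a * N y i) (u i) (at u≋ i) ⟩
                (1# + conj a * p - a * r) * u i + (conj a * N x i - a * N y i)
                  ≈⟨ trans (+-congʳ (trans (*-congʳ coeff) (zeroˡ _))) (+-identityˡ _) ⟩
                conj a * N x i - a * N y i ∎
                where open ≈-Reasoning

              cayley-difference : ∀ {v w x y} → T (conj a) v ⊖ T a w ≋ conj a ⊙ N x ⊖ a ⊙ N y →
                cayley v ⊖ w ≋ N (T⁻¹ (conj a ⊙ x ⊖ a ⊙ y))
              cayley-difference {v} {w} {x} {y} eq = begin
                T⁻¹ (T (conj a) v) ⊖ w  ≈⟨ ⊖-cong ≋-refl (I.inverseˡ w) ⟨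
                T⁻¹ (T (conj a) v) ⊖ T⁻¹ (T a w)  ≈⟨ T⁻¹.sub _ _ ⟨
                T⁻¹ (T (conj a) v ⊖ T a w)  ≈⟨ T⁻¹.cong eq ⟩
                T⁻¹ (conj a ⊙ N x ⊖ a ⊙ N y)  ≈⟨ T⁻¹.cong (⊖-cong (N.scale (conj a) x) (N.scale a y)) ⟨
                T⁻¹ (N (conj a ⊙ x) ⊖ N (a ⊙ y))  ≈⟨ T⁻¹.cong (N.sub (conj a ⊙ x) (a ⊙ y)) ⟨
                T⁻¹ (N (conj a ⊙ x ⊖ a ⊙ y))  ≈⟨ commute-N I.linear T⁻¹-commutes _ ⟩
                N (T⁻¹ (conj a ⊙ x ⊖ a ⊙ y))  ∎
                where open ≋-Reasoning

            cayley-moves : ∀ {v w} → K (suc j) v → K (suc j) w → v ⊖ w ≋ u →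
              1# + conj a * pairing j u v - a * pairing j u w ≈ 0# → ∃ λ z → cayley v ⊖ w ≋ N z
            cayley-moves {v} {w} v∈ w∈ u≋ coeff = combine (Θ-mod-N v∈) (Θ-mod-N w∈)
              where
              combine : (∃ λ x → Θ v ≋ pairing j u v ⊙ u ⊕ N x) → (∃ λ y → Θ w ≋ pairing j u w ⊙ u ⊕ N y) →
                ∃ λ z → cayley v ⊖ w ≋ N z
              combine (x , eqx) (y , eqy) = T⁻¹ (conj a ⊙ x ⊖ a ⊙ y) ,
                cayley-difference {v} {w} {x} {y} (T-difference {v} {w} {x} {y} u≋ eqx eqy coeff)

        -- Equal values imply equivalence

        cayley-transitive : ∀ j {v w} → K (suc j) v → K (suc j) w → pairing j v v ≈ pairing j w w →
          pairing j (v ⊖ w) v ≉0 → v ~ w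
        cayley-transitive j {v} {w} v∈ w∈ vv≈ww P≉0 with a , eq , good ← cayley-parameter P≉0 =
          R.cayley a good′ , R.cayley-centralizes a good′ , R.cayley-moves a good′ v∈ w∈ ≋-refl (begin
            1# + conj a * P - a * pairing j u w  ≈⟨ +-congˡ (-‿cong (*-congˡ uw)) ⟩
            1# + conj a * P - a * - conj P  ≈⟨ +-congˡ (solve 2 (λ a p → :- (a :* (:- p)) := a :* p) refl a (conj P)) ⟩
            1# + conj a * P + a * conj P  ≈⟨ eq ⟩
            0#  ∎)
          where
          open ≈-Reasoning
          u = v ⊖ w
          u∈ = K-sub (suc j) v∈ w∈
          module R = RankOne j u u∈
          P = pairing j u v
          -- The equal values enter here: ⟨u , w⟩ = ⟨v , w⟩ - ⟨w , w⟩ becomes ⟨v , w⟩ - ⟨v , v⟩, the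
          -- negated conjugate of P = ⟨v , v⟩ - ⟨w , v⟩. Hence ⟨u , u⟩ = P + conj P, and the two
          -- requirements on a are those of `cayley-parameter`.
          uw : pairing j u w ≈ - conj P
          uw = begin
            pairing j u w  ≈⟨ pairing-subˡ j v w w ⟩
            pairing j v w - pairing j w w  ≈⟨ +-cong (sym (pairing-conj j w∈)) (-‿cong (trans (sym vv≈ww) (sym (pairing-fixed j v∈)))) ⟩
            conj (pairing j w v) - conj (pairing j v v)
              ≈⟨ solve 2 (λ x y → x :- y := :- (y :- x)) refl _ _ ⟩
            - (conj (pairing j v v) - conj (pairing j w v))
              ≈⟨ -‿cong (trans (conj-cong (pairing-subˡ j v w v)) (trans (conj-+ _ _) (+-congˡ (conj-neg _)))) ⟨
            - conj P  ∎
          good′ : (1# + a * pairing j u u) ≉0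
          good′ = ≉0-resp (+-congˡ (*-congˡ (sym (begin
            pairing j u u  ≈⟨ functional-sub (pairing-functional j u) v w ⟩
            P - pairing j u w  ≈⟨ +-congˡ (-‿cong uw) ⟩
            P - - conj P  ≈⟨ +-congˡ (solve 1 (λ p → :- (:- p) := p) refl (conj P)) ⟩
            P + conj P  ∎)))) good

        -- For v ∈ K (suc j) this means v ∉ K j + N V.
        NonRadical : ℕ → V n → Set (c ⊔ ℓ)
        NonRadical j v = ∃ λ y → K (suc j) y × pairing j y v ≉0

        nonRadical? : ∀ j v → Dec (NonRadical j v)
        nonRadical? j v = V-∃?
          (λ eq (y∈ , yv≉0) → K-resp (suc j) eq y∈ , ≉0-resp (pairing-congˡ j eq) yv≉0)
          (λ y → (N^ (suc j) y ≋? 𝟎) ×-dec ¬? (pairing j y v ≟ 0#))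

        anisotropic⇒nonRadical : ∀ j {v} → K (suc j) v → pairing j v v ≉0 → NonRadical j v
        anisotropic⇒nonRadical j v∈ vv≉0 = _ , v∈ , vv≉0

        pairing-scale-both : ∀ j a v → pairing j (a ⊙ v) (a ⊙ v) ≈ (a * conj a) * pairing j v v
        pairing-scale-both j a v = trans (pairing-scaleˡ j a v (a ⊙ v)) (trans (*-congˡ (pairing.scale j v a v))
          (solve 3 (λ a b x → b :* (a :* x) := a :* b :* x) refl a (conj a) _))

        pairing-⊕⊙ : ∀ j {y v} → K (suc j) y → K (suc j) v → ∀ a →
          pairing j (y ⊕ a ⊙ v) (y ⊕ a ⊙ v) ≈
          pairing j y y + (a * pairing j y v + conj (a * pairing j y v)) + (a * conj a) * pairing j v v
        pairing-⊕⊙ j {y} {v} y∈ v∈ a = begin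
          pairing j (y ⊕ a ⊙ v) (y ⊕ a ⊙ v)
            ≈⟨ trans (pairing-addˡ j y _ _) (+-cong (pairing.add j y _ _) (pairing.add j (a ⊙ v) _ _)) ⟩
          (pairing j y y + pairing j y (a ⊙ v)) + (pairing j (a ⊙ v) y + pairing j (a ⊙ v) (a ⊙ v))
            ≈⟨ +-cong (+-congˡ (pairing.scale j y a v)) (+-cong (sym (trans (conj-cong (sym (pairing.scale j y a v))) (pairing-conj j y∈)))
                 (pairing-scale-both j a v)) ⟩
          (pairing j y y + a * pairing j y v) + (conj (a * pairing j y v) + (a * conj a) * pairing j v v)
            ≈⟨ solve 4 (λ a b c d → (a :+ b) :+ (c :+ d) := a :+ (b :+ c) :+ d) refl _ _ _ _ ⟩
          pairing j y y + (a * pairing j y v + conj (a * pairing j y v)) + (a * conj a) * pairing j v v ∎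
          where open ≈-Reasoning

        -- As v is isotropic, the value at y + a v is ⟨y , y⟩ plus the trace of a ⟨y , v⟩, and the
        -- trace reaches every fixed element.
        hyperbolic : ∀ j {y v b} → K (suc j) y → K (suc j) v → pairing j v v ≈ 0# → pairing j y v ≉0 →
          Fixed b → ∃ λ a → pairing j (y ⊕ a ⊙ v) (y ⊕ a ⊙ v) ≈ b
        hyperbolic j {y} {v} {b} y∈ v∈ vv≈0 yv≉0 fb = solution
          (trace-surjective (trans (conj-+ b _) (+-cong fb (fixed-neg (pairing-fixed j y∈)))))
          (inverse _ yv≉0)
          where
          open ≈-Reasoning
          solution : (∃ λ t → t + conj t ≈ b - pairing j y y) → (∃ λ z → pairing j y v * z ≈ 1#) →
            ∃ λ a → pairing j (y ⊕ a ⊙ v) (y ⊕ a ⊙ v) ≈ b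
          solution (t , tr) (z , yvz≈1) = t * z , (begin
            pairing j (y ⊕ (t * z) ⊙ v) (y ⊕ (t * z) ⊙ v)  ≈⟨ pairing-⊕⊙ j y∈ v∈ (t * z) ⟩
            pairing j y y + (t * z * pairing j y v + conj (t * z * pairing j y v)) + (t * z * conj (t * z)) * pairing j v v
              ≈⟨ +-cong (+-congˡ (+-cong a-yv (conj-cong a-yv))) (trans (*-congˡ vv≈0) (zeroʳ _)) ⟩
            pairing j y y + (t + conj t) + 0#  ≈⟨ trans (+-identityʳ _) (+-congˡ tr) ⟩
            pairing j y y + (b - pairing j y y) ≈⟨ solve 2 (λ y b → y :+ (b :- y) := b) refl _ b ⟩
            b  ∎)
            where
            a-yv : t * z * pairing j y v ≈ t
            a-yv = trans (solve 3 (λ t z p → t :* z :* p := t :* (p :* z)) refl t z _)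
              (trans (*-congˡ yvz≈1) (*-identityʳ t))

        -- The quotient of conj ι by ι has norm one, and it differs from 1 when conjugation moves ι.
        nontrivial-norm-one : ∃ λ a → a * conj a ≈ 1# × ¬ conj a ≈ 1#
        nontrivial-norm-one with ι , nf ← non-fixed with ι ≟ 0#
        ... | yes ι≈0 = contradiction (fixed-resp (sym ι≈0) fixed-0) nf
        ... | no ι≉0 with x , ιx≈1 ← inverse ι ι≉0 = conj ι * x , (begin
            conj ι * x * conj (conj ι * x)  ≈⟨ *-congˡ conj-a ⟩
            conj ι * x * (ι * conj x)  ≈⟨ solve 4 (λ i x j y → j :* x :* (i :* y) := (i :* x) :* (j :* y)) refl ι x (conj ι) (conj x) ⟩
            (ι * x) * (conj ι * conj x)  ≈⟨ *-cong ιx≈1 (trans (sym (conj-* ι x)) (trans (conj-cong ιx≈1) conj-1)) ⟩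
            1# * 1#  ≈⟨ *-identityˡ 1# ⟩
            1#  ∎) , λ eq → nf (begin
            conj ι  ≈⟨ *-identityʳ _ ⟨
            conj ι * 1#  ≈⟨ *-congˡ (trans (sym conj-a) eq) ⟨
            conj ι * (ι * conj x)  ≈⟨ solve 3 (λ i j y → j :* (i :* y) := i :* (j :* y)) refl ι (conj ι) (conj x) ⟩
            ι * (conj ι * conj x)  ≈⟨ *-congˡ (trans (sym (conj-* ι x)) (trans (conj-cong ιx≈1) conj-1)) ⟩
            ι * 1#  ≈⟨ *-identityʳ ι ⟩
            ι  ∎)
          where
          open ≈-Reasoning
          conj-a : conj (conj ι * x) ≈ ι * conj x
          conj-a = trans (conj-* _ _) (*-congʳ (conj-involutive ι))

        private
          -- If each witness fails for the other vector, their sum serves both: a space is not the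
          -- union of two proper subspaces.
          common-witness : ∀ j {v w} → NonRadical j v → NonRadical j w →
            ∃ λ y → K (suc j) y × pairing j y v ≉0 × pairing j y w ≉0
          common-witness j {v} {w} (y₁ , y₁∈ , y₁v) (y₂ , y₂∈ , y₂w) with pairing j y₁ w ≟ 0#
          ... | no y₁w = y₁ , y₁∈ , y₁v , y₁w
          ... | yes y₁w≈0 with pairing j y₂ v ≟ 0#
          ...   | no y₂v = y₂ , y₂∈ , y₂v , y₂w
          ...   | yes y₂v≈0 = y₁ ⊕ y₂ , K-add (suc j) y₁∈ y₂∈
            , ≉0-resp (sym (trans (pairing-addˡ j y₁ y₂ v) (trans (+-congˡ y₂v≈0) (+-identityʳ _)))) y₁v
            , ≉0-resp (sym (trans (pairing-addˡ j y₁ y₂ w) (trans (+-congʳ y₁w≈0) (+-identityˡ _)))) y₂w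

        -- The Cayley construction applies directly unless ⟨v - w , v⟩ = 0. In that case an
        -- anisotropic w is first multiplied by a scalar a of norm one other than 1, which makes the
        -- pairing (1 - conj a) ⟨v , v⟩. Isotropic v and w are both moved to a third isotropic
        -- vector.
        transitive-on-level : ∀ j {v w} → K (suc j) v → K (suc j) w → NonRadical j v → NonRadical j w →
          pairing j v v ≈ pairing j w w → v ~ w
        transitive-on-level j {v} {w} v∈ w∈ v-nr w-nr vv≈ww =
          by-cases (pairing j (v ⊖ w) v ≟ 0#) (pairing j v v ≟ 0#)
          where
          open ≈-Reasoning
          module _ (P≈0 : pairing j (v ⊖ w) v ≈ 0#) where
            wv≈vv : pairing j w v ≈ pairing j v v
            wv≈vv = sym (x-y≈0⇒x≈y (trans (sym (pairing-subˡ j v w v)) P≈0))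

            anisotropic : pairing j v v ≉0 → (∃ λ a → a * conj a ≈ 1# × ¬ conj a ≈ 1#) → v ~ w
            anisotropic vv≉0 (a , norm , ā≉1) = ~-trans
              (cayley-transitive j v∈ (K-scale (suc j) a w∈)
                (trans vv≈ww (sym (trans (pairing-scale-both j a w) (trans (*-congʳ norm) (*-identityˡ _)))))
                (≉0-resp (sym (begin
                  pairing j (v ⊖ a ⊙ w) v  ≈⟨ trans (pairing-subˡ j v _ v) (+-congˡ (-‿cong (pairing-scaleˡ j a w v))) ⟩
                  pairing j v v - conj a * pairing j w v ≈⟨ +-congˡ (-‿cong (*-congˡ wv≈vv)) ⟩
                  pairing j v v - conj a * pairing j v v ≈⟨ solve 2 (λ a x → x :- a :* x := (:1 :- a) :* x) refl (conj a) _ ⟩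
                  (1# - conj a) * pairing j v v  ∎))
                  (*-≉0 (λ eq → ā≉1 (sym (x-y≈0⇒x≈y eq))) vv≉0)))
              (~-sym (~-norm-one norm w))

            isotropic : pairing j v v ≈ 0# → (∃ λ y → K (suc j) y × pairing j y v ≉0 × pairing j y w ≉0) → v ~ w
            isotropic vv≈0 (y , y∈ , yv≉0 , yw≉0) = via (hyperbolic j y∈ v∈ vv≈0 yv≉0 fixed-0)
              where
              ww≈0 : pairing j w w ≈ 0#
              ww≈0 = trans (sym vv≈ww) vv≈0
              vw≈0 : pairing j v w ≈ 0#
              vw≈0 = trans (sym (pairing-conj j w∈)) (trans (conj-cong (trans wv≈vv vv≈0)) conj-0)
              module _ (a : Carrier) (xx≈0 : pairing j (y ⊕ a ⊙ v) (y ⊕ a ⊙ v) ≈ 0#) where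
                -- With x = y + a v the Cayley criterion reads ⟨t - x , t⟩ = - ⟨y , t⟩, since t is
                -- isotropic and orthogonal to v. It applies to t = v and to t = w alike.
                moves : ∀ {t} → K (suc j) t → pairing j v t ≈ 0# → pairing j t t ≈ 0# → pairing j y t ≉0 → t ~ y ⊕ a ⊙ v
                moves {t} t∈ vt≈0 tt≈0 yt≉0 = cayley-transitive j t∈ (K-add (suc j) y∈ (K-scale (suc j) a v∈))
                  (trans tt≈0 (sym xx≈0)) (≉0-resp (sym (begin
                    pairing j (t ⊖ (y ⊕ a ⊙ v)) t  ≈⟨ pairing-subˡ j t (y ⊕ a ⊙ v) t ⟩
                    pairing j t t - pairing j (y ⊕ a ⊙ v) t
                      ≈⟨ +-cong tt≈0 (-‿cong (trans (pairing-addˡ j y _ t) (+-congˡ (trans (pairing-scaleˡ j a v t) (*-congˡ vt≈0))))) ⟩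
                    0# - (pairing j y t + conj a * 0#)  ≈⟨ solve 2 (λ y a → :0 :- (y :+ a :* :0) := :- y) refl _ (conj a) ⟩
                    - pairing j y t  ∎)) (-‿≉0 yt≉0))
              via : (∃ λ a → pairing j (y ⊕ a ⊙ v) (y ⊕ a ⊙ v) ≈ 0#) → v ~ w
              via (a , xx≈0) = ~-trans (moves a xx≈0 v∈ vv≈0 vv≈0 yv≉0) (~-sym (moves a xx≈0 w∈ vw≈0 ww≈0 yw≉0))

          by-cases : Dec (pairing j (v ⊖ w) v ≈ 0#) → Dec (pairing j v v ≈ 0#) → v ~ w
          by-cases (no P≉0) _ = cayley-transitive j v∈ w∈ vv≈ww P≉0
          by-cases (yes P≈0) (no vv≉0) = anisotropic P≈0 vv≉0 nontrivial-norm-one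
          by-cases (yes P≈0) (yes vv≈0) = isotropic P≈0 vv≈0 (common-witness j v-nr w-nr)

        -- An anisotropic v is scaled by an element of norm b / ⟨v , v⟩, which exists because the
        -- norm is onto the nonzero fixed elements. An isotropic v is added in a suitable multiple
        -- to its witness y.
        realize-value : ∀ j {v b} → K (suc j) v → NonRadical j v → Fixed b → b ≉0 →
          ∃ λ x → K (suc j) x × pairing j x x ≈ b
        realize-value j {v} {b} v∈ (y , y∈ , yv≉0) fb b≉0 = by-cases (pairing j v v ≟ 0#)
          where
          open ≈-Reasoning
          scaled : ∀ {z} → pairing j v v * z ≈ 1# → (∃ λ a → a * conj a ≈ b * z) → ∃ λ x → K (suc j) x × pairing j x x ≈ b
          scaled {z} vvz≈1 (a , norm) = a ⊙ v , K-scale (suc j) a v∈ , (begin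
            pairing j (a ⊙ v) (a ⊙ v)  ≈⟨ trans (pairing-scale-both j a v) (*-congʳ norm) ⟩
            b * z * pairing j v v  ≈⟨ solve 3 (λ b z p → b :* z :* p := b :* (p :* z)) refl b z _ ⟩
            b * (pairing j v v * z)  ≈⟨ trans (*-congˡ vvz≈1) (*-identityʳ b) ⟩
            b  ∎)
          sheared : (∃ λ a → pairing j (y ⊕ a ⊙ v) (y ⊕ a ⊙ v) ≈ b) → ∃ λ x → K (suc j) x × pairing j x x ≈ b
          sheared (a , eq) = y ⊕ a ⊙ v , K-add (suc j) y∈ (K-scale (suc j) a v∈) , eq
          by-cases : Dec (pairing j v v ≈ 0#) → ∃ λ x → K (suc j) x × pairing j x x ≈ b
          by-cases (yes vv≈0) = sheared (hyperbolic j y∈ v∈ vv≈0 yv≉0 fb)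
          by-cases (no vv≉0) = let z , vvz≈1 = inverse _ vv≉0 in scaled vvz≈1
            (norm-surjective (fixed-* fb (fixed-inverse (pairing-fixed j v∈) vv≉0 vvz≈1))
              (*-≉0 b≉0 (λ z≈0 → 1≉0 (trans (sym vvz≈1) (trans (*-congˡ z≈0) (zeroʳ _))))))

        ~-preserves-pairing : ∀ j {v w} → K (suc j) v → K (suc j) w → v ~ w → pairing j v v ≈ pairing j w w
        ~-preserves-pairing j {v} {w} v∈ w∈ (h , ch , u , eq) = begin
          pairing j v v  ≈⟨ C.preserves-pairing j v v ⟨
          pairing j (h v) (h v)  ≈⟨ trans (pairing-congˡ j hv≋) (pairing.cong j (w ⊕ N u) hv≋) ⟩
          pairing j (w ⊕ N u) (w ⊕ N u)  ≈⟨ pairing.add j (w ⊕ N u) w (N u) ⟩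
          pairing j (w ⊕ N u) w + pairing j (w ⊕ N u) (N u)
            ≈⟨ +-cong (trans (pairing-addˡ j w (N u) w) (+-congˡ (pairing-N-kills j u w∈)))
                 (pairing-kills-N j u (K-resp (suc j) hv≋ (C.preserves-K (suc j) v∈))) ⟩
          (pairing j w w + 0#) + 0#  ≈⟨ trans (+-identityʳ _) (+-identityʳ _) ⟩
          pairing j w w  ∎
          where
          open ≈-Reasoning
          module C = Centralizes ch
          hv≋ : h v ≋ w ⊕ N u
          hv≋ = mk≋ λ i → trans (solve 2 (λ a b → a := b :+ (a :- b)) refl (h v i) (w i)) (+-congˡ (at eq i))

        -- `h` carries the witness for v to a witness for w + N u, but N^j kills `K i`, and N u
        -- pairs to zero with `K (suc j)`.
        levels-disjoint : ∀ {i j v w} → i ℕ.≤ j → NonRadical j v → K i w → ¬ v ~ w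
        levels-disjoint {i} {j} {v} {w} i≤j (y , y∈ , yv≉0) w∈ (h , ch , u , eq) = yv≉0 (begin
          pairing j y v  ≈⟨ C.preserves-pairing j y v ⟨
          pairing j (h y) (h v)  ≈⟨ pairing.cong j (h y) (mk≋ λ i → trans (solve 2 (λ a b → a := b :+ (a :- b)) refl (h v i) (w i)) (+-congˡ (at eq i))) ⟩
          pairing j (h y) (w ⊕ N u)  ≈⟨ pairing.add j (h y) w (N u) ⟩
          pairing j (h y) w + pairing j (h y) (N u)
            ≈⟨ +-cong (trans (*-congˡ (trans (B-congˡ (K-≤ i≤j w∈)) (B-0ʳ _))) (zeroʳ _)) (pairing-kills-N j u (C.preserves-K (suc j) y∈)) ⟩
          0# + 0#  ≈⟨ +-identityˡ 0# ⟩
          0#  ∎)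
          where
          open ≈-Reasoning
          module C = Centralizes ch

        -- Duality of kernels and images

        image : ℕ → Subspace n (c ⊔ ℓ)
        image k = record
          { _∋_ = λ x → ∃ λ z → N^ k z ≋ x
          ; ∋? = λ x → V-∃? (λ eq Nz≋x → ≋-trans (N^.cong k (≋-sym eq)) Nz≋x) (λ z → N^ k z ≋? x)
          ; resp = λ eq (z , Nz≋x) → z , ≋-trans Nz≋x eq
          ; zero∈ = 𝟎 , N^.zero-map k
          ; add = λ (y , p) (z , r) → y ⊕ z , ≋-trans (N^.add k y z) (⊕-cong p r)
          ; scale = λ a (z , r) → a ⊙ z , ≋-trans (N^.scale k a z) (⊙-cong refl r) }

        -- (ker Nᵏ)^⊥ = im Nᵏ
        image-or-witness : ∀ k x → (∃ λ z → N^ k z ≋ x) ⊎ (∃ λ y → K k y × B y x ≉0)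
        image-or-witness k x = by-cases (Subspace.∋? (image k) x)
          where
          -- From N = - G N* follows N^k = (- G)^k N*^k, and `signG k` is the factor (- G)^k.
          N*^-kernel : ∀ k {y} → N*^ k y ≋ 𝟎 → K k y
          N*^-kernel k {y} eq = nondegenerateʳ (λ w → begin
            B w (N^ k y)  ≈⟨ B-congˡ (N^≋GN*^ k y) ⟩
            B w (signG k (N*^ k y)) ≈⟨ B-congˡ (≋-trans (Linear.cong (signG-linear k) eq) (Linear.zero-map (signG-linear k))) ⟩
            B w 𝟎  ≈⟨ B-0ʳ w ⟩
            0#  ∎)
            where
            open ≈-Reasoning
            signG : ℕ → V n → V n
            signG k = iter 𝔽 k (λ x → - 1# ⊙ G x)
            signG-linear : ∀ k → Linear (signG k)
            signG-linear k = iter-linear k (⊙-linear (- 1#) G-linear)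
            N≋ : ∀ x → N x ≋ - 1# ⊙ G (N* x)
            N≋ x = ≋-sym (≋-trans (⊙-cong refl (≋-trans (G.sub x _) (⊖-cong ≋-refl (GG⁻¹ x))))
              (mk≋ λ i → solve 2 (λ x y → (:- :1) :* (y :- x) := x :- y) refl (x i) (G x i)))
            signG-N* : Commute N* (λ x → - 1# ⊙ G x)
            signG-N* x = ≋-trans (N*.scale _ _) (⊙-cong refl (commute-G N*-linear N*-commutes-N x))
            N^≋GN*^ : ∀ k y → N^ k y ≋ signG k (N*^ k y)
            N^≋GN*^ zero    y = ≋-refl
            N^≋GN*^ (suc k) y = ≋-trans (N≋ _) (⊙-cong refl (G.cong
              (≋-trans (N*.cong (N^≋GN*^ k y)) (commute-iter (⊙-linear (- 1#) G-linear) signG-N* k _))))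

          -- The functional vanishing on im N^k is B(y , ·) for some y. Then N*^k y is orthogonal to
          -- all of V, hence zero, and this puts y into ker N^k.
          witness : (∃ λ f → (∀ {x} → image k ∋ x → dot f x ≈ 0#) × dot f x ≉0) → ∃ λ y → K k y × B y x ≉0
          witness (f , kill , f-x) = let y , By = riesz f in
            y , N*^-kernel k (nondegenerateˡ (λ z → trans (N*^-adjoint k y z) (trans (By _) (kill (z , ≋-refl)))))
              , ≉0-resp (sym (By x)) f-x
          by-cases : Dec (image k ∋ x) → (∃ λ z → N^ k z ≋ x) ⊎ (∃ λ y → K k y × B y x ≉0)
          by-cases (yes x∈) = inj₁ x∈
          by-cases (no x∉)  = inj₂ (witness (separate n (image k) x∉))

        -- Either N^j v pairs nontrivially with K (suc j), or N^j v = N^(j + 1) z; then subtracting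
        -- N z moves v into `K j` inside its coset. Descending from j = n in this way finds the
        -- level of a coset.
        nonRadical-or-reduce : ∀ j v → NonRadical j v ⊎ ∃ λ z → v ~ v ⊖ N z × K j (v ⊖ N z)
        nonRadical-or-reduce j v = by-cases (image-or-witness (suc j) (N^ j v))
          where
          by-cases : (∃ λ z → N^ (suc j) z ≋ N^ j v) ⊎ (∃ λ y → K (suc j) y × B y (N^ j v) ≉0) →
            NonRadical j v ⊎ ∃ λ z → v ~ v ⊖ N z × K j (v ⊖ N z)
          by-cases (inj₂ (y , y∈ , yv≉0)) = inj₁ (y , y∈ , *-≉0 (σ≉0 j) yv≉0)
          by-cases (inj₁ (z , eq)) = inj₂ (z
            , ~-mod-N z (mk≋ λ i → solve 2 (λ a b → a :- (a :- b) := b) refl (v i) (N z i))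
            , ≋-trans (N^.sub j v (N z)) (≋⇒⊖≋𝟎 (≋-trans (≋-sym eq) (≋-sym (N^-shift j z)))))

        -- Dimensions of kernels and socles, and the three types of level

        Ker : ℕ → Subspace n ℓ
        Ker k = record
          { _∋_ = K k ; ∋? = λ x → N^ k x ≋? 𝟎 ; resp = K-resp k ; zero∈ = N^.zero-map k
          ; add = K-add k ; scale = λ a → K-scale k a }

        -- Nʲ (K (suc j)), whose dimension is the number of Jordan blocks of size > j.
        Socle : ℕ → Subspace n (c ⊔ ℓ)
        Socle j = record
          { _∋_ = λ x → K 1 x × image j ∋ x
          ; ∋? = λ x → (N^ 1 x ≋? 𝟎) ×-dec Subspace.∋? (image j) x
          ; resp = λ eq (x∈ , x∈im) → K-resp 1 eq x∈ , Subspace.resp (image j) eq x∈im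
          ; zero∈ = N^.zero-map 1 , Subspace.zero∈ (image j)
          ; add = λ (x∈ , x∈im) (y∈ , y∈im) → K-add 1 x∈ y∈ , Subspace.add (image j) x∈im y∈im
          ; scale = λ a (x∈ , x∈im) → K-scale 1 a x∈ , Subspace.scale (image j) a x∈im }

        N^-Socle : ∀ j {v} → K (suc j) v → Socle j ∋ N^ j v
        N^-Socle j {v} v∈ = v∈ , v , ≋-refl

        Socle-N^ : ∀ j {x} → Socle j ∋ x → ∃ λ v → K (suc j) v × N^ j v ≋ x
        Socle-N^ j (Nx , v , eq) = v , ≋-trans (N.cong eq) Nx , eq

        Socle-suc : ∀ j {x} → Socle (suc j) ∋ x → Socle j ∋ x
        Socle-suc j (Nx , v , eq) = Nx , N v , ≋-trans (N^-shift j v) eq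

        Socle-≤ : ∀ {i j x} → i ℕ.≤ j → Socle j ∋ x → Socle i ∋ x
        Socle-≤ {i} {j} {x} i≤j = go (ℕₚ.≤⇒≤′ i≤j)
          where
          go : ∀ {k} → i ℕ.≤′ k → Socle k ∋ x → Socle i ∋ x
          go ℕ.≤′-refl          x∈ = x∈
          go (ℕ.≤′-step {k} i≤k) x∈ = go i≤k (Socle-suc k x∈)

        -- N^j maps K (suc j) onto `Socle j`, and its kernel is `K j`.
        card-Ker-suc : ∀ j → card (Ker (suc j)) ≡ card (Socle j) ℕ.* card (Ker j)
        card-Ker-suc j = card-fibres (Setoid.isEquivalence (vecSetoid setoid n)) _≋?_ (Ker (suc j)) (Ker j) (N^ j) (N^.cong j) (K-suc j)
          (λ {v} {w} _ _ eq → ≋-trans (N^.sub j v w) (≋⇒⊖≋𝟎 eq))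
          (λ {v} {w} _ _ v-w∈ → ⊖≋𝟎⇒≋ (≋-trans (≋-sym (N^.sub j v w)) v-w∈))
          (members (Socle j)) (Subspace.members-distinct (Socle j))
          (λ v∈ → Subspace.members-complete (Socle j) (N^-Socle j v∈))
          (λ x∈ → Socle-N^ j (Subspace.members∋ (Socle j) x∈))

        abstract
          -- Defined as the exponent of the cardinality, in step with `dimFromCard`; it is
          -- determined by the cardinality because `order` exceeds 1.
          dim : ∀ {p} → Subspace n p → ℕ
          dim W = proj₁ (card-power n W)

          dim-≤ : ∀ {p} (W : Subspace n p) → dim W ℕ.≤ n
          dim-≤ W = proj₁ (proj₂ (card-power n W))

          card≡^dim : ∀ {p} (W : Subspace n p) → card W ≡ order ℕ.^ dim W
          card≡^dim W = proj₂ (proj₂ (card-power n W))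

        ^-cancel-< : ∀ {a b} → order ℕ.^ a ℕ.< order ℕ.^ b → a ℕ.< b
        ^-cancel-< {a} {b} lt with ℕₚ.<-≤-connex a b
        ... | inj₁ a<b = a<b
        ... | inj₂ b≤a = contradiction (ℕₚ.^-monoʳ-≤ order {{ℕ.>-nonZero (ℕₚ.<-trans (s≤s z≤n) order>1)}} b≤a) (ℕₚ.<⇒≱ lt)

        ^-cancel-≡ : ∀ {a b} → order ℕ.^ a ≡ order ℕ.^ b → a ≡ b
        ^-cancel-≡ {a} {b} eq with ℕₚ.<-cmp a b
        ... | tri< a<b _ _ = contradiction eq (ℕₚ.<⇒≢ (ℕₚ.^-monoʳ-< order order>1 a<b))
        ... | tri≈ _ a≡b _ = a≡b
        ... | tri> _ _ b<a = contradiction (≡.sym eq) (ℕₚ.<⇒≢ (ℕₚ.^-monoʳ-< order order>1 b<a))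

        dim-Ker-suc : ∀ j → dim (Ker (suc j)) ≡ dim (Socle j) ℕ.+ dim (Ker j)
        dim-Ker-suc j = ^-cancel-≡ (≡.trans (≡.sym (card≡^dim (Ker (suc j)))) (≡.trans (card-Ker-suc j)
          (≡.trans (≡.cong₂ ℕ._*_ (card≡^dim (Socle j)) (card≡^dim (Ker j)))
            (≡.sym (ℕₚ.^-distribˡ-+-* order (dim (Socle j)) (dim (Ker j)))))))

        dim-positive : ∀ {p} (W : Subspace n p) {x} → W ∋ x → ¬ x ≋ 𝟎 → 0 ℕ.< dim W
        dim-positive W {x} x∈ x≢𝟎 = ^-cancel-< (≡.subst (1 ℕ.<_) (card≡^dim W)
          (ℕₚ.≤-<-trans (pigeonhole _≋_ _≋_ (λ p r → ≋-trans p (≋-sym r)) {𝟎 ∷ []} ([] ∷ [])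
              (Subspace.members-complete (Ker 0) ≋-refl ∷ []))
            (card-< (Ker 0) W (λ v≋𝟎 → Subspace.resp W (≋-sym v≋𝟎) (Subspace.zero∈ W)) x∈ x≢𝟎)))

        -- Multiplicity zero, one, or at least two. Each constructor joins the geometric fact that
        -- decides which values occur with the dimension fact that decides how many Jordan blocks
        -- there are.
        data LevelType (j : ℕ) : Set (c ⊔ ℓ) where
          absent : (∀ {v} → K (suc j) v → ¬ NonRadical j v) → dim (Socle j) ≡ dim (Socle (suc j)) → LevelType j
          line   : (∃ λ v → K (suc j) v × NonRadical j v) →
                   (∀ {v} → K (suc j) v → NonRadical j v → pairing j v v ≉0) →
                   dim (Socle j) ≡ suc (dim (Socle (suc j))) → LevelType j
          plane  : (∃ λ v → K (suc j) v × NonRadical j v × pairing j v v ≈ 0#) →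
                   suc (suc (dim (Socle (suc j)))) ℕ.≤ dim (Socle j) → LevelType j

        private
          nonRadical-resp : ∀ j {v w} → v ≋ w → NonRadical j v → NonRadical j w
          nonRadical-resp j eq (y , y∈ , yv≉0) = y , y∈ , ≉0-resp (pairing.cong j y eq) yv≉0

          Socle-suc-or-nonRadical : ∀ j {x v} → K (suc j) v → N^ j v ≋ x → Socle (suc j) ∋ x ⊎ NonRadical j v
          Socle-suc-or-nonRadical j {x} {v} v∈ eq = by-cases (image-or-witness (suc j) x)
            where
            by-cases : (∃ λ z → N^ (suc j) z ≋ x) ⊎ (∃ λ y → K (suc j) y × B y x ≉0) → Socle (suc j) ∋ x ⊎ NonRadical j v
            by-cases (inj₁ x∈im) = inj₁ (≋-trans (N.cong (≋-sym eq)) v∈ , x∈im)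
            by-cases (inj₂ (y , y∈ , yx≉0)) = inj₂ (y , y∈ , *-≉0 (σ≉0 j) (≉0-resp (B-congˡ (≋-sym eq)) yx≉0))

          nonRadical⇒∉Socle : ∀ j {v} → NonRadical j v → ¬ Socle (suc j) ∋ N^ j v
          nonRadical⇒∉Socle j (y , y∈ , yv≉0) (_ , z , eq) = yv≉0
            (trans (*-congˡ (trans (B-congˡ (≋-sym eq)) (K⊥imN^ (suc j) z y∈))) (zeroʳ _))

          -- For a nonradical v in `K (suc j)` this is a hyperplane of `Socle j` containing
          -- `Socle (suc j)`. Whether it is strictly larger separates multiplicity one from higher
          -- multiplicity.
          slice : ∀ j v → Subspace n _
          slice j v = Socle j ∩ker B-functional v

          Socle⊆slice : ∀ j {v x} → K (suc j) v → Socle (suc j) ∋ x → slice j v ∋ x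
          Socle⊆slice j {v} v∈ x∈@(_ , z , eq) =
            Socle-suc j x∈ , trans (B-congˡ (≋-sym eq)) (K⊥imN^ (suc j) z v∈)

          dim-slice : ∀ j {v} → K (suc j) v → NonRadical j v → dim (Socle j) ≡ suc (dim (slice j v))
          dim-slice j {v} v∈ (y , y∈ , yv≉0) = ^-cancel-≡ (≡.trans (≡.sym (card≡^dim (Socle j)))
            (≡.trans (card-∩ker (Socle j) (B-functional v) (N^-Socle j y∈)
                (λ eq → yv≉0 (trans (sym (pairing-conj j v∈))
                  (trans (conj-cong (trans (*-congˡ eq) (zeroʳ _))) conj-0))))
              (≡.cong (order ℕ.*_) (card≡^dim (slice j v)))))

          pairing≈0⇒B≈0 : ∀ j {v w} → pairing j v w ≈ 0# → B v (N^ j w) ≈ 0#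
          pairing≈0⇒B≈0 j eq = zero-product eq (σ≉0 j)

        -- Choose a of norm - ⟨v , v⟩ / ⟨w , w⟩, a nonzero fixed element. Orthogonality removes the
        -- cross terms of v + a w, and v itself witnesses that this vector is not radical.
        isotropic-combination : ∀ j {v w} → K (suc j) v → K (suc j) w → pairing j v v ≉0 → pairing j w w ≉0 →
          pairing j v w ≈ 0# → ∃ λ x → K (suc j) x × NonRadical j x × pairing j x x ≈ 0#
        isotropic-combination j {v} {w} v∈ w∈ vv≉0 ww≉0 vw≈0 =
          let z , wwz≈1 = inverse _ ww≉0 in combine wwz≈1
            (norm-surjective (fixed-neg (fixed-* (pairing-fixed j v∈) (fixed-inverse (pairing-fixed j w∈) ww≉0 wwz≈1)))
              (-‿≉0 (*-≉0 vv≉0 (λ z≈0 → 1≉0 (trans (sym wwz≈1) (trans (*-congˡ z≈0) (zeroʳ _)))))))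
          where
          open ≈-Reasoning
          combine : ∀ {z} → pairing j w w * z ≈ 1# → (∃ λ a → a * conj a ≈ - (pairing j v v * z)) →
            ∃ λ x → K (suc j) x × NonRadical j x × pairing j x x ≈ 0#
          combine {z} wwz≈1 (a , norm) = v ⊕ a ⊙ w , K-add (suc j) v∈ (K-scale (suc j) a w∈)
            , (v , v∈ , ≉0-resp (sym (trans (pairing.add j v v (a ⊙ w))
                (trans (+-congˡ (trans (pairing.scale j v a w) a·vw)) (+-identityʳ _)))) vv≉0)
            , (begin
            pairing j (v ⊕ a ⊙ w) (v ⊕ a ⊙ w)  ≈⟨ pairing-⊕⊙ j v∈ w∈ a ⟩
            pairing j v v + (a * pairing j v w + conj (a * pairing j v w)) + (a * conj a) * pairing j w w
              ≈⟨ +-cong (+-congˡ (+-cong a·vw (trans (conj-cong a·vw) conj-0))) (*-congʳ norm) ⟩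
            pairing j v v + (0# + 0#) + (- (pairing j v v * z)) * pairing j w w
              ≈⟨ solve 3 (λ v z w → v :+ (:0 :+ :0) :+ (:- (v :* z)) :* w := v :* (:1 :- w :* z)) refl _ z _ ⟩
            pairing j v v * (1# - pairing j w w * z)  ≈⟨ *-congˡ (x≈y⇒x-y≈0 (sym wwz≈1)) ⟩
            pairing j v v * 0#  ≈⟨ zeroʳ _ ⟩
            0#  ∎)
            where
            a·vw : a * pairing j v w ≈ 0#
            a·vw = trans (*-congˡ vw≈0) (zeroʳ a)

        abstract
          -- An isotropic nonradical v gives `plane`: N^j v lies in its own slice but outside
          -- `Socle (suc j)`, so two dimensions are gained. Only when there is none does any other
          -- nonradical vector decide between `line` and `absent`.
          levelType : ∀ j → LevelType j
          levelType j = by-cases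
            (V-∃? (λ eq (v∈ , nr , vv≈0) → K-resp (suc j) eq v∈ , nonRadical-resp j eq nr ,
                          trans (sym (trans (pairing-congˡ j eq) (pairing.cong j _ eq))) vv≈0)
                   (λ v → (N^ (suc j) v ≋? 𝟎) ×-dec (nonRadical? j v ×-dec (pairing j v v ≟ 0#))))
            (V-∃? (λ eq (v∈ , nr) → K-resp (suc j) eq v∈ , nonRadical-resp j eq nr)
                   (λ v → (N^ (suc j) v ≋? 𝟎) ×-dec nonRadical? j v))
            where
            by-cases : Dec (∃ λ v → K (suc j) v × NonRadical j v × pairing j v v ≈ 0#) →
              Dec (∃ λ v → K (suc j) v × NonRadical j v) → LevelType j
            by-cases (yes (v , v∈ , nr , vv≈0)) _ = plane (v , v∈ , nr , vv≈0)
              (≡.subst (suc (suc (dim (Socle (suc j)))) ℕ.≤_) (≡.sym (dim-slice j v∈ nr))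
                (s≤s (^-cancel-< (≡.subst₂ ℕ._<_ (card≡^dim (Socle (suc j))) (card≡^dim (slice j v))
                  (card-< (Socle (suc j)) (slice j v) (Socle⊆slice j v∈)
                    (N^-Socle j v∈ , pairing≈0⇒B≈0 j vv≈0) (nonRadical⇒∉Socle j nr))))))
            by-cases (no _) (no none) = absent (λ v∈ nr → none (_ , v∈ , nr))
              (^-cancel-≡ (≡.trans (≡.sym (card≡^dim (Socle j))) (≡.trans
                (card-≡ (Socle j) (Socle (suc j)) Socle⊆ (Socle-suc j)) (card≡^dim (Socle (suc j))))))
              where
              Socle⊆ : ∀ {x} → Socle j ∋ x → Socle (suc j) ∋ x
              Socle⊆ x∈ = let v , v∈ , eq = Socle-N^ j x∈ in
                [ id , (λ nr → contradiction (v , v∈ , nr) none) ]′ (Socle-suc-or-nonRadical j v∈ eq)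
            by-cases (no none) (yes (v , v∈ , nr)) = line (v , v∈ , nr) anisotropic
              (≡.trans (dim-slice j v∈ nr) (≡.cong suc (^-cancel-≡ (≡.trans (≡.sym (card≡^dim (slice j v))) (≡.trans
                (card-≡ (slice j v) (Socle (suc j)) slice⊆ (Socle⊆slice j v∈)) (card≡^dim (Socle (suc j))))))))
              where
              anisotropic : ∀ {w} → K (suc j) w → NonRadical j w → pairing j w w ≉0
              anisotropic w∈ w-nr ww≈0 = none (_ , w∈ , w-nr , ww≈0)
              -- A nonradical w orthogonal to v would be anisotropic like v, and the two together
              -- would yield an isotropic nonradical vector.
              slice⊆ : ∀ {x} → slice j v ∋ x → Socle (suc j) ∋ x
              slice⊆ {x} (x∈ , Bvx≈0) = let w , w∈ , eq = Socle-N^ j x∈ in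
                [ id , (λ w-nr → contradiction
                  (isotropic-combination j v∈ w∈ (anisotropic v∈ nr) (anisotropic w∈ w-nr)
                    (trans (*-congˡ (trans (B-congˡ eq) Bvx≈0)) (zeroʳ _))) none) ]′ (Socle-suc-or-nonRadical j w∈ eq)

        -- If N ^ n v ≠ 0 with v ∈ K (suc n), then every Socle j with j ≤ n is nonzero, so dim (Ker (suc n)) > n.
        Ker-stable : ∀ {v} → K (suc n) v → K n v
        Ker-stable {v} v∈ = decidable-stable (N^ n v ≋? 𝟎) λ v∉ →
          ℕₚ.<⇒≱ (grow v∉ (suc n) ℕₚ.≤-refl) (dim-≤ (Ker (suc n)))
          where
          grow : ¬ N^ n v ≋ 𝟎 → ∀ k → k ℕ.≤ suc n → k ℕ.≤ dim (Ker k)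
          grow v∉ zero    _ = z≤n
          grow v∉ (suc k) (s≤s k≤n) = ≡.subst (suc k ℕ.≤_) (≡.sym (dim-Ker-suc k))
            (ℕₚ.+-mono-≤ (dim-positive (Socle k) (Socle-≤ k≤n (N^-Socle n v∈)) v∉) (grow v∉ k (ℕₚ.m≤n⇒m≤1+n k≤n)))

        -- Invariants of the classes and their number

        HasLevelBelow : ℕ → V n → Set (c ⊔ ℓ)
        HasLevelBelow k v = ∃ λ j → j ℕ.< k × ∃ λ w → v ~ w × K (suc j) w × NonRadical j w

        private
          pull-back : ∀ {k v v′} → v ~ v′ → v′ ~ 𝟎 ⊎ HasLevelBelow k v′ → v ~ 𝟎 ⊎ HasLevelBelow k v
          pull-back v~v′ (inj₁ v′~𝟎) = inj₁ (~-trans v~v′ v′~𝟎)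
          pull-back v~v′ (inj₂ (j , j<k , w , v′~w , w∈ , nr)) = inj₂ (j , j<k , w , ~-trans v~v′ v′~w , w∈ , nr)

          raise : ∀ {k v} → v ~ 𝟎 ⊎ HasLevelBelow k v → v ~ 𝟎 ⊎ HasLevelBelow (suc k) v
          raise (inj₁ v~𝟎) = inj₁ v~𝟎
          raise (inj₂ (j , j<k , rest)) = inj₂ (j , ℕₚ.m<n⇒m<1+n j<k , rest)

          level-Ker : ∀ k {v} → K k v → v ~ 𝟎 ⊎ HasLevelBelow k v
          level-Ker zero    {v} v∈ = inj₁ (~-mod-N 𝟎 (≋-trans
            (mk≋ λ i → trans (+-congˡ (solve 0 (:- :0 := :0) refl)) (+-identityʳ _)) (≋-trans v∈ (≋-sym N.zero-map))))
          level-Ker (suc k) {v} v∈ = by-cases (nonRadical-or-reduce k v)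
            where
            by-cases : NonRadical k v ⊎ (∃ λ z → v ~ v ⊖ N z × K k (v ⊖ N z)) → v ~ 𝟎 ⊎ HasLevelBelow (suc k) v
            by-cases (inj₁ nr) = inj₂ (k , ℕₚ.≤-refl , v , ~-refl , v∈ , nr)
            by-cases (inj₂ (z , v~v′ , v′∈)) = raise (pull-back v~v′ (level-Ker k v′∈))

        level : ∀ v → v ~ 𝟎 ⊎ HasLevelBelow n v
        level v = by-cases (nonRadical-or-reduce n v)
          where
          by-cases : NonRadical n v ⊎ (∃ λ z → v ~ v ⊖ N z × K n (v ⊖ N z)) → v ~ 𝟎 ⊎ HasLevelBelow n v
          -- No level n arises, as blocks have size at most n: `Ker-stable` puts y into K n, which
          -- is orthogonal to N^n v.
          by-cases (inj₁ (y , y∈ , yv≉0)) = contradiction (trans (*-congˡ (K⊥imN^ n v (Ker-stable y∈))) (zeroʳ _)) yv≉0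
          by-cases (inj₂ (z , v~v′ , v′∈)) = pull-back v~v′ (level-Ker n v′∈)

        values : ∀ {j} → LevelType j → List Carrier
        values (absent _ _) = []
        values (line _ _ _) = fixedUnits
        values (plane _ _)  = fixedElems

        isLine isPresent : ∀ {j} → LevelType j → Bool
        isLine (absent _ _) = false
        isLine (line _ _ _) = true
        isLine (plane _ _)  = false
        isPresent (absent _ _) = false
        isPresent (line _ _ _) = true
        isPresent (plane _ _)  = true

        -- A present level contributes q values, less one on a line, where zero is not attained. The
        -- correction stands on the left to avoid truncated subtraction, and it sums up to b.
        length-values : ∀ {j} (t : LevelType j) →
          length (values t) ℕ.+ (if isLine t then 1 else 0) ≡ q ℕ.* (if isPresent t then 1 else 0)
        length-values (absent _ _) = ≡.sym (ℕₚ.*-zeroʳ q)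
        length-values (line _ _ _) = ≡.trans (ℕₚ.+-comm _ 1) (≡.trans length-fixedUnits (≡.sym (ℕₚ.*-identityʳ q)))
        length-values (plane _ _)  = ≡.trans (ℕₚ.+-identityʳ _) (≡.trans length-fixedElems (≡.sym (ℕₚ.*-identityʳ q)))

        values-distinct : ∀ {j} (t : LevelType j) → AllPairs (λ x y → ¬ x ≈ y) (values t)
        values-distinct (absent _ _) = []
        values-distinct (line _ _ _) = fixedUnits-distinct
        values-distinct (plane _ _)  = fixedElems-distinct

        values-complete : ∀ {j} (t : LevelType j) {w} → K (suc j) w → NonRadical j w → Any (pairing j w w ≈_) (values t)
        values-complete (absent none _) w∈ nr = contradiction nr (none w∈)
        values-complete {j} (line _ anisotropic _) w∈ nr = fixedUnits-complete (pairing-fixed j w∈) (anisotropic w∈ nr)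
        values-complete {j} (plane _ _) w∈ nr = fixedElems-complete (pairing-fixed j w∈)

        Attained : ℕ → Carrier → Set (c ⊔ ℓ)
        Attained j a = ∃ λ w → K (suc j) w × NonRadical j w × pairing j w w ≈ a

        private
          attain-unit : ∀ j {v a} → K (suc j) v → NonRadical j v → Fixed a → a ≉0 → Attained j a
          attain-unit j v∈ nr fa a≉0 = let w , w∈ , eq = realize-value j v∈ nr fa a≉0 in
            w , w∈ , anisotropic⇒nonRadical j w∈ (≉0-resp (sym eq) a≉0) , eq

        values-attained : ∀ {j} (t : LevelType j) → All (Attained j) (values t)
        values-attained (absent _ _) = []
        values-attained {j} (line (v , v∈ , nr) _ _) = All.map (λ (fa , a≉0) → attain-unit j v∈ nr fa a≉0) fixedUnits-all
        values-attained {j} (plane (v , v∈ , nr , vv≈0) _) = All.map (λ {a} fa → by-cases a fa (a ≟ 0#)) fixedElems-fixed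
          where
          by-cases : ∀ a → Fixed a → Dec (a ≈ 0#) → Attained j a
          by-cases a fa (yes a≈0) = v , v∈ , nr , trans vv≈0 (sym a≈0)
          by-cases a fa (no a≉0)  = attain-unit j v∈ nr fa a≉0

        Invariant : Set c
        Invariant = ℕ × Carrier

        _≈ᵢ_ : Invariant → Invariant → Set ℓ
        (i , a) ≈ᵢ (j , b) = i ≡ j × a ≈ b

        -- (0 , 0) is the invariant of the zero coset, (suc j , a) that of a coset meeting
        -- K (suc j) outside the radical, with a the value of the hermitian form there.
        HasInvariant : V n → Invariant → Set (c ⊔ ℓ)
        HasInvariant v (zero  , a) = v ~ 𝟎 × a ≈ 0#
        HasInvariant v (suc j , a) = ∃ λ w → v ~ w × K (suc j) w × NonRadical j w × pairing j w w ≈ a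

        invariants : ℕ → List Invariant
        invariants zero    = (0 , 0#) ∷ []
        invariants (suc k) = map (suc k ,_) (values (levelType k)) ++ invariants k

        private
          zero-listed : ∀ {P : Invariant → Set (c ⊔ ℓ)} k → P (0 , 0#) → Any P (invariants k)
          zero-listed zero    p = here p
          zero-listed (suc k) p = Anyₚ.++⁺ʳ _ (zero-listed k p)

          level-listed : ∀ {P : Invariant → Set (c ⊔ ℓ)} {j k} → j ℕ.< k →
            Any (λ a → P (suc j , a)) (values (levelType j)) → Any P (invariants k)
          level-listed {P} {j} j<k p = go (ℕₚ.≤⇒≤′ j<k)
            where
            go : ∀ {k} → suc j ℕ.≤′ k → Any P (invariants k)
            go ℕ.≤′-refl         = Anyₚ.++⁺ˡ (Anyₚ.map⁺ p)
            go (ℕ.≤′-step {k} i) = Anyₚ.++⁺ʳ (map (suc k ,_) (values (levelType k))) (go i)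

          levels-bounded : ∀ k → All (λ i → proj₁ i ℕ.≤ k) (invariants k)
          levels-bounded zero    = z≤n ∷ []
          levels-bounded (suc k) = Allₚ.++⁺ (Allₚ.map⁺ (All.tabulate (λ _ → ℕₚ.≤-refl)))
            (All.map ℕₚ.m≤n⇒m≤1+n (levels-bounded k))

        invariants-complete : ∀ v → Any (HasInvariant v) (invariants n)
        invariants-complete v = by-cases (level v)
          where
          by-cases : v ~ 𝟎 ⊎ HasLevelBelow n v → Any (HasInvariant v) (invariants n)
          by-cases (inj₁ v~𝟎) = zero-listed n (v~𝟎 , refl)
          by-cases (inj₂ (j , j<n , w , v~w , w∈ , nr)) = level-listed j<n
            (Any.map (λ eq → w , v~w , w∈ , nr , eq) (values-complete (levelType j) w∈ nr))

        invariant-determines : ∀ {v w i} → HasInvariant v i → HasInvariant w i → v ~ w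
        invariant-determines {i = zero , _} (v~𝟎 , _) (w~𝟎 , _) = ~-trans v~𝟎 (~-sym w~𝟎)
        invariant-determines {i = suc j , _} (v′ , v~v′ , v′∈ , v′-nr , eq) (w′ , w~w′ , w′∈ , w′-nr , eq′) =
          ~-trans v~v′ (~-trans (transitive-on-level j v′∈ w′∈ v′-nr w′-nr (trans eq (sym eq′))) (~-sym w~w′))

        invariant-unique : ∀ {v w i j} → v ~ w → HasInvariant v i → HasInvariant w j → i ≈ᵢ j
        invariant-unique {i = zero , _} {zero , _} _ (_ , a≈0) (_ , b≈0) = ≡.refl , trans a≈0 (sym b≈0)
        invariant-unique {i = zero , _} {suc j , _} v~w (v~𝟎 , _) (w′ , w~w′ , _ , nr , _) =
          contradiction (~-trans (~-sym w~w′) (~-trans (~-sym v~w) v~𝟎)) (levels-disjoint {0} z≤n nr ≋-refl)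
        invariant-unique {i = suc i , _} {zero , _} v~w (v′ , v~v′ , _ , nr , _) (w~𝟎 , _) =
          contradiction (~-trans (~-sym v~v′) (~-trans v~w w~𝟎)) (levels-disjoint {0} z≤n nr ≋-refl)
        invariant-unique {i = suc i , _} {suc j , _} v~w (v′ , v~v′ , v′∈ , v′-nr , eq) (w′ , w~w′ , w′∈ , w′-nr , eq′) =
          by-cases (ℕₚ.<-cmp i j) (~-trans (~-sym v~v′) (~-trans v~w w~w′)) v′∈ v′-nr eq w′∈ w′-nr eq′
          where
          by-cases : ∀ {i j a b v′ w′} → Tri (i ℕ.< j) (i ≡ j) (j ℕ.< i) → v′ ~ w′ →
            K (suc i) v′ → NonRadical i v′ → pairing i v′ v′ ≈ a →
            K (suc j) w′ → NonRadical j w′ → pairing j w′ w′ ≈ b → (suc i , a) ≈ᵢ (suc j , b)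
          by-cases (tri< i<j _ _) v′~w′ v′∈ _ _ _ w′-nr _ = contradiction (~-sym v′~w′) (levels-disjoint i<j w′-nr v′∈)
          by-cases (tri> _ _ j<i) v′~w′ _ v′-nr _ w′∈ _ _ = contradiction v′~w′ (levels-disjoint j<i v′-nr w′∈)
          by-cases {i} (tri≈ _ ≡.refl _) v′~w′ v′∈ _ eq w′∈ _ eq′ =
            ≡.refl , trans (sym eq) (trans (~-preserves-pairing i v′∈ w′∈ v′~w′) eq′)

        invariants-distinct : ∀ k → AllPairs (λ i j → ¬ i ≈ᵢ j) (invariants k)
        invariants-distinct zero    = [] ∷ []
        invariants-distinct (suc k) = AllPairsₚ.++⁺
          (AllPairsₚ.map⁺ (AllPairs.map (λ a≉b (_ , a≈b) → a≉b a≈b) (values-distinct (levelType k))))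
          (invariants-distinct k)
          (Allₚ.map⁺ (All.tabulate (λ _ → All.map (λ { i≤k (≡.refl , _) → ℕₚ.<⇒≱ ℕₚ.≤-refl i≤k }) (levels-bounded k))))

        invariants-attained : ∀ k → All (λ i → ∃ λ v → HasInvariant v i) (invariants k)
        invariants-attained zero    = (𝟎 , ~-refl , refl) ∷ []
        invariants-attained (suc k) = Allₚ.++⁺
          (Allₚ.map⁺ (All.map (λ (w , w∈ , nr , eq) → w , w , ~-refl , w∈ , nr , eq) (values-attained (levelType k))))
          (invariants-attained k)

        HasInvariant-resp-~ : ∀ {v w i} → v ~ w → HasInvariant w i → HasInvariant v i
        HasInvariant-resp-~ {i = zero , _} v~w (w~𝟎 , a≈0) = ~-trans v~w w~𝟎 , a≈0
        HasInvariant-resp-~ {i = suc j , _} v~w (w′ , w~w′ , rest) = w′ , ~-trans v~w w~w′ , rest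

        ≋⇒~ : ∀ {v w} → v ≋ w → v ~ w
        ≋⇒~ eq = ~-mod-N 𝟎 (≋-trans (≋⇒⊖≋𝟎 eq) (≋-sym N.zero-map))

        length-invariants : ∀ k → length (invariants k) ℕ.+ countB (λ j → isLine (levelType j)) (upTo k) ≡
          1 ℕ.+ q ℕ.* countB (λ j → isPresent (levelType j)) (upTo k)
        length-invariants zero    = ≡.cong suc (≡.sym (ℕₚ.*-zeroʳ q))
        length-invariants (suc k) = begin
          length (map (suc k ,_) (values t) ++ invariants k) ℕ.+ countB line? (upTo (suc k))
            ≡⟨ ≡.cong₂ ℕ._+_ (length-tagged (values t) (invariants k))
                 (countB-upTo line? k) ⟩
          (length (values t) ℕ.+ length (invariants k)) ℕ.+ (countB line? (upTo k) ℕ.+ (if isLine t then 1 else 0))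
            ≡⟨ NS.solve 4 (λ a b c d → (a NS.:+ b) NS.:+ (c NS.:+ d) NS.:= (b NS.:+ c) NS.:+ (a NS.:+ d)) ≡.refl
                 (length (values t)) (length (invariants k)) (countB line? (upTo k)) (if isLine t then 1 else 0) ⟩
          (length (invariants k) ℕ.+ countB line? (upTo k)) ℕ.+ (length (values t) ℕ.+ (if isLine t then 1 else 0))
            ≡⟨ ≡.cong₂ ℕ._+_ (length-invariants k) (length-values t) ⟩
          1 ℕ.+ q ℕ.* countB present? (upTo k) ℕ.+ q ℕ.* (if isPresent t then 1 else 0)
            ≡⟨ ≡.cong suc (ℕₚ.*-distribˡ-+ q _ _) ⟨
          1 ℕ.+ q ℕ.* (countB present? (upTo k) ℕ.+ (if isPresent t then 1 else 0))
            ≡⟨ ≡.cong (λ m → 1 ℕ.+ q ℕ.* m) (countB-upTo present? k) ⟨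
          1 ℕ.+ q ℕ.* countB present? (upTo (suc k)) ∎
          where
          open ≡.≡-Reasoning
          t = levelType k
          length-tagged : ∀ as (is : List Invariant) → length (map (suc k ,_) as ++ is) ≡ length as ℕ.+ length is
          length-tagged []       is = ≡.refl
          length-tagged (_ ∷ as) is = ≡.cong suc (length-tagged as is)
          line? present? : ℕ → Bool
          line? j = isLine (levelType j)
          present? j = isPresent (levelType j)

        -- The number of blocks of size exceeding j less that of size exceeding j + 1, so the
        -- multiplicity of j + 1 as a part.
        codim : ℕ → ℕ
        codim j = dim (Socle j) ℕ.∸ dim (Socle (suc j))

        private
          ≡ᵇ-false : ∀ {a b} → ¬ a ≡ b → (a ℕ.≡ᵇ b) ≡ false
          ≡ᵇ-false {a} {b} a≢b with a ℕ.≡ᵇ b in eq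
          ... | false = ≡.refl
          ... | true  = contradiction (ℕₚ.≡ᵇ⇒≡ a b (≡.subst Bool.T (≡.sym eq) _)) a≢b

          codim-absent : ∀ {j} → dim (Socle j) ≡ dim (Socle (suc j)) → codim j ≡ 0
          codim-absent {j} eq = ≡.trans (≡.cong (ℕ._∸ dim (Socle (suc j))) eq) (ℕₚ.n∸n≡0 (dim (Socle (suc j))))

          codim-line : ∀ {j} → dim (Socle j) ≡ suc (dim (Socle (suc j))) → codim j ≡ 1
          codim-line {j} eq = ≡.trans (≡.cong (ℕ._∸ dim (Socle (suc j))) eq) (ℕₚ.m+n∸n≡m 1 (dim (Socle (suc j))))

          codim-plane : ∀ {j} → suc (suc (dim (Socle (suc j)))) ℕ.≤ dim (Socle j) → 2 ℕ.≤ codim j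
          codim-plane {j} le = ℕₚ.m+n≤o⇒m≤o∸n 2 le

        codim≡1 : ∀ {j} (t : LevelType j) → (codim j ℕ.≡ᵇ 1) ≡ isLine t
        codim≡1 {j} (absent _ eq) = ≡.cong (ℕ._≡ᵇ 1) (codim-absent {j} eq)
        codim≡1 {j} (line _ _ eq) = ≡.cong (ℕ._≡ᵇ 1) (codim-line {j} eq)
        codim≡1 {j} (plane _ le)  = ≡ᵇ-false (λ eq → ℕₚ.<⇒≢ (codim-plane {j} le) (≡.sym eq))

        codim≢0 : ∀ {j} (t : LevelType j) → not (codim j ℕ.≡ᵇ 0) ≡ isPresent t
        codim≢0 {j} (absent _ eq) = ≡.cong (λ m → not (m ℕ.≡ᵇ 0)) (codim-absent {j} eq)
        codim≢0 {j} (line _ _ eq) = ≡.cong (λ m → not (m ℕ.≡ᵇ 0)) (codim-line {j} eq)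
        codim≢0 {j} (plane _ le)  = ≡.cong not (≡ᵇ-false (λ eq → ℕₚ.<⇒≢ (ℕₚ.<-trans (s≤s z≤n) (codim-plane {j} le)) (≡.sym eq)))

        jordan-multiplicity : ∀ j → (dim (Ker (suc j)) ℕ.∸ dim (Ker j)) ℕ.∸ (dim (Ker (suc (suc j))) ℕ.∸ dim (Ker (suc j))) ≡ codim j
        jordan-multiplicity j = ≡.cong₂ ℕ._∸_ (difference j) (difference (suc j))
          where
          difference : ∀ j → dim (Ker (suc j)) ℕ.∸ dim (Ker j) ≡ dim (Socle j)
          difference j = ≡.trans (≡.cong (ℕ._∸ dim (Ker j)) (dim-Ker-suc j)) (ℕₚ.m+n∸n≡m (dim (Socle j)) (dim (Ker j)))

      -- From the Boolean definitions to the relations of the proof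

      vecEq⇒≋ : ∀ {m} {v w : V m} → vecEq 𝔽 v w ≡ true → v ≋ w
      vecEq⇒≋ {m} {v} {w} eq = mk≋ λ i → does⁻ (v i ≟ w i) (allB⁻ (λ i → does (v i ≟ w i)) eq (∈-allFin i))

      ≋⇒vecEq : ∀ {m} {v w : V m} → v ≋ w → vecEq 𝔽 v w ≡ true
      ≋⇒vecEq {m} {v} {w} eq = allB⁺ (λ i → does (v i ≟ w i)) (allFin m) (λ {i} _ → dec-true (v i ≟ w i) (at eq i))

      matEq⇒app : ∀ {m} {A A′ : Mat 𝔽 m} → matEq 𝔽 A A′ ≡ true → ∀ v → app 𝔽 A v ≋ app 𝔽 A′ v
      matEq⇒app {m} {A} {A′} eq v = mk≋ λ i → sumF-cong m (λ j →
        *-congʳ (at (vecEq⇒≋ (allB⁻ (λ i → vecEq 𝔽 (A i) (A′ i)) eq (∈-allFin i))) j))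

      app⇒matEq : ∀ {m} {A A′ : Mat 𝔽 m} → (∀ v → app 𝔽 A v ≋ app 𝔽 A′ v) → matEq 𝔽 A A′ ≡ true
      app⇒matEq {m} {A} {A′} eq = allB⁺ (λ i → vecEq 𝔽 (A i) (A′ i)) (allFin m) (λ {i} _ → ≋⇒vecEq (mk≋ λ j →
        trans (sym (app-basis A j i)) (trans (at (eq (basis j)) i) (app-basis A′ j i))))

      -- `allMats` contains the matrix of f only up to equality of entries, so a listed matrix with
      -- the same action takes its place in the search of `orbitRel`.
      listed-matrix : ∀ {m} {f : V m → V m} → Linear f →
        ∃ λ M → M ∈ allMats 𝔽 m × ∀ v → app 𝔽 M v ≋ f v
      listed-matrix {m} {f} lf =
        let M , M∈ , eq = find (IsFinite.complete (vecFinite (vecFinite Carrier-finite m) m) (matrix f)) in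
        M , M∈ , λ v → ≋-trans (mk≋ λ i → sumF-cong m (λ j → *-congʳ (sym (at (at eq i) j)))) (app-matrix lf v)

      abstract
        inGU⇒isometry : ∀ {h : Mat 𝔽 n} → Herm.inGU 𝔽 q n H h ≡ true → ∀ v w → B (app 𝔽 h v) (app 𝔽 h w) ≈ B v w
        inGU⇒isometry {h} eq v w =
          let v′ , v′∈ , v≋v′ = find (V-complete v)
              w′ , w′∈ , w≋w′ = find (V-complete w)
          in trans (B-cong (Linear.cong (app-linear h) v≋v′) (Linear.cong (app-linear h) w≋w′))
            (trans (does⁻ (B (app 𝔽 h v′) (app 𝔽 h w′) ≟ B v′ w′)
              (allB⁻ (λ w → does (B (app 𝔽 h v′) (app 𝔽 h w) ≟ B v′ w))
                (allB⁻ (λ v → allB (λ w → does (B (app 𝔽 h v) (app 𝔽 h w) ≟ B v w)) (allVecs 𝔽 n)) eq v′∈) w′∈))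
            (B-cong (≋-sym v≋v′) (≋-sym w≋w′)))

      isometry⇒inGU : ∀ {h : Mat 𝔽 n} → (∀ v w → B (app 𝔽 h v) (app 𝔽 h w) ≈ B v w) → Herm.inGU 𝔽 q n H h ≡ true
      isometry⇒inGU {h} iso = allB⁺ _ (allVecs 𝔽 n) (λ {v} _ → allB⁺ _ (allVecs 𝔽 n) (λ {w} _ →
        dec-true (B (app 𝔽 h v) (app 𝔽 h w) ≟ B v w) (iso v w)))

      module _ (g : Mat 𝔽 n) (g∈GU : Herm.InGU 𝔽 q n H g) where
        open Isometry (app 𝔽 g) (app-linear g) (inGU⇒isometry g∈GU)

        private
          module GU = Herm 𝔽 q n H

          translates : Mat 𝔽 n → V n → V n → Bool
          translates h v w = anyB (λ u → vecEq 𝔽 (vsub 𝔽 (app 𝔽 h v) w) (IminusG 𝔽 g u)) (allVecs 𝔽 n)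

          centralizes : ∀ h → GU.inCent g h ≡ true → Centralizes (app 𝔽 h)
          centralizes h eq = record
            { linear = app-linear h ; isometry = inGU⇒isometry (proj₁ (∧⁻ {GU.inGU h} eq))
            ; commutes = λ x → ≋-trans (≋-sym (app-mmul h g x)) (≋-trans
                (matEq⇒app {A = mmul 𝔽 h g} {mmul 𝔽 g h} (proj₂ (∧⁻ {GU.inGU h} eq)) x) (app-mmul g h x)) }

          inCent : ∀ h M → Centralizes h → (∀ x → app 𝔽 M x ≋ h x) → GU.inCent g M ≡ true
          inCent h M ch M≋h = ∧⁺
            (isometry⇒inGU {M} (λ x y → trans (B-cong (M≋h x) (M≋h y)) (C.isometry x y)))
            (app⇒matEq {A = mmul 𝔽 M g} {mmul 𝔽 g M} (λ x → ≋-trans (app-mmul M g x) (≋-trans (M≋h _) (≋-trans (C.commutes x)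
              (≋-sym (≋-trans (app-mmul g M x) (Linear.cong (app-linear g) (M≋h x))))))))
            where module C = Centralizes ch

          translates⇒ : ∀ h v w → translates h v w ≡ true → ∃ λ u → app 𝔽 h v ⊖ w ≋ N u
          translates⇒ h v w eq =
            let u , _ , eq′ = anyB⁻ (λ u → vecEq 𝔽 (vsub 𝔽 (app 𝔽 h v) w) (IminusG 𝔽 g u)) (allVecs 𝔽 n) eq
            in u , vecEq⇒≋ eq′

          ⇒translates : ∀ h v w u → app 𝔽 h v ⊖ w ≋ N u → translates h v w ≡ true
          ⇒translates h v w u eq = let u′ , u′∈ , u≋u′ = find (V-complete u) in
            anyB⁺ (λ u → vecEq 𝔽 (vsub 𝔽 (app 𝔽 h v) w) (IminusG 𝔽 g u)) u′∈
              (≋⇒vecEq (≋-trans eq (N.cong u≋u′)))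

        orbitRel⇒~ : ∀ {v w} → GU.orbitRel g v w ≡ true → v ~ w
        orbitRel⇒~ {v} {w} eq =
          let h , _ , eq₁ = anyB⁻ (λ h → GU.inCent g h ∧ translates h v w) (allMats 𝔽 n) eq
          in app 𝔽 h , centralizes h (proj₁ (∧⁻ {GU.inCent g h} eq₁))
           , translates⇒ h v w (proj₂ (∧⁻ {GU.inCent g h} eq₁))

        ~⇒orbitRel : ∀ {v w} → v ~ w → GU.orbitRel g v w ≡ true
        ~⇒orbitRel {v} {w} (h , ch , u , eq) =
          let M , M∈ , M≋h = listed-matrix (Centralizes.linear ch)
          in anyB⁺ (λ h → GU.inCent g h ∧ translates h v w) M∈
            (∧⁺ (inCent h M ch M≋h) (⇒translates M v w u (≋-trans (⊖-cong (M≋h v) ≋-refl) eq)))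

        o≡length-invariants : GU.o g ≡ length (invariants n)
        o≡length-invariants = numClasses-invariants (GU.orbitRel g) _~_ orbitRel⇒~ ~⇒orbitRel ~-refl ~-sym ~-trans
          HasInvariant _≈ᵢ_ (allVecs 𝔽 n) (invariants n) invariants-complete
          (λ {v} {w} {i} → invariant-determines {v} {w} {i}) invariant-unique (invariants-distinct n)
          (All.map (λ {i} (v , vi) →
            let v′ , v′∈ , v≋v′ = find (V-complete v) in v′ , v′∈ , HasInvariant-resp-~ {v′} {v} {i} (≋⇒~ (≋-sym v≋v′)) vi)
            (invariants-attained n))

        N≡dim-Ker : ∀ k → GU.N g k ≡ dim (Ker k)
        N≡dim-Ker k = ≡.trans
          (≡.cong GU.dimFromCard (≡.trans (countB-filter (λ v → N^ k v ≋? 𝟎) kernel (allVecs 𝔽 n)) (card≡^dim (Ker k))))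
          (countB-powers order order>1 (dim-≤ (Ker k)))
          where
          kernel : ∀ v → isZero 𝔽 (iter 𝔽 k (IminusG 𝔽 g) v) ≡ does (N^ k v ≋? 𝟎)
          kernel v = ≡-does (N^ k v ≋? 𝟎) vecEq⇒≋ ≋⇒vecEq

        mult≡codim : ∀ j → GU.mult g (suc j) ≡ codim j
        mult≡codim j = ≡.trans
          (≡.cong₂ ℕ._∸_ (≡.cong₂ ℕ._∸_ (N≡dim-Ker (suc j)) (N≡dim-Ker j))
                         (≡.cong₂ ℕ._∸_ (N≡dim-Ker (suc (suc j))) (N≡dim-Ker (suc j))))
          (jordan-multiplicity j)

        orbit-count : GU.o g ℕ.+ GU.b g ≡ 1 ℕ.+ q ℕ.* GU.d g
        orbit-count = ≡.trans
          (≡.cong₂ ℕ._+_ o≡length-invariants (countB-cong (λ j →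
            ≡.trans (≡.cong (ℕ._≡ᵇ 1) (mult≡codim j)) (codim≡1 (levelType j))) (upTo n)))
          (≡.trans (length-invariants n) (≡.cong (λ m → 1 ℕ.+ q ℕ.* m) (≡.sym (countB-cong (λ j →
            ≡.trans (≡.cong (λ m → not (m ℕ.≡ᵇ 0)) (mult≡codim j)) (codim≢0 (levelType j))) (upTo n)))))

open import Data.Nat using (_+_; _*_; _^_; _≥_)

theorem4p1 : ∀ {c ℓ} (q : ℕ) → IsPrimePower q →
    (𝔽 : FiniteField c ℓ) → FiniteField.order 𝔽 ≡ q ^ 2 →
    (n : ℕ) → n ≥ 1 → (H : Mat 𝔽 n) →
    Herm.IsHermitian 𝔽 q n H → Herm.IsNondegenerate 𝔽 q n H →
    (g : Mat 𝔽 n) → Herm.InGU 𝔽 q n H g →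
    Herm.o 𝔽 q n H g + Herm.b 𝔽 q n H g ≡ 1 + q * Herm.d 𝔽 q n H g
theorem4p1 q pp 𝔽 order≡q² n _ H hermitian nondegenerate g g∈GU =
  orbit-count 𝔽 q pp order≡q² n H hermitian nondegenerate g g∈GU
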